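{- Let $k\ge 0$ be an integer. For $n=2k+2$, the map $\Phi:\mathrm{VHC}(S_{n-1})\to\widetilde{\mathcal P}^c(n)$ (defined in the context) restricts to a bijection $$\Phi':\mathrm{VHC}^k(S_{2k+1})\to\widetilde{\mathcal M}^c(2k+2).$$ In particular, $\left|\mathrm{VHC}^k(S_{2k+1})\right|=A_{k+1}$.
   Context: Lassalle's sequence $(A_m)_{m\geq 1}$ is defined by $A_1=1$ and $A_m=(-1)^{m-1}C_m+\sum_{j=1}^{m-1}(-1)^{j-1}\binom{2m-1}{2m-2j-1}A_{m-j}C_j$, where $C_n=\frac{1}{n+1}\binom{2n}{n}$. Valid hook configurations. $S_n$ is the set of permutations of $\{1,\ldots,n\}$, written $\pi=\pi_1\cdots\pi_n$. A descent of $\pi$ is an index $i\in\{1,\ldots,n-1\}$ with $\pi_i>\pi_{i+1}$. The plot of $\pi$ is the set of points $(i,\pi_i)$. A hook of $\pi$ is given by a southwest endpoint $(i,\pi_i)$ and a northeast endpoint $(j,\pi_j)$ with $i<j$ and $\pi_i<\pi_j$; it is the L-shaped set $(\{i\}\times[\pi_i,\pi_j])\cup([i,j]\times\{\pi_j\})$. If $\pi$ has descents $d_1<\cdots<d_k$, a valid hook configuration of $\pi$ is a tuple $\mathcal H=(H_1,\ldots,H_k)$ of hooks of $\pi$ such that: (1) for each $i$, the southwest endpoint of $H_i$ is $(d_i,\pi_{d_i})$; (2) no point of the plot lies directly above a hook (i.e., if a hook has endpoints $(i,\pi_i)$ and $(j,\pi_j)$ and $i<l<j$, then $\pi_l<\pi_j$);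 (3) hooks do not intersect each other, except that the northeast endpoint of one hook may be the southwest endpoint of another. $\mathrm{VHC}(\pi)$ is the set of valid hook configurations of $\pi$, and $\mathrm{VHC}(S_{n})=\bigcup_{\pi\in S_{n}}\mathrm{VHC}(\pi)$ (a disjoint union; a configuration carries its underlying permutation). $\mathrm{VHC}^h(S_{n})$ is the set of those with exactly $h$ hooks. Set partitions. For a partition $\rho$ of $\{1,\ldots,n\}$, two distinct blocks $B,B'$ form a crossing if there are $i,k\in B$ and $j,\ell\in B'$ with $i<j<k<\ell$ or $i>j>k>\ell$. The crossing graph $G(\rho)$ has the blocks of $\rho$ as vertices, two blocks being adjacent iff they form a crossing. $\widetilde{\mathcal P}^c(n)$ is the set of pairs $(\rho,\alpha)$ where $\rho$ is a partition of $\{1,\ldots,n\}$ with $G(\rho)$ connected and $\alpha$ is an acyclic orientation of $G(\rho)$ whose only source (vertex of in-degree $0$) is the block containing $n$. $\widetilde{\mathcal M}^c(2m)$ is the set of $(\rho,\alpha)\in\widetilde{\mathcal P}^c(2m)$ such that $\rho$ is a matching (all blocks have exactly $2$ elements). The map $\Phi$. Let $\mathcal H\in\mathrm{VHC}(\pi)$ with $\pi\in S_{n-1}$. Draw a blue "sky" above the plot and give the hooks distinct colors other than blue. A point $(l,\pi_l)$ that is not a northeast endpoint of a hook looks directly upward and gets the color of the first hook it sees, or blue if it sees no hook; a southwest endpoint of a hook looks around (on the left side of) the vertical part of that hook, so it does not see its own hook. (That is: among hooks with endpoints $(d,\pi_d)$, $(j,\pi_j)$ satisfying $d<l<j$, take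 the one with smallest $\pi_j$; the color is that hook's color, or blue if there is no such hook.) The northeast endpoint of a hook gets the color of that hook. Color $\pi_i$ like the point $(i,\pi_i)$, and color $n$ blue; this gives a partition $\rho$ of $\{1,\ldots,n\}$ into color classes. For a block $B$ let $\widehat B=\{i:1\le i\le n-1,\ \pi_i\in B\}$. Orient each edge of $G(\rho)$ between $B$ and $B'$ from $B$ to $B'$ if $\min\widehat B<\min\widehat{B'}$ and from $B'$ to $B$ otherwise; call this orientation $\alpha$. Then $\Phi(\mathcal H)=(\rho,\alpha)$. -}

module Defs where

open import Level as Level using (0ℓ)
open import Data.Nat.Base using (ℕ; zero; suc; _+_; _*_; _∸_; _/_; NonZero)
import Data.Nat.Properties as ℕ
open import Data.Nat.Combinatorics using (_C_)
open import Data.Integer.Base as ℤ using (ℤ; +_; -1ℤ)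
open import Data.Integer.Properties using (+-0-commutativeMonoid)
open import Algebra.Properties.CommutativeMonoid.Sum +-0-commutativeMonoid
  using (sum-syntax; sum-cong-≗)
open import Data.Fin.Base using (Fin; zero; suc; toℕ; fromℕ; inject₁; _<_; _≤_)
open import Data.Fin.Properties using (_≟_; _<?_; any?)
open import Data.Fin.Permutation as Perm
  using (Permutation′; _⟨$⟩ʳ_; _⟨$⟩ˡ_)
open import Data.Fin.Relation.Unary.Top using (view; ‵fromℕ; ‵inject₁)
open import Data.Fin.Subset using (Subset; _∈_; Nonempty; ∣_∣)
open import Data.List.Base as List using (List; []; _∷_; allFin; filter; length)
open import Data.List.Extrema.Nat using (argmin)
import Data.List.Membership.Propositional as List
open import Data.Maybe.Base using (Maybe; just; nothing)
open import Data.Product.Base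
  using (Σ; ∃; ∃-syntax; ∃₂; _×_; _,_; proj₁; proj₂)
open import Data.Product using (∃!)
open import Data.Sum.Base using (_⊎_)
open import Data.Vec.Base using (Vec; []; _∷_; head; lookup)
open import Function.Bundles using (_⇔_; Bijection)
import Function.Construct.Composition as Compose
import Function.Construct.Identity as Identity
import Function.Construct.Symmetry as Symmetry
open import Relation.Binary.Bundles using (Setoid)
open import Relation.Binary.Core using (Rel)
open import Relation.Binary.Construct.Closure.ReflexiveTransitive using (Star)
open import Relation.Binary.Construct.Closure.Transitive using (TransClosure)
import Relation.Binary.Construct.On as On
open import Relation.Binary.PropositionalEquality
  using (_≡_; _≢_; refl; sym; trans; cong; setoid)
open import Relation.Nullary using (¬_; Dec)
open import Relation.Nullary.Decidable using (_×-dec_)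
open import Relation.Unary using (Pred)

catalan : ℕ → ℕ
catalan n = ((2 * n) C n) / suc n

-- One step of the recurrence, computing A_{m+1} from a function with
-- previous j = A_{m-j}.  The summation index of the recurrence is
-- 1 + toℕ j.
lassalleStep : (m : ℕ) → (Fin m → ℤ) → ℤ
lassalleStep m previous =
  -1ℤ ℤ.^ m ℤ.* + catalan (1 + m)
  ℤ.+ ∑[ j < m ]
        ( -1ℤ ℤ.^ toℕ j
          ℤ.* + ((2 * (1 + m) ∸ 1) C (2 * (1 + m) ∸ 2 * (1 + toℕ j) ∸ 1))
          ℤ.* previous j
          ℤ.* + catalan (1 + toℕ j))

-- A_m ∷ A_{m-1} ∷ … ∷ A_1 ∷ []
lassalleTable : (m : ℕ) → Vec ℤ m
lassalleTable zero      = []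
lassalleTable (suc m) =
  lassalleStep m (lookup (lassalleTable m)) ∷ lassalleTable m

lassalle : (m : ℕ) → .{{NonZero m}} → ℤ
lassalle (suc m) = head (lassalleTable (suc m))

lookup-lassalleTable : ∀ m (j : Fin m) →
  lookup (lassalleTable m) j ≡ lassalle (1 + (m ∸ (1 + toℕ j)))
lookup-lassalleTable (suc m) zero    = refl
lookup-lassalleTable (suc m) (suc j) = lookup-lassalleTable m j

lassalle-recurrence : ∀ m →
  lassalle (1 + m) ≡
    lassalleStep m (λ j → lassalle (1 + (m ∸ (1 + toℕ j))))
lassalle-recurrence m =
  cong (λ s → -1ℤ ℤ.^ m ℤ.* + catalan (1 + m) ℤ.+ s)
    (sum-cong-≗ {m} λ j →
      cong (λ a → -1ℤ ℤ.^ toℕ j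
                  ℤ.* + ((2 * (1 + m) ∸ 1) C (2 * (1 + m) ∸ 2 * (1 + toℕ j) ∸ 1))
                  ℤ.* a
                  ℤ.* + catalan (1 + toℕ j))
           (lookup-lassalleTable m j))

-- The set {1,…,N} is represented by Fin N, shifted down by one.

module _ {N : ℕ} (π : Permutation′ N) where

  IsDescent : Pred (Fin N) 0ℓ
  IsDescent i = ∃[ j ] (toℕ j ≡ 1 + toℕ i × π ⟨$⟩ʳ j < π ⟨$⟩ʳ i)

  isDescent? : ∀ i → Dec (IsDescent i)
  isDescent? i = any? λ j →
    (toℕ j ℕ.≟ 1 + toℕ i) ×-dec (π ⟨$⟩ʳ j <? π ⟨$⟩ʳ i)

  -- In increasing order, because allFin is.
  descents : List (Fin N)
  descents = filter isDescent? (allFin N)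

Point : ℕ → Set
Point N = Fin N × Fin N

plot : ∀ {N} → Permutation′ N → Fin N → Point N
plot π i = i , π ⟨$⟩ʳ i

-- A hook with southwest endpoint plot π i and northeast endpoint
-- plot π j is represented by the pair of abscissae (i , j).
Hook : ℕ → Set
Hook N = Fin N × Fin N

sw ne : ∀ {N} → Hook N → Fin N
sw = proj₁
ne = proj₂

module _ {N : ℕ} (π : Permutation′ N) where

  IsHook : Pred (Hook N) 0ℓ
  IsHook h = sw h < ne h × π ⟨$⟩ʳ sw h < π ⟨$⟩ʳ ne h

  -- The lattice points of the L-shaped set drawn for h.  The segments of
  -- hooks are axis-parallel with integer endpoints, so two hooks meet in
  -- the plane iff they share a lattice point, and they share a
  -- nondegenerate segment only if they share two lattice points.
  OnHook : Hook N → Pred (Point N) 0ℓ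
  OnHook h (x , y) =
      (x ≡ sw h × π ⟨$⟩ʳ sw h ≤ y × y ≤ π ⟨$⟩ʳ ne h)
    ⊎ (sw h ≤ x × x ≤ ne h × y ≡ π ⟨$⟩ʳ ne h)

  NothingAbove : Pred (Hook N) 0ℓ
  NothingAbove h = ∀ l → sw h < l → l < ne h → π ⟨$⟩ʳ l < π ⟨$⟩ʳ ne h

  MeetOnlyAtEndpoints : Rel (Hook N) 0ℓ
  MeetOnlyAtEndpoints h h′ = ∀ p → OnHook h p → OnHook h′ p →
      (p ≡ plot π (ne h) × p ≡ plot π (sw h′))
    ⊎ (p ≡ plot π (sw h) × p ≡ plot π (ne h′))

  record VHC : Set where
    field
      hooks     : List (Hook N)
      isHook    : ∀ {h} → h List.∈ hooks → IsHook h
      southwest : List.map sw hooks ≡ descents π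
      nothingAbove : ∀ {h} → h List.∈ hooks → NothingAbove h
      nonIntersecting : ∀ {h h′} → h List.∈ hooks → h′ List.∈ hooks →
                        h ≢ h′ → MeetOnlyAtEndpoints h h′

open VHC public

VHC[S_] : ℕ → Set
VHC[S N ] = Σ (Permutation′ N) VHC

numHooks : ∀ {N} → VHC[S N ] → ℕ
numHooks (_ , H) = length (hooks H)

-- Configurations are compared by their underlying data, not by the
-- proofs they carry.
VHC[S_]-setoid : ℕ → Setoid 0ℓ 0ℓ
VHC[S N ]-setoid = record
  { Carrier = VHC[S N ]
  ; _≈_ = λ (π , H) (π′ , H′) → π Perm.≈ π′ × hooks H ≡ hooks H′
  ; isEquivalence = record
    { refl  = (λ _ → refl) , refl
    ; sym   = λ (p , q) → (λ i → sym (p i)) , sym q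
    ; trans = λ (p , q) (p′ , q′) → (λ i → trans (p i) (p′ i)) , trans q q′
    }
  }

VHC^_[S_]-setoid : ℕ → ℕ → Setoid 0ℓ 0ℓ
VHC^ h [S N ]-setoid =
  On.setoid {B = ∃ λ (H : VHC[S N ]) → numHooks H ≡ h} VHC[S N ]-setoid proj₁

-- A family of subsets, and a set of ordered pairs of subsets; both are
-- constrained by IsP̃ᶜ below.
record OrientedPartition (n : ℕ) : Set₁ where
  field
    ρ : Pred (Subset n) 0ℓ
    α : Rel (Subset n) 0ℓ

open OrientedPartition public

OrientedPartition-setoid : ℕ → Setoid (Level.suc 0ℓ) 0ℓ
OrientedPartition-setoid n = record
  { Carrier = OrientedPartition n
  ; _≈_ = λ P Q → (∀ B → ρ P B ⇔ ρ Q B) × (∀ B B′ → α P B B′ ⇔ α Q B B′)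
  ; isEquivalence = record
    { refl  = (λ _ → Identity.⇔-id _) , (λ _ _ → Identity.⇔-id _)
    ; sym   = λ (p , q) → (λ B → Symmetry.⇔-sym (p B))
                        , (λ B B′ → Symmetry.⇔-sym (q B B′))
    ; trans = λ (p , q) (p′ , q′) → (λ B → p′ B Compose.⇔-∘ p B)
                                  , (λ B B′ → q′ B B′ Compose.⇔-∘ q B B′)
    }
  }

module _ {n : ℕ} where

  record IsPartition (ρ : Pred (Subset n) 0ℓ) : Set where
    field
      nonempty : ∀ {B} → ρ B → Nonempty B
      covered  : ∀ v → ∃! _≡_ λ B → ρ B × v ∈ B

  Crossing : Rel (Subset n) 0ℓ
  Crossing B B′ = ∃₂ λ i k → ∃₂ λ j l →
    i ∈ B × k ∈ B × j ∈ B′ × l ∈ B′ ×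
    ((i < j × j < k × k < l) ⊎ (l < k × k < j × j < i))

  -- The edge relation of the crossing graph G(ρ).
  Adjacent : Pred (Subset n) 0ℓ → Rel (Subset n) 0ℓ
  Adjacent ρ B B′ = ρ B × ρ B′ × B ≢ B′ × Crossing B B′

  Connected : Pred (Subset n) 0ℓ → Set
  Connected ρ = ∀ {B B′} → ρ B → ρ B′ → Star (Adjacent ρ) B B′

  record IsOrientation (ρ : Pred (Subset n) 0ℓ) (α : Rel (Subset n) 0ℓ) : Set where
    field
      edge     : ∀ {B B′} → α B B′ → Adjacent ρ B B′
      oriented : ∀ {B B′} → Adjacent ρ B B′ → α B B′ ⊎ α B′ B
      oneWay   : ∀ {B B′} → α B B′ → ¬ α B′ B

  Acyclic : Rel (Subset n) 0ℓ → Set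
  Acyclic α = ∀ B → ¬ TransClosure α B B

  IsSource : Rel (Subset n) 0ℓ → Pred (Subset n) 0ℓ
  IsSource α B = ∀ B′ → ¬ α B′ B

-- The largest element of {1,…,1+N} is fromℕ N.
record IsP̃ᶜ {N : ℕ} (P : OrientedPartition (1 + N)) : Set where
  field
    isPartition   : IsPartition (ρ P)
    connected     : Connected (ρ P)
    isOrientation : IsOrientation (ρ P) (α P)
    acyclic       : Acyclic (α P)
    onlySource    : ∀ {B} → ρ P B → IsSource (α P) B ⇔ fromℕ N ∈ B

IsMatching : ∀ {n} → Pred (Subset n) 0ℓ → Set
IsMatching ρ = ∀ {B} → ρ B → ∣ B ∣ ≡ 2

IsM̃ᶜ : ∀ {N} → OrientedPartition (1 + N) → Set
IsM̃ᶜ P = IsP̃ᶜ P × IsMatching (ρ P)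

M̃ᶜ-setoid : (n : ℕ) → .{{NonZero n}} → Setoid (Level.suc 0ℓ) 0ℓ
M̃ᶜ-setoid n@(suc N) =
  On.setoid {B = ∃ λ (P : OrientedPartition n) → IsM̃ᶜ P}
    (OrientedPartition-setoid n) proj₁

-- Hooks serve as their own colours; nothing is blue.
Colour : ℕ → Set
Colour N = Maybe (Hook N)

module _ {N : ℕ} (π : Permutation′ N) (H : VHC π) where

  -- The first hook seen when looking upward from the l-th point.
  lookUp : Fin N → Colour N
  lookUp l with filter (λ h → (sw h <? l) ×-dec (l <? ne h)) (hooks H)
  ... | []     = nothing
  ... | h ∷ hs = just (argmin (λ h′ → toℕ (π ⟨$⟩ʳ ne h′)) h hs)

  -- At most one hook has its northeast endpoint at l, by nonIntersecting.
  pointColour : Fin N → Colour N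
  pointColour l with filter (λ h → ne h ≟ l) (hooks H)
  ... | []    = lookUp l
  ... | h ∷ _ = just h

  colour : Fin (1 + N) → Colour N
  colour v with view v
  ... | ‵fromℕ     = nothing
  ... | ‵inject₁ y = pointColour (π ⟨$⟩ˡ y)

  ColourClass : Pred (Subset (1 + N)) 0ℓ
  ColourClass B = ∃[ v ] ∀ w → w ∈ B ⇔ colour w ≡ colour v

IsMin : ∀ {N} → Fin N → Pred (Fin N) 0ℓ → Set
IsMin i P = P i × (∀ j → P j → i ≤ j)

module _ {N : ℕ} (π : Permutation′ N) where

  -- B̂, the set of positions of the entries of π lying in B.
  Hat : Subset (1 + N) → Pred (Fin N) 0ℓ
  Hat B i = inject₁ (π ⟨$⟩ʳ i) ∈ B

  MinHat< : Rel (Subset (1 + N)) 0ℓ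
  MinHat< B B′ = ∃₂ λ i i′ → IsMin i (Hat B) × IsMin i′ (Hat B′) × i < i′

Φ : ∀ {N} → VHC[S N ] → OrientedPartition (1 + N)
Φ (π , H) = record
  { ρ = ColourClass π H
  ; α = λ B B′ → Adjacent (ColourClass π H) B B′ × MinHat< π B B′
  }

HasCardinality : ∀ {c ℓ} → Setoid c ℓ → ℕ → Set _
HasCardinality S m = Bijection S (setoid (Fin m))

{-# OPTIONS --safe #-}
-- A configuration with k hooks on 2k + 1 points has room only for the first point and, for
-- each hook, its descent bottom and its northeast end.  Read from left to right, descent
-- bottoms are pushes and northeast ends are pops, so the configuration is a binary tree whose
-- nodes are the arcs {descent bottom, northeast end}.  Together with the arc from the first
-- entry to the largest label these are the blocks of Φ, and α orients crossing arcs in the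
-- order of the pushes.  Conversely, a matching with an acyclic orientation is a heap of arcs:
-- dropping the pieces one after another, each finds its place in the tree, and the tree
-- depends on the heap only.  That Φ lands in P̃ᶜ for any number of hooks holds because every
-- non-blue block crosses a block that starts earlier, found by following hooks to the left.
--
-- For the count, split a tree at its first pop.  This gives a recurrence for the number of
-- trees with p letters below the root and q above it, whose exponential generating function
-- is M(x) M(y) / M(x + y), where M is the moment generating function of the semicircle law of
-- variance -1, the signed Catalan numbers.  Integrating over x + y = t turns this into
-- A(t) = - M′(t) / M(t), which is Lassalle's recurrence.
module Submission where

-- Trees stand between the two sides because both can be read off them. As a word, a tree is a
-- permutation whose hooks join the letter before a push to the matching pop; as a list of arcs, it
-- is a matching with a linear extension of its orientation. The obstacle is that one orientation
-- has many linear extensions. Orders of arcs are therefore compared on crossing pairs only, and a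
-- dropped arc gets a position behind which no arc crosses it. Inside a subtree, crossing must also
-- take into account the label that closes the subtree, hence `arcs t β` instead of `inner t`.
--
-- In the count no quotient of power series is formed. The identity is G(x, y) M(x + y) = M(x) M(y),
-- coefficient by coefficient over the integers, with G known only through its recurrence. It holds
-- because the products M(x) M(y) satisfy a recurrence of the same form, which expresses a
-- decomposition of noncrossing matchings. The recurrence descends on p + q and not on p or q alone;
-- the first argument of `g` is the bound that makes it structural.

open import Defs
open import Data.Nat.Base as ℕ using (ℕ; zero; suc; s≤s; z≤n)
import Data.Nat.Properties as ℕ
open import Data.Nat.Induction using (<-wellFounded; Acc; acc)
open import Data.Fin.Base using (Fin; zero; suc; toℕ; fromℕ; fromℕ<; inject₁; cast; _<_; _≤_)
open import Data.Fin.Properties using (_≟_; _<?_; toℕ-injective; toℕ-inject₁; inject₁-injective; toℕ<n; toℕ-fromℕ; toℕ-fromℕ<; toℕ≤pred[n]; toℕ-cast; cast-involutive; ≤fromℕ; fromℕ≢inject₁)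
open import Data.Fin.Permutation as Perm using (Permutation′; permutation; _⟨$⟩ʳ_; _⟨$⟩ˡ_; inverseˡ; inverseʳ)
open import Data.Fin.Relation.Unary.Top using (view; ‵fromℕ; ‵inject₁; view-fromℕ; view-inject₁)
open import Data.Fin.Subset using (Subset; ⁅_⁆; _∪_; ∣_∣; ⊥) renaming (_∈_ to _∈ˢ_)
open import Data.List.Base using (List; []; _∷_; _++_; map; concatMap; cartesianProductWith; filter; allFin; length; lookup)
open import Data.List.Properties using (∷-injective; ++-assoc; ++-identityʳ; length-++; length-++-sucʳ; length-map; length-tabulate; filter-≐)
open import Data.List.Membership.Propositional using (_∈_; _∉_; find; lose)
open import Data.List.Membership.Propositional.Properties using (∈-++⁺ˡ; ∈-++⁺ʳ; ∈-++⁻; ∈-∃++; ∈-map⁺; ∈-map⁻; ∈-filter⁺; ∈-filter⁻; ∈-concatMap⁺; ∈-concatMap⁻; ∈-cartesianProductWith⁺; ∈-cartesianProductWith⁻; ∈-allFin; ∈-lookup)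
import Data.List.Membership.DecPropositional as DecMembership
open import Data.List.Relation.Unary.Any as Any using (Any; here; there; index)
open import Data.List.Relation.Unary.Any.Properties using (lookup-index)
open import Data.List.Relation.Unary.All as All using (All; []; _∷_)
import Data.List.Relation.Unary.All.Properties as All
open import Data.List.Relation.Unary.AllPairs as AllPairs using (AllPairs; []; _∷_)
import Data.List.Relation.Unary.AllPairs.Properties as AllPairs
open import Data.List.Relation.Unary.Unique.Propositional using (Unique)
import Data.List.Relation.Unary.Unique.Propositional.Properties as Unique
open import Data.Maybe.Base using (just; nothing)
open import Data.Maybe.Properties using (just-injective)
open import Data.Product.Base using (Σ; Σ-syntax; ∃; ∃₂; ∃-syntax; _×_; _,_; proj₁; proj₂)
open import Data.Sum.Base using (_⊎_; inj₁; inj₂)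
open import Function.Bundles using (_⇔_; mk⇔; Equivalence; Bijection)
open import Relation.Binary.Bundles using (Setoid)
open import Relation.Binary.Construct.Closure.Transitive as Transitive using (TransClosure; [_]; _∷_)
open import Relation.Binary.Definitions using (tri<; tri≈; tri>)
open import Relation.Binary.PropositionalEquality
open import Relation.Nullary using (¬_; Dec; yes; no; does; contradiction; ¬?)
open import Relation.Nullary.Decidable using (_×-dec_; _⊎-dec_)
open import Relation.Unary using (Decidable)

-- Binomial sums and the generating function identity for trees

module Sums where
  open import Data.Integer.Base using (ℤ; _+_; _*_; -_; 0ℤ; 1ℤ)
  open import Data.Integer.Properties
  open import Data.Integer.Tactic.RingSolver using (solve-∀)

  Summand : Set
  Summand = ℕ → ℕ → ℤ

  -- The indices are the numbers of elements before and after a marked element of an n-element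
  -- chain. On exponential generating functions this is the integral of F(x, t - x) over x from 0 to
  -- t.
  sumC : ℕ → Summand → ℤ
  sumC zero    F = 0ℤ
  sumC (suc n) F = F 0 n + sumC n (λ i j → F (suc i) j)

  -- A sum over the subsets of an n-element set, with F taken at the sizes of subset and complement;
  -- on exponential generating functions it is the product. Deciding on one element at a time,
  -- instead of using binomial coefficients, makes the regrouping lemmas plain inductions.
  sumS : ℕ → Summand → ℤ
  sumS zero    F = F 0 0
  sumS (suc n) F = sumS n (λ i j → F (suc i) j) + sumS n (λ i j → F i (suc j))

  sumC-cong : ∀ n {F G : Summand} → (∀ i j → suc (i ℕ.+ j) ≡ n → F i j ≡ G i j) → sumC n F ≡ sumC n G
  sumC-cong zero    h = refl
  sumC-cong (suc n) h = cong₂ _+_ (h 0 n refl) (sumC-cong n λ i j e → h (suc i) j (cong suc e))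

  sumS-cong : ∀ n {F G : Summand} → (∀ i j → i ℕ.+ j ≡ n → F i j ≡ G i j) → sumS n F ≡ sumS n G
  sumS-cong zero    h = h 0 0 refl
  sumS-cong (suc n) h = cong₂ _+_
    (sumS-cong n λ i j e → h (suc i) j (cong suc e))
    (sumS-cong n λ i j e → h i (suc j) (trans (ℕ.+-suc i j) (cong suc e)))

  -- Linearity is all that is needed to exchange two sums, so `sumC-swap` and `sumS-swap` serve for
  -- every combination of the two kinds.
  record IsSum (L : Summand → ℤ) : Set where
    field
      ≗-cong : ∀ {F G : Summand} → (∀ i j → F i j ≡ G i j) → L F ≡ L G
      +-homo : ∀ F G → L (λ i j → F i j + G i j) ≡ L F + L G
      *-homo : ∀ x F → L (λ i j → x * F i j) ≡ x * L F

    0-homo : L (λ _ _ → 0ℤ) ≡ 0ℤ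
    0-homo = *-homo 0ℤ (λ _ _ → 0ℤ)

  open IsSum

  interchange : ∀ a b c d → (a + b) + (c + d) ≡ (a + c) + (b + d)
  interchange = solve-∀

  sumC-isSum : ∀ n → IsSum (sumC n)
  sumC-isSum n .≗-cong h = sumC-cong n λ i j _ → h i j
  sumC-isSum zero .+-homo F G = refl
  sumC-isSum (suc n) .+-homo F G =
    trans (cong (F 0 n + G 0 n +_) (sumC-isSum n .+-homo _ _)) (interchange (F 0 n) (G 0 n) _ _)
  sumC-isSum zero .*-homo x F = sym (*-zeroʳ x)
  sumC-isSum (suc n) .*-homo x F =
    trans (cong (x * F 0 n +_) (sumC-isSum n .*-homo x _)) (sym (*-distribˡ-+ x (F 0 n) _))

  sumS-isSum : ∀ n → IsSum (sumS n)
  sumS-isSum n .≗-cong h = sumS-cong n λ i j _ → h i j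
  sumS-isSum zero .+-homo F G = refl
  sumS-isSum (suc n) .+-homo F G =
    trans (cong₂ _+_ (sumS-isSum n .+-homo _ _) (sumS-isSum n .+-homo _ _))
          (interchange (sumS n _) (sumS n _) (sumS n _) (sumS n _))
  sumS-isSum zero .*-homo x F = refl
  sumS-isSum (suc n) .*-homo x F =
    trans (cong₂ _+_ (sumS-isSum n .*-homo x _) (sumS-isSum n .*-homo x _))
          (sym (*-distribˡ-+ x (sumS n _) (sumS n _)))

  sumC-swap : ∀ {L} → IsSum L → ∀ n (F : ℕ → ℕ → Summand) →
    L (λ a b → sumC n (F a b)) ≡ sumC n (λ i j → L (λ a b → F a b i j))
  sumC-swap s zero    F = 0-homo s
  sumC-swap {L} s (suc n) F = trans (+-homo s _ _)
    (cong (L (λ a b → F a b 0 n) +_) (sumC-swap s n λ a b i j → F a b (suc i) j))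

  sumS-swap : ∀ {L} → IsSum L → ∀ n (F : ℕ → ℕ → Summand) →
    L (λ a b → sumS n (F a b)) ≡ sumS n (λ i j → L (λ a b → F a b i j))
  sumS-swap s zero    F = refl
  sumS-swap s (suc n) F = trans (+-homo s _ _)
    (cong₂ _+_ (sumS-swap s n λ a b i j → F a b (suc i) j) (sumS-swap s n λ a b i j → F a b i (suc j)))

  *-homoʳ : ∀ {L} → IsSum L → ∀ F x → L (λ i j → F i j * x) ≡ L F * x
  *-homoʳ s F x = trans (≗-cong s λ i j → *-comm (F i j) x) (trans (*-homo s x F) (*-comm x _))

  -- A subset of a disjoint union is a pair of subsets.
  sumS-vandermonde : ∀ m n (F : Summand) →
    sumS m (λ i i′ → sumS n (λ j j′ → F (i ℕ.+ j) (i′ ℕ.+ j′))) ≡ sumS (m ℕ.+ n) F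
  sumS-vandermonde zero    n F = refl
  sumS-vandermonde (suc m) n F =
    cong₂ _+_ (sumS-vandermonde m n λ i j → F (suc i) j) (sumS-vandermonde m n λ i j → F i (suc j))

  -- Both sides run over the ways to divide a set into three parts.
  sumS-assoc : ∀ n (F : ℕ → Summand) →
    sumS n (λ i r → sumS i (λ a b → F a b r)) ≡ sumS n (λ a r → sumS r (F a))
  sumS-assoc zero    F = refl
  sumS-assoc (suc n) F = begin
    sumS n (λ i r → sumS i (λ a b → F (suc a) b r) + sumS i (λ a b → F a (suc b) r))
      + sumS n (λ i r → sumS i (λ a b → F a b (suc r)))
      ≡⟨ cong (_+ sumS n (λ i r → sumS i (λ a b → F a b (suc r)))) (+-homo (sumS-isSum n) _ _) ⟩
    sumS n (λ i r → sumS i (λ a b → F (suc a) b r)) + sumS n (λ i r → sumS i (λ a b → F a (suc b) r))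
      + sumS n (λ i r → sumS i (λ a b → F a b (suc r)))
      ≡⟨ cong₂ _+_ (cong₂ _+_ (sumS-assoc n λ a → F (suc a)) (sumS-assoc n λ a b r → F a (suc b) r))
                   (sumS-assoc n λ a b r → F a b (suc r)) ⟩
    X + Y + Z
      ≡⟨ +-assoc X Y Z ⟩
    X + (Y + Z)
      ≡⟨ cong (X +_) (+-homo (sumS-isSum n) _ _) ⟨
    sumS (suc n) (λ a r → sumS r (F a)) ∎
    where
    open ≡-Reasoning
    X = sumS n (λ a r → sumS r (F (suc a)))
    Y = sumS n (λ a r → sumS r (λ b c → F a (suc b) c))
    Z = sumS n (λ a r → sumS r (λ b c → F a b (suc c)))

  -- Choosing a subset and a point of it is choosing a point and subsets of
  -- what lies before and after it.
  sumS-sumC : ∀ q (F : ℕ → ℕ → ℕ → ℤ) →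
    sumS q (λ j j′ → sumC j (λ z y → F z y j′)) ≡
    sumC q (λ Z Y → sumS Z (λ z z′ → sumS Y (λ y y′ → F z y (z′ ℕ.+ y′))))
  sumS-sumC zero    F = refl
  sumS-sumC (suc q) F = begin
    sumS q (λ j j′ → F 0 j j′ + sumC j (λ z y → F (suc z) y j′)) + sumS q (λ j j′ → sumC j (λ z y → F z y (suc j′)))
      ≡⟨ cong (_+ sumS q (λ j j′ → sumC j (λ z y → F z y (suc j′)))) (+-homo (sumS-isSum q) _ _) ⟩
    X + sumS q (λ j j′ → sumC j (λ z y → F (suc z) y j′)) + sumS q (λ j j′ → sumC j (λ z y → F z y (suc j′)))
      ≡⟨ cong₂ (λ u v → X + u + v) (sumS-sumC q λ z → F (suc z)) (sumS-sumC q λ z y r → F z y (suc r)) ⟩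
    X + Y + Z
      ≡⟨ +-assoc X Y Z ⟩
    X + (Y + Z)
      ≡⟨ cong (X +_) (+-homo (sumC-isSum q) _ _) ⟨
    sumC (suc q) (λ Z Y → sumS Z (λ z z′ → sumS Y (λ y y′ → F z y (z′ ℕ.+ y′)))) ∎
    where
    open ≡-Reasoning
    X = sumS q (F 0)
    Y = sumC q (λ Z Y → sumS Z (λ z z′ → sumS Y (λ y y′ → F (suc z) y (z′ ℕ.+ y′))))
    Z = sumC q (λ Z Y → sumS Z (λ z z′ → sumS Y (λ y y′ → F z y (suc (z′ ℕ.+ y′)))))

  -- Both sides run over the ways to mark two elements of a chain.
  sumC-assoc : ∀ p (F : ℕ → Summand) →
    sumC p (λ S l → sumC S (λ i j → F i j l)) ≡ sumC p (λ i r → sumC r (F i))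
  sumC-assoc zero    F = refl
  sumC-assoc (suc p) F = begin
    0ℤ + sumC p (λ S l → F 0 S l + sumC S (λ i j → F (suc i) j l))
      ≡⟨ +-identityˡ _ ⟩
    sumC p (λ S l → F 0 S l + sumC S (λ i j → F (suc i) j l))
      ≡⟨ +-homo (sumC-isSum p) _ _ ⟩
    sumC p (F 0) + sumC p (λ S l → sumC S (λ i j → F (suc i) j l))
      ≡⟨ cong (sumC p (F 0) +_) (sumC-assoc p λ i → F (suc i)) ⟩
    sumC (suc p) (λ i r → sumC r (F i)) ∎
    where open ≡-Reasoning

  sumC-+ : ∀ p q (F : Summand) →
    sumC (p ℕ.+ q) F ≡ sumC p (λ i j → F i (j ℕ.+ q)) + sumC q (λ i j → F (p ℕ.+ i) j)
  sumC-+ zero    q F = sym (+-identityˡ _)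
  sumC-+ (suc p) q F = trans (cong (F 0 (p ℕ.+ q) +_) (sumC-+ p q λ i → F (suc i))) (sym (+-assoc (F 0 (p ℕ.+ q)) _ _))

  δ : Summand
  δ zero    zero    = 1ℤ
  δ zero    (suc _) = 0ℤ
  δ (suc _) _       = 0ℤ

  sumS-zero : ∀ n {F : Summand} → (∀ i j → F i j ≡ 0ℤ) → sumS n F ≡ 0ℤ
  sumS-zero n h = trans (sumS-isSum n .≗-cong h) (0-homo (sumS-isSum n))

  sumS-δ : ∀ p q (f : ℕ → ℤ) → sumS p (λ i i′ → sumS q (λ j j′ → δ i j * f (i′ ℕ.+ j′))) ≡ f (p ℕ.+ q)
  sumS-δ zero zero f = *-identityˡ (f 0)
  sumS-δ zero (suc q) f =
    trans (cong₂ _+_ (sumS-zero q λ _ _ → refl) (sumS-δ zero q λ i → f (suc i))) (+-identityˡ _)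
  sumS-δ (suc p) q f =
    trans (cong₂ _+_ (sumS-zero p λ _ _ → sumS-zero q λ _ _ → refl) (sumS-δ p q λ i → f (suc i))) (+-identityˡ _)

  -- g n p q, for n > p + q, is the number of valid trees with p labels below the root and q above it.
  g : ℕ → Summand
  g zero    p q = 0ℤ
  g (suc n) p q = δ p q +
    sumC q λ Z Y → sumC p λ S S′ →
      sumS S λ s r → sumS (S′ ℕ.+ Z) λ u r′ → g n s u * g n (r ℕ.+ r′) Y

  module _ (m : ℕ → ℤ) (m-zero : m 0 ≡ 1ℤ) (m-suc : ∀ n → m (suc n) ≡ - sumC n (λ i j → m i * m j)) where

    -- Up to sign, `m k` counts the noncrossing matchings of k points on a line. Among those of p +
    -- q points, the ones without an arc between the first p and the last q points give `m p * m q`.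
    -- In the others, the outermost such arc has S points to its left, S′ + Z points under it and Y
    -- points to its right, and contributes a factor -1. The proof is an induction on p that removes
    -- the arc at the first point.
    m-* : ∀ n p q → p ℕ.< n →
      m p * m q ≡ m (p ℕ.+ q) + sumC p (λ S S′ → m S * sumC q (λ Z Y → m (S′ ℕ.+ Z) * m Y))
    m-* n zero q p<n = trans (cong (_* m q) m-zero) (trans (*-identityˡ (m q)) (sym (+-identityʳ (m q))))
    m-* (suc n) (suc p) q (s≤s p<n) = begin
      m (suc p) * m q
        ≡⟨ cong (_* m q) (m-suc p) ⟩
      - sumC p (λ i j → m i * m j) * m q
        ≡⟨ neg-distribˡ-* (sumC p (λ i j → m i * m j)) (m q) ⟨
      - (sumC p (λ i j → m i * m j) * m q)
        ≡⟨ cong -_ (*-homoʳ (sumC-isSum p) (λ i j → m i * m j) (m q)) ⟨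
      - sumC p (λ i j → m i * m j * m q)
        ≡⟨ cong -_ (sumC-cong p step) ⟩
      - sumC p (λ i j → m i * m (j ℕ.+ q) + sumC j (λ S S′ → m i * m S * X S′))
        ≡⟨ cong -_ (+-homo (sumC-isSum p) _ _) ⟩
      - (A + sumC p (λ i j → sumC j (λ S S′ → m i * m S * X S′)))
        -- Terms with the same S′ are gathered; by `m-suc`, the products `m i * m S` with i + S + 1
        -- = T add up to minus `m (suc T)`.
        ≡⟨ cong (λ u → - (A + u)) (sumC-assoc p (λ i S S′ → m i * m S * X S′)) ⟨
      - (A + sumC p (λ T S′ → sumC T (λ i S → m i * m S * X S′)))
        ≡⟨ cong (λ u → - (A + u)) (sumC-cong p (λ T S′ _ → step′ T S′)) ⟩
      - (A + sumC p (λ T S′ → - 1ℤ * (m (suc T) * X S′)))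
        ≡⟨ cong (λ u → - (A + u)) (*-homo (sumC-isSum p) (- 1ℤ) (λ T S′ → m (suc T) * X S′)) ⟩
      - (A + - 1ℤ * B)
        -- `X p` is both the part i ≥ p of the recurrence for `m (suc (p + q))` and the term S = 0
        -- of the sum over S.
        ≡⟨ algebra A B (X p) ⟩
      - (A + X p) + (1ℤ * X p + B)
        ≡⟨ cong₂ (λ u v → - u + (v * X p + B)) (sumC-+ p q (λ i j → m i * m j)) m-zero ⟨
      - sumC (p ℕ.+ q) (λ i j → m i * m j) + (m 0 * X p + B)
        ≡⟨ cong (_+ (m 0 * X p + B)) (m-suc (p ℕ.+ q)) ⟨
      m (suc p ℕ.+ q) + sumC (suc p) (λ S S′ → m S * X S′) ∎
      where
      open ≡-Reasoning
      X : ℕ → ℤ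
      X S′ = sumC q (λ Z Y → m (S′ ℕ.+ Z) * m Y)
      A = sumC p (λ i j → m i * m (j ℕ.+ q))
      B = sumC p (λ S S′ → m (suc S) * X S′)
      algebra : ∀ a b x → - (a + - 1ℤ * b) ≡ - (a + x) + (1ℤ * x + b)
      algebra = solve-∀
      step : ∀ i j → suc (i ℕ.+ j) ≡ p →
        m i * m j * m q ≡ m i * m (j ℕ.+ q) + sumC j (λ S S′ → m i * m S * X S′)
      step i j e = begin
        m i * m j * m q
          ≡⟨ *-assoc (m i) (m j) (m q) ⟩
        m i * (m j * m q)
          ≡⟨ cong (m i *_) (m-* n j q (ℕ.≤-trans (ℕ.s≤s (ℕ.m≤n+m j i)) (ℕ.≤-trans (ℕ.≤-reflexive e) (ℕ.<⇒≤ p<n)))) ⟩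
        m i * (m (j ℕ.+ q) + sumC j (λ S S′ → m S * X S′))
          ≡⟨ *-distribˡ-+ (m i) (m (j ℕ.+ q)) _ ⟩
        m i * m (j ℕ.+ q) + m i * sumC j (λ S S′ → m S * X S′)
          ≡⟨ cong (m i * m (j ℕ.+ q) +_) (*-homo (sumC-isSum j) (m i) (λ S S′ → m S * X S′)) ⟨
        m i * m (j ℕ.+ q) + sumC j (λ S S′ → m i * (m S * X S′))
          ≡⟨ cong (m i * m (j ℕ.+ q) +_) (≗-cong (sumC-isSum j) λ S S′ → *-assoc (m i) (m S) (X S′)) ⟨
        m i * m (j ℕ.+ q) + sumC j (λ S S′ → m i * m S * X S′) ∎
      step′ : ∀ T S′ → sumC T (λ i S → m i * m S * X S′) ≡ - 1ℤ * (m (suc T) * X S′)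
      step′ T S′ = begin
        sumC T (λ i S → m i * m S * X S′)
          ≡⟨ *-homoʳ (sumC-isSum T) (λ i S → m i * m S) (X S′) ⟩
        sumC T (λ i S → m i * m S) * X S′
          ≡⟨ neg (sumC T (λ i S → m i * m S)) (X S′) ⟩
        - 1ℤ * (- sumC T (λ i S → m i * m S) * X S′)
          ≡⟨ cong (λ u → - 1ℤ * (u * X S′)) (m-suc T) ⟨
        - 1ℤ * (m (suc T) * X S′) ∎
        where
        neg : ∀ a x → a * x ≡ - 1ℤ * (- a * x)
        neg = solve-∀

    -- Coefficients of G(x, y) M(x + y) = M(x) M(y). Once the two roots chosen by the recurrence of
    -- `g` are fixed, the induction hypothesis is applied to the factor of the right part and then
    -- to that of the left part. What is left is the summand of `m-*`.
    g-* : ∀ n p q → p ℕ.+ q ℕ.< n →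
      sumS p (λ i i′ → sumS q (λ j j′ → g n i j * m (i′ ℕ.+ j′))) ≡ m p * m q
    g-* (suc n) p q (s≤s p+q≤n) = begin
      sumS p (λ i i′ → sumS q (λ j j′ → g (suc n) i j * m (i′ ℕ.+ j′)))
        ≡⟨ ≗-cong (sumS-isSum p) (λ i i′ → trans
             (≗-cong (sumS-isSum q) (λ j j′ → *-distribʳ-+ (m (i′ ℕ.+ j′)) (δ i j) (sumC j λ z y → sumC i λ s s′ → K s (s′ ℕ.+ z) y)))
             (+-homo (sumS-isSum q) _ _)) ⟩
      sumS p (λ i i′ → sumS q (λ j j′ → δ i j * m (i′ ℕ.+ j′)) + R i i′)
        ≡⟨ +-homo (sumS-isSum p) _ _ ⟩
      sumS p (λ i i′ → sumS q (λ j j′ → δ i j * m (i′ ℕ.+ j′))) + sumS p R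
        ≡⟨ cong₂ _+_ (sumS-δ p q m) rest ⟩
      m (p ℕ.+ q) + sumC p (λ S S′ → m S * sumC q (λ Z Y → m (S′ ℕ.+ Z) * m Y))
        ≡⟨ m-* (suc p) p q ℕ.≤-refl ⟨
      m p * m q ∎
      where
      open ≡-Reasoning
      -- Counts the pairs of parts with fixed roots: S letters lie below the lower root, W between
      -- the two roots and Y above the upper one.
      K : ℕ → ℕ → ℕ → ℤ
      K S W Y = sumS S λ s r → sumS W λ u r′ → g n s u * g n (r ℕ.+ r′) Y

      R : Summand
      R i i′ = sumS q (λ j j′ → (sumC j λ z y → sumC i λ s s′ → K s (s′ ℕ.+ z) y) * m (i′ ℕ.+ j′))

      -- S, S′, Z, Y are the sizes of the intervals cut out by the two roots. Of each interval, some
      -- letters belong to the tree and the others, counted by σ′, τ′, z′, y′, go to the factor `m`.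
      T : ℕ → ℕ → ℕ → ℕ → ℤ
      T S S′ Z Y = sumS Z λ z z′ → sumS Y λ y y′ → sumS S λ σ σ′ → sumS S′ λ τ τ′ →
        K σ (τ ℕ.+ z) y * m ((σ′ ℕ.+ τ′) ℕ.+ (z′ ℕ.+ y′))

      T-value : ∀ S S′ Z Y → S ℕ.+ (S′ ℕ.+ Z) ℕ.+ Y ℕ.< n → T S S′ Z Y ≡ m S * (m (S′ ℕ.+ Z) * m Y)
      T-value S S′ Z Y bound = begin
        T S S′ Z Y
          ≡⟨ sumS-swap (sumS-isSum Z) Y _ ⟩
        (sumS Y λ y y′ → sumS Z λ z z′ → sumS S λ σ σ′ → sumS S′ λ τ τ′ →
          K σ (τ ℕ.+ z) y * m ((σ′ ℕ.+ τ′) ℕ.+ (z′ ℕ.+ y′)))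
          -- The summand depends on τ + z and τ′ + z′ only, so the choices in S′ and Z merge into a
          -- choice in W.
          ≡⟨ ≗-cong (sumS-isSum Y) (λ y y′ → trans (sumS-swap (sumS-isSum Z) S _) (≗-cong (sumS-isSum S) λ σ σ′ →
               trans (sumS-swap (sumS-isSum Z) S′ _)
                 (trans (≗-cong (sumS-isSum S′) λ τ τ′ → ≗-cong (sumS-isSum Z) λ z z′ →
                           cong (λ k → K σ (τ ℕ.+ z) y * m k) (reassoc σ′ τ′ z′ y′))
                        (sumS-vandermonde S′ Z λ w w′ → K σ w y * m (σ′ ℕ.+ w′ ℕ.+ y′))))) ⟩
        (sumS Y λ y y′ → sumS S λ σ σ′ → sumS W λ w w′ → K σ w y * m (σ′ ℕ.+ w′ ℕ.+ y′))
          -- A letter goes to the left part, to the right part or to `m`. Regrouping makes the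
          -- choice of the left part come first, here in W and in the next step in S.
          ≡⟨ ≗-cong (sumS-isSum Y) (λ y y′ → ≗-cong (sumS-isSum S) λ σ σ′ → trans
               (≗-cong (sumS-isSum W) λ w w′ → trans
                 (sym (*-homoʳ (sumS-isSum σ) _ (m (σ′ ℕ.+ w′ ℕ.+ y′))))
                 (≗-cong (sumS-isSum σ) λ s r → sym (*-homoʳ (sumS-isSum w) _ (m (σ′ ℕ.+ w′ ℕ.+ y′)))))
               (trans (sumS-swap (sumS-isSum W) σ _)
                 (≗-cong (sumS-isSum σ) λ s r →
                   sumS-assoc W (λ u r′ w′ → g n s u * g n (r ℕ.+ r′) y * m (σ′ ℕ.+ w′ ℕ.+ y′))))) ⟩
        (sumS Y λ y y′ → sumS S λ σ σ′ → sumS σ λ s r → sumS W λ u ω → sumS ω λ r′ w′ →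
           g n s u * g n (r ℕ.+ r′) y * m (σ′ ℕ.+ w′ ℕ.+ y′))
          ≡⟨ ≗-cong (sumS-isSum Y) (λ y y′ → sumS-assoc S λ s r σ′ → sumS W λ u ω → sumS ω λ r′ w′ →
               g n s u * g n (r ℕ.+ r′) y * m (σ′ ℕ.+ w′ ℕ.+ y′)) ⟩
        (sumS Y λ y y′ → sumS S λ s ρ → sumS ρ λ r σ′ → sumS W λ u ω → sumS ω λ r′ w′ →
           g n s u * g n (r ℕ.+ r′) y * m (σ′ ℕ.+ w′ ℕ.+ y′))
          ≡⟨ sumS-swap (sumS-isSum Y) S _ ⟩
        (sumS S λ s ρ → sumS Y λ y y′ → sumS ρ λ r σ′ → sumS W λ u ω → sumS ω λ r′ w′ →
           g n s u * g n (r ℕ.+ r′) y * m (σ′ ℕ.+ w′ ℕ.+ y′))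
          ≡⟨ sumS-cong S (λ s ρ e → trans
               (≗-cong (sumS-isSum Y) λ y y′ → sumS-swap (sumS-isSum ρ) W _)
               (trans (sumS-swap (sumS-isSum Y) W _)
                 (sumS-cong W λ u ω e′ → inner s ρ u ω e e′))) ⟩
        (sumS S λ s ρ → sumS W λ u ω → g n s u * m (ρ ℕ.+ ω) * m Y)
          ≡⟨ ≗-cong (sumS-isSum S) (λ s ρ → *-homoʳ (sumS-isSum W) _ (m Y)) ⟩
        (sumS S λ s ρ → (sumS W λ u ω → g n s u * m (ρ ℕ.+ ω)) * m Y)
          ≡⟨ *-homoʳ (sumS-isSum S) _ (m Y) ⟩
        (sumS S λ s ρ → sumS W λ u ω → g n s u * m (ρ ℕ.+ ω)) * m Y
          ≡⟨ cong (_* m Y) (g-* n S W (ℕ.≤-<-trans (ℕ.m≤m+n (S ℕ.+ W) Y) bound)) ⟩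
        m S * m W * m Y
          ≡⟨ *-assoc (m S) (m W) (m Y) ⟩
        m S * (m W * m Y) ∎
        where
        W = S′ ℕ.+ Z
        reassoc : ∀ a b c d → (a ℕ.+ b) ℕ.+ (c ℕ.+ d) ≡ a ℕ.+ (b ℕ.+ c) ℕ.+ d
        reassoc a b c d = trans (sym (ℕ.+-assoc (a ℕ.+ b) c d)) (cong (ℕ._+ d) (ℕ.+-assoc a b c))
        inner : ∀ s ρ u ω → s ℕ.+ ρ ≡ S → u ℕ.+ ω ≡ W →
          (sumS Y λ y y′ → sumS ρ λ r σ′ → sumS ω λ r′ w′ →
             g n s u * g n (r ℕ.+ r′) y * m (σ′ ℕ.+ w′ ℕ.+ y′)) ≡ g n s u * m (ρ ℕ.+ ω) * m Y
        inner s ρ u ω e e′ = begin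
          (sumS Y λ y y′ → sumS ρ λ r σ′ → sumS ω λ r′ w′ →
             g n s u * g n (r ℕ.+ r′) y * m (σ′ ℕ.+ w′ ℕ.+ y′))
            ≡⟨ ≗-cong (sumS-isSum Y) (λ y y′ →
                 sumS-vandermonde ρ ω λ i i′ → g n s u * g n i y * m (i′ ℕ.+ y′)) ⟩
          (sumS Y λ y y′ → sumS (ρ ℕ.+ ω) λ i i′ → g n s u * g n i y * m (i′ ℕ.+ y′))
            ≡⟨ sumS-swap (sumS-isSum Y) (ρ ℕ.+ ω) _ ⟩
          (sumS (ρ ℕ.+ ω) λ i i′ → sumS Y λ y y′ → g n s u * g n i y * m (i′ ℕ.+ y′))
            ≡⟨ ≗-cong (sumS-isSum (ρ ℕ.+ ω)) (λ i i′ → trans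
                 (≗-cong (sumS-isSum Y) λ y y′ → *-assoc (g n s u) (g n i y) (m (i′ ℕ.+ y′)))
                 (*-homo (sumS-isSum Y) (g n s u) _)) ⟩
          (sumS (ρ ℕ.+ ω) λ i i′ → g n s u * sumS Y λ y y′ → g n i y * m (i′ ℕ.+ y′))
            ≡⟨ *-homo (sumS-isSum (ρ ℕ.+ ω)) (g n s u) _ ⟩
          g n s u * (sumS (ρ ℕ.+ ω) λ i i′ → sumS Y λ y y′ → g n i y * m (i′ ℕ.+ y′))
            ≡⟨ cong (g n s u *_) (g-* n (ρ ℕ.+ ω) Y (ℕ.≤-<-trans (ℕ.+-monoˡ-≤ Y (ℕ.+-mono-≤
                 (ℕ.m+n≤o⇒n≤o s (ℕ.≤-reflexive e)) (ℕ.m+n≤o⇒n≤o u (ℕ.≤-reflexive e′)))) bound)) ⟩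
          g n s u * (m (ρ ℕ.+ ω) * m Y)
            ≡⟨ *-assoc (g n s u) (m (ρ ℕ.+ ω)) (m Y) ⟨
          g n s u * m (ρ ℕ.+ ω) * m Y ∎

      rest : sumS p R ≡ sumC p (λ S S′ → m S * sumC q (λ Z Y → m (S′ ℕ.+ Z) * m Y))
      rest = begin
        sumS p R
          ≡⟨ ≗-cong (sumS-isSum p) (λ i i′ → trans
               (≗-cong (sumS-isSum q) λ j j′ → trans
                 (sym (*-homoʳ (sumC-isSum j) _ (m (i′ ℕ.+ j′))))
                 (≗-cong (sumC-isSum j) λ z y → sym (*-homoʳ (sumC-isSum i) _ (m (i′ ℕ.+ j′)))))
               (sumS-sumC q λ z y r → sumC i λ s s′ → K s (s′ ℕ.+ z) y * m (i′ ℕ.+ r))) ⟩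
        (sumS p λ i i′ → sumC q λ Z Y → sumS Z λ z z′ → sumS Y λ y y′ →
          sumC i λ s s′ → K s (s′ ℕ.+ z) y * m (i′ ℕ.+ (z′ ℕ.+ y′)))
          ≡⟨ sumC-swap (sumS-isSum p) q _ ⟩
        (sumC q λ Z Y → sumS p λ i i′ → sumS Z λ z z′ → sumS Y λ y y′ →
          sumC i λ s s′ → K s (s′ ℕ.+ z) y * m (i′ ℕ.+ (z′ ℕ.+ y′)))
          ≡⟨ ≗-cong (sumC-isSum q) (λ Z Y → trans (sumS-swap (sumS-isSum p) Z _)
               (trans (≗-cong (sumS-isSum Z) λ z z′ → trans (sumS-swap (sumS-isSum p) Y _)
                 (trans (≗-cong (sumS-isSum Y) λ y y′ → sumS-sumC p λ s s′ r → K s (s′ ℕ.+ z) y * m (r ℕ.+ (z′ ℕ.+ y′)))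
                        (sumC-swap (sumS-isSum Y) p _)))
               (sumC-swap (sumS-isSum Z) p _))) ⟩
        (sumC q λ Z Y → sumC p λ S S′ → T S S′ Z Y)
          ≡⟨ sumC-cong q (λ Z Y e → sumC-cong p λ S S′ e′ → T-value S S′ Z Y (bound Z Y S S′ e e′)) ⟩
        (sumC q λ Z Y → sumC p λ S S′ → m S * (m (S′ ℕ.+ Z) * m Y))
          ≡⟨ sumC-swap (sumC-isSum q) p _ ⟩
        (sumC p λ S S′ → sumC q λ Z Y → m S * (m (S′ ℕ.+ Z) * m Y))
          ≡⟨ ≗-cong (sumC-isSum p) (λ S S′ → *-homo (sumC-isSum q) (m S) _) ⟩
        sumC p (λ S S′ → m S * sumC q (λ Z Y → m (S′ ℕ.+ Z) * m Y)) ∎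
        where
        shuffle : ∀ Z Y S S′ → suc (S ℕ.+ (S′ ℕ.+ Z) ℕ.+ Y) ≡ suc (S ℕ.+ S′) ℕ.+ (Z ℕ.+ Y)
        shuffle Z Y S S′ = cong suc (trans (cong (ℕ._+ Y) (sym (ℕ.+-assoc S S′ Z))) (ℕ.+-assoc (S ℕ.+ S′) Z Y))
        bound : ∀ Z Y S S′ → suc (Z ℕ.+ Y) ≡ q → suc (S ℕ.+ S′) ≡ p → S ℕ.+ (S′ ℕ.+ Z) ℕ.+ Y ℕ.< n
        bound Z Y S S′ refl refl = ℕ.≤-trans
          (ℕ.≤-trans (ℕ.≤-reflexive (shuffle Z Y S S′)) (ℕ.+-monoʳ-≤ (suc (S ℕ.+ S′)) (ℕ.n≤1+n (Z ℕ.+ Y))))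
          p+q≤n

    -- The rank of the root among the k letters varies, so for k ≤ n this counts all valid trees on
    -- k letters.
    total : ℕ → ℕ → ℤ
    total n k = sumC k (g n)

    -- Coefficients of A(t) M(t) = - M′(t). By `sumS-sumC` the root is chosen before the subset, so
    -- that `g-*` applies to the letters on its two sides; the resulting sum is the right-hand side
    -- of `m-suc`.
    total-* : ∀ n k → k ℕ.≤ n → sumS k (λ u r → total n u * m r) ≡ - m (suc k)
    total-* n k k≤n = begin
      sumS k (λ u r → total n u * m r)
        ≡⟨ ≗-cong (sumS-isSum k) (λ u r → *-homoʳ (sumC-isSum u) (g n) (m r)) ⟨
      sumS k (λ u r → sumC u (λ i j → g n i j * m r))
        ≡⟨ sumS-sumC k (λ i j r → g n i j * m r) ⟩
      sumC k (λ I J → sumS I λ i i′ → sumS J λ j j′ → g n i j * m (i′ ℕ.+ j′))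
        ≡⟨ sumC-cong k (λ I J e → g-* n I J (ℕ.≤-trans (ℕ.≤-reflexive e) k≤n)) ⟩
      sumC k (λ I J → m I * m J)
        ≡⟨ neg-involutive _ ⟨
      - - sumC k (λ I J → m I * m J)
        ≡⟨ cong -_ (m-suc k) ⟨
      - m (suc k) ∎
      where open ≡-Reasoning

-- Catalan numbers, semicircle moments and Lassalle's recurrence

module Catalan where
  open Sums
  import Data.Nat.DivMod as ℕ
  import Data.Nat.Tactic.RingSolver as ℕ-Solver
  open import Data.Nat.Combinatorics using (_C_; nCk+nC[k+1]≡[n+1]C[k+1]; k>n⇒nCk≡0; nCn≡1)
  open import Data.Integer.Base as ℤ using (ℤ; +_; -1ℤ; 0ℤ; 1ℤ)
  open import Data.Integer.Properties as ℤ using (pos-*; pos-+; +-0-commutativeMonoid)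
  open import Data.Integer.Tactic.RingSolver using (solve-∀)
  open import Algebra.Properties.CommutativeMonoid.Sum +-0-commutativeMonoid using (sum)
  open ≡-Reasoning

  absorption : ∀ n k → suc k ℕ.* (suc n C suc k) ≡ suc n ℕ.* (n C k)
  absorption zero zero = refl
  absorption zero (suc k) = trans (cong (suc (suc k) ℕ.*_) (k>n⇒nCk≡0 {1} {suc (suc k)} (s≤s (s≤s z≤n))))
                                  (ℕ.*-zeroʳ (suc (suc k)))
  absorption (suc n) zero = begin
    1 ℕ.* (suc (suc n) C 1)            ≡⟨ ℕ.*-identityˡ _ ⟩
    suc (suc n) C 1                    ≡⟨ nCk+nC[k+1]≡[n+1]C[k+1] (suc n) 0 ⟨
    1 ℕ.+ (suc n C 1)                  ≡⟨ cong (1 ℕ.+_) (trans (sym (ℕ.*-identityˡ _)) (absorption n 0)) ⟩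
    1 ℕ.+ suc n ℕ.* 1                  ≡⟨⟩
    suc (suc n) ℕ.* 1                  ∎
  absorption (suc n) (suc k) = begin
    suc (suc k) ℕ.* (suc (suc n) C suc (suc k))
      ≡⟨ cong (suc (suc k) ℕ.*_) (nCk+nC[k+1]≡[n+1]C[k+1] (suc n) (suc k)) ⟨
    suc (suc k) ℕ.* (A ℕ.+ (suc n C suc (suc k)))
      ≡⟨ ℕ.*-distribˡ-+ (suc (suc k)) A (suc n C suc (suc k)) ⟩
    suc (suc k) ℕ.* A ℕ.+ suc (suc k) ℕ.* (suc n C suc (suc k))
      ≡⟨ cong₂ (λ u v → A ℕ.+ u ℕ.+ v) (absorption n k) (absorption n (suc k)) ⟩
    A ℕ.+ suc n ℕ.* (n C k) ℕ.+ suc n ℕ.* (n C suc k)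
      ≡⟨ ℕ.+-assoc A _ _ ⟩
    A ℕ.+ (suc n ℕ.* (n C k) ℕ.+ suc n ℕ.* (n C suc k))
      ≡⟨ cong (A ℕ.+_) (ℕ.*-distribˡ-+ (suc n) (n C k) (n C suc k)) ⟨
    A ℕ.+ suc n ℕ.* ((n C k) ℕ.+ (n C suc k))
      ≡⟨ cong (λ u → A ℕ.+ suc n ℕ.* u) (nCk+nC[k+1]≡[n+1]C[k+1] n k) ⟩
    suc (suc n) ℕ.* A ∎
    where A = suc n C suc k

  next-C : ∀ n k → suc k ℕ.* (n C suc k) ℕ.+ k ℕ.* (n C k) ≡ n ℕ.* (n C k)
  next-C n k = ℕ.+-cancelˡ-≡ (n C k) _ _ (begin
    A ℕ.+ (suc k ℕ.* B ℕ.+ k ℕ.* A)    ≡⟨ algebra A B k ⟩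
    suc k ℕ.* (A ℕ.+ B)                ≡⟨ cong (suc k ℕ.*_) (nCk+nC[k+1]≡[n+1]C[k+1] n k) ⟩
    suc k ℕ.* (suc n C suc k)          ≡⟨ absorption n k ⟩
    A ℕ.+ n ℕ.* A                      ∎)
    where
    A = n C k
    B = n C suc k
    algebra : ∀ a b k → a ℕ.+ (suc k ℕ.* b ℕ.+ k ℕ.* a) ≡ suc k ℕ.* (a ℕ.+ b)
    algebra = ℕ-Solver.solve-∀

  -- The division in `catalan` is exact because the quotient is the difference of the binomial
  -- coefficients of 2n at n and at n + 1.
  catalan-* : ∀ n → suc n ℕ.* catalan n ≡ (2 ℕ.* n) C n
  catalan-* n = begin
    suc n ℕ.* (A ℕ./ suc n)                       ≡⟨ cong (λ u → suc n ℕ.* (u ℕ./ suc n)) (trans (sym multiple) (ℕ.*-comm (suc n) (A ℕ.∸ B))) ⟩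
    suc n ℕ.* ((A ℕ.∸ B) ℕ.* suc n ℕ./ suc n)     ≡⟨ cong (suc n ℕ.*_) (ℕ.m*n/n≡m (A ℕ.∸ B) (suc n)) ⟩
    suc n ℕ.* (A ℕ.∸ B)                           ≡⟨ multiple ⟩
    A                                             ∎
    where
    A = (2 ℕ.* n) C n
    B = (2 ℕ.* n) C suc n
    double : ∀ n a → (2 ℕ.* n) ℕ.* a ≡ n ℕ.* a ℕ.+ n ℕ.* a
    double = ℕ-Solver.solve-∀
    multiple : suc n ℕ.* (A ℕ.∸ B) ≡ A
    multiple = begin
      suc n ℕ.* (A ℕ.∸ B)             ≡⟨ ℕ.*-distribˡ-∸ (suc n) A B ⟩
      suc n ℕ.* A ℕ.∸ suc n ℕ.* B     ≡⟨ cong (suc n ℕ.* A ℕ.∸_)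
                                           (ℕ.+-cancelʳ-≡ (n ℕ.* A) _ _ (trans (next-C (2 ℕ.* n) n) (double n A))) ⟩
      A ℕ.+ n ℕ.* A ℕ.∸ n ℕ.* A       ≡⟨ ℕ.m+n∸n≡m A (n ℕ.* A) ⟩
      A                               ∎

  catalan-suc : ∀ n → suc (suc n) ℕ.* catalan (suc n) ≡ 2 ℕ.* suc (2 ℕ.* n) ℕ.* catalan n
  catalan-suc n = ℕ.*-cancelˡ-≡ _ _ (suc n) (begin
    suc n ℕ.* (suc (suc n) ℕ.* catalan (suc n))          ≡⟨ cong (suc n ℕ.*_) (catalan-* (suc n)) ⟩
    suc n ℕ.* ((2 ℕ.* suc n) C suc n)                    ≡⟨ cong (λ u → suc n ℕ.* (u C suc n)) (even n) ⟩
    suc n ℕ.* (suc (suc (2 ℕ.* n)) C suc n)              ≡⟨ absorption (suc (2 ℕ.* n)) n ⟩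
    suc (suc (2 ℕ.* n)) ℕ.* (suc (2 ℕ.* n) C n)          ≡⟨ algebra n (suc (2 ℕ.* n) C n) ⟩
    2 ℕ.* (suc n ℕ.* (suc (2 ℕ.* n) C n))                ≡⟨ cong (2 ℕ.*_) middle ⟨
    2 ℕ.* (suc n ℕ.* (suc (2 ℕ.* n) C suc n))            ≡⟨ cong (2 ℕ.*_) (absorption (2 ℕ.* n) n) ⟩
    2 ℕ.* (suc (2 ℕ.* n) ℕ.* ((2 ℕ.* n) C n))            ≡⟨ cong (λ u → 2 ℕ.* (suc (2 ℕ.* n) ℕ.* u)) (catalan-* n) ⟨
    2 ℕ.* (suc (2 ℕ.* n) ℕ.* (suc n ℕ.* catalan n))      ≡⟨ algebra′ n (catalan n) ⟩
    suc n ℕ.* (2 ℕ.* suc (2 ℕ.* n) ℕ.* catalan n)        ∎)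
    where
    even : ∀ n → 2 ℕ.* suc n ≡ suc (suc (2 ℕ.* n))
    even = ℕ-Solver.solve-∀
    algebra : ∀ n a → suc (suc (2 ℕ.* n)) ℕ.* a ≡ 2 ℕ.* (suc n ℕ.* a)
    algebra = ℕ-Solver.solve-∀
    algebra′ : ∀ n a → 2 ℕ.* (suc (2 ℕ.* n) ℕ.* (suc n ℕ.* a)) ≡ suc n ℕ.* (2 ℕ.* suc (2 ℕ.* n) ℕ.* a)
    algebra′ = ℕ-Solver.solve-∀
    odd : ∀ n a → suc (2 ℕ.* n) ℕ.* a ≡ suc n ℕ.* a ℕ.+ n ℕ.* a
    odd = ℕ-Solver.solve-∀
    middle : suc n ℕ.* (suc (2 ℕ.* n) C suc n) ≡ suc n ℕ.* (suc (2 ℕ.* n) C n)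
    middle = ℕ.+-cancelʳ-≡ (n ℕ.* (suc (2 ℕ.* n) C n)) _ _
      (trans (next-C (suc (2 ℕ.* n)) n) (odd n (suc (2 ℕ.* n) C n)))

  sumC-snoc : ∀ n F → sumC (suc n) F ≡ sumC n (λ i j → F i (suc j)) ℤ.+ F n 0
  sumC-snoc zero    F = ℤ.+-comm (F 0 0) 0ℤ
  sumC-snoc (suc n) F = trans (cong (ℤ._+_ (F 0 (suc n))) (sumC-snoc n λ i → F (suc i)))
    (sym (ℤ.+-assoc (F 0 (suc n)) _ _))

  sumC-reverse : ∀ n F → sumC n F ≡ sumC n (λ i j → F j i)
  sumC-reverse zero    F = refl
  sumC-reverse (suc n) F = begin
    F 0 n ℤ.+ sumC n (λ i j → F (suc i) j)     ≡⟨ cong (ℤ._+_ (F 0 n)) (sumC-reverse n λ i j → F (suc i) j) ⟩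
    F 0 n ℤ.+ sumC n (λ i j → F (suc j) i)     ≡⟨ ℤ.+-comm (F 0 n) _ ⟩
    sumC n (λ i j → F (suc j) i) ℤ.+ F 0 n     ≡⟨ sumC-snoc n (λ i j → F j i) ⟨
    sumC (suc n) (λ i j → F j i)               ∎

  c : ℕ → ℤ
  c n = + catalan n

  c-suc : ∀ n → + suc (suc n) ℤ.* c (suc n) ≡ (+ 4 ℤ.* + n ℤ.+ + 2) ℤ.* c n
  c-suc n = begin
    + suc (suc n) ℤ.* c (suc n)                  ≡⟨ pos-* (suc (suc n)) (catalan (suc n)) ⟨
    + (suc (suc n) ℕ.* catalan (suc n))          ≡⟨ cong +_ (catalan-suc n) ⟩
    + (2 ℕ.* suc (2 ℕ.* n) ℕ.* catalan n)        ≡⟨ pos-* (2 ℕ.* suc (2 ℕ.* n)) (catalan n) ⟩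
    + (2 ℕ.* suc (2 ℕ.* n)) ℤ.* c n              ≡⟨ cong (λ u → + u ℤ.* c n) (algebra n) ⟩
    + (4 ℕ.* n ℕ.+ 2) ℤ.* c n                    ≡⟨ cong (ℤ._* c n) (trans (pos-+ (4 ℕ.* n) 2) (cong (ℤ._+ + 2) (pos-* 4 n))) ⟩
    (+ 4 ℤ.* + n ℤ.+ + 2) ℤ.* c n                ∎
    where
    algebra : ∀ n → 2 ℕ.* suc (2 ℕ.* n) ≡ 4 ℕ.* n ℕ.+ 2
    algebra = ℕ-Solver.solve-∀

  -- Adding the reversed sum turns the weight i into i + j, which is constantly n.
  weighted : ∀ n → + 2 ℤ.* sumC (suc n) (λ i j → + i ℤ.* (c i ℤ.* c j)) ≡ + n ℤ.* sumC (suc n) (λ i j → c i ℤ.* c j)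
  weighted n = begin
    + 2 ℤ.* W                                                          ≡⟨ two W ⟩
    W ℤ.+ W                                                            ≡⟨ cong (ℤ._+_ W) (sumC-reverse (suc n) (λ i j → + i ℤ.* (c i ℤ.* c j))) ⟩
    W ℤ.+ sumC (suc n) (λ i j → + j ℤ.* (c j ℤ.* c i))                 ≡⟨ IsSum.+-homo (sumC-isSum (suc n)) (λ i j → + i ℤ.* (c i ℤ.* c j)) (λ i j → + j ℤ.* (c j ℤ.* c i)) ⟨
    sumC (suc n) (λ i j → + i ℤ.* (c i ℤ.* c j) ℤ.+ + j ℤ.* (c j ℤ.* c i)) ≡⟨ sumC-cong (suc n) term ⟩
    sumC (suc n) (λ i j → + n ℤ.* (c i ℤ.* c j))                       ≡⟨ IsSum.*-homo (sumC-isSum (suc n)) (+ n) (λ i j → c i ℤ.* c j) ⟩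
    + n ℤ.* sumC (suc n) (λ i j → c i ℤ.* c j)                         ∎
    where
    W = sumC (suc n) (λ i j → + i ℤ.* (c i ℤ.* c j))
    two : ∀ w → + 2 ℤ.* w ≡ w ℤ.+ w
    two = solve-∀
    collect : ∀ i j x y → i ℤ.* (x ℤ.* y) ℤ.+ j ℤ.* (y ℤ.* x) ≡ (i ℤ.+ j) ℤ.* (x ℤ.* y)
    collect = solve-∀
    term : ∀ i j → suc (i ℕ.+ j) ≡ suc n →
      + i ℤ.* (c i ℤ.* c j) ℤ.+ + j ℤ.* (c j ℤ.* c i) ≡ + n ℤ.* (c i ℤ.* c j)
    term i j refl = trans (collect (+ i) (+ j) (c i) (c j)) (cong (ℤ._* (c i ℤ.* c j)) (sym (pos-+ i j)))

  -- Both sides satisfy (n+2) x = 2 (2n+1) c n: for the sum, evaluate Σ (i+1) c i c j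
  -- both by symmetry and by c-suc.
  segner : ∀ n → c (suc n) ≡ sumC (suc n) (λ i j → c i ℤ.* c j)
  segner zero    = refl
  segner (suc n) = ℤ.*-cancelˡ-≡ (+ suc (suc (suc n))) _ _ (begin
    + suc (suc (suc n)) ℤ.* c (suc (suc n))
      ≡⟨ c-suc (suc n) ⟩
    (+ 4 ℤ.* + suc n ℤ.+ + 2) ℤ.* c (suc n)
      ≡⟨ algebra₁ (+ suc n) (c (suc n)) ⟩
    + 2 ℤ.* (1ℤ ℤ.* (1ℤ ℤ.* c (suc n))) ℤ.+ + 4 ℤ.* (+ suc n ℤ.* c (suc n))
      ≡⟨ cong₂ (λ u v → + 2 ℤ.* (1ℤ ℤ.* (1ℤ ℤ.* c (suc n))) ℤ.+ + 4 ℤ.* (u ℤ.* v))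
           (pos-+ 1 n) (segner n) ⟩
    + 2 ℤ.* (1ℤ ℤ.* (1ℤ ℤ.* c (suc n))) ℤ.+ + 4 ℤ.* ((1ℤ ℤ.+ + n) ℤ.* S′)
      ≡⟨ algebra₂ (1ℤ ℤ.* (1ℤ ℤ.* c (suc n))) (+ n) S′ ⟩
    + 2 ℤ.* (1ℤ ℤ.* (1ℤ ℤ.* c (suc n))) ℤ.+ + 4 ℤ.* (+ n ℤ.* S′) ℤ.+ + 4 ℤ.* S′
      ≡⟨ cong (λ u → + 2 ℤ.* (1ℤ ℤ.* (1ℤ ℤ.* c (suc n))) ℤ.+ + 4 ℤ.* u ℤ.+ + 4 ℤ.* S′) (weighted n) ⟨
    + 2 ℤ.* (1ℤ ℤ.* (1ℤ ℤ.* c (suc n))) ℤ.+ + 4 ℤ.* (+ 2 ℤ.* W′) ℤ.+ + 4 ℤ.* S′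
      ≡⟨ algebra₃ (1ℤ ℤ.* (1ℤ ℤ.* c (suc n))) W′ S′ ⟩
    + 2 ℤ.* (1ℤ ℤ.* (1ℤ ℤ.* c (suc n)) ℤ.+ (+ 4 ℤ.* W′ ℤ.+ + 2 ℤ.* S′))
      ≡⟨ cong (λ u → + 2 ℤ.* (1ℤ ℤ.* (1ℤ ℤ.* c (suc n)) ℤ.+ u)) tail ⟨
    + 2 ℤ.* sumC (suc (suc n)) (λ i j → + suc i ℤ.* (c i ℤ.* c j))
      ≡⟨ cong (+ 2 ℤ.*_) (IsSum.≗-cong (sumC-isSum (suc (suc n))) λ i j →
           trans (cong (ℤ._* (c i ℤ.* c j)) (pos-+ 1 i)) (algebra₄ (+ i) (c i ℤ.* c j))) ⟩
    + 2 ℤ.* sumC (suc (suc n)) (λ i j → + i ℤ.* (c i ℤ.* c j) ℤ.+ c i ℤ.* c j)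
      ≡⟨ cong (+ 2 ℤ.*_) (IsSum.+-homo (sumC-isSum (suc (suc n))) (λ i j → + i ℤ.* (c i ℤ.* c j)) (λ i j → c i ℤ.* c j)) ⟩
    + 2 ℤ.* (W ℤ.+ S)
      ≡⟨ ℤ.*-distribˡ-+ (+ 2) W S ⟩
    + 2 ℤ.* W ℤ.+ + 2 ℤ.* S
      ≡⟨ cong (ℤ._+ + 2 ℤ.* S) (weighted (suc n)) ⟩
    + suc n ℤ.* S ℤ.+ + 2 ℤ.* S
      ≡⟨ ℤ.*-distribʳ-+ S (+ suc n) (+ 2) ⟨
    (+ suc n ℤ.+ + 2) ℤ.* S
      ≡⟨ cong (ℤ._* S) (trans (sym (pos-+ (suc n) 2)) (cong +_ (ℕ.+-comm (suc n) 2))) ⟩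
    + suc (suc (suc n)) ℤ.* S ∎)
    where
    S = sumC (suc (suc n)) (λ i j → c i ℤ.* c j)
    W = sumC (suc (suc n)) (λ i j → + i ℤ.* (c i ℤ.* c j))
    S′ = sumC (suc n) (λ i j → c i ℤ.* c j)
    W′ = sumC (suc n) (λ i j → + i ℤ.* (c i ℤ.* c j))
    algebra₁ : ∀ n x → (+ 4 ℤ.* n ℤ.+ + 2) ℤ.* x ≡ + 2 ℤ.* (1ℤ ℤ.* (1ℤ ℤ.* x)) ℤ.+ + 4 ℤ.* (n ℤ.* x)
    algebra₁ = solve-∀
    algebra₂ : ∀ x n s → + 2 ℤ.* x ℤ.+ + 4 ℤ.* ((1ℤ ℤ.+ n) ℤ.* s) ≡ + 2 ℤ.* x ℤ.+ + 4 ℤ.* (n ℤ.* s) ℤ.+ + 4 ℤ.* s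
    algebra₂ = solve-∀
    algebra₃ : ∀ x w s → + 2 ℤ.* x ℤ.+ + 4 ℤ.* (+ 2 ℤ.* w) ℤ.+ + 4 ℤ.* s ≡ + 2 ℤ.* (x ℤ.+ (+ 4 ℤ.* w ℤ.+ + 2 ℤ.* s))
    algebra₃ = solve-∀
    algebra₄ : ∀ i x → (1ℤ ℤ.+ i) ℤ.* x ≡ i ℤ.* x ℤ.+ x
    algebra₄ = solve-∀
    algebra₅ : ∀ i x y → (+ 4 ℤ.* i ℤ.+ + 2) ℤ.* x ℤ.* y ≡ + 4 ℤ.* (i ℤ.* (x ℤ.* y)) ℤ.+ + 2 ℤ.* (x ℤ.* y)
    algebra₅ = solve-∀
    tail : sumC (suc n) (λ i j → + suc (suc i) ℤ.* (c (suc i) ℤ.* c j)) ≡ + 4 ℤ.* W′ ℤ.+ + 2 ℤ.* S′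
    tail = begin
      sumC (suc n) (λ i j → + suc (suc i) ℤ.* (c (suc i) ℤ.* c j))
        ≡⟨ IsSum.≗-cong (sumC-isSum (suc n)) (λ i j → trans (sym (ℤ.*-assoc (+ suc (suc i)) (c (suc i)) (c j)))
             (trans (cong (ℤ._* c j) (c-suc i)) (algebra₅ (+ i) (c i) (c j)))) ⟩
      sumC (suc n) (λ i j → + 4 ℤ.* (+ i ℤ.* (c i ℤ.* c j)) ℤ.+ + 2 ℤ.* (c i ℤ.* c j))
        ≡⟨ IsSum.+-homo (sumC-isSum (suc n)) (λ i j → + 4 ℤ.* (+ i ℤ.* (c i ℤ.* c j))) (λ i j → + 2 ℤ.* (c i ℤ.* c j)) ⟩
      sumC (suc n) (λ i j → + 4 ℤ.* (+ i ℤ.* (c i ℤ.* c j))) ℤ.+ sumC (suc n) (λ i j → + 2 ℤ.* (c i ℤ.* c j))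
        ≡⟨ cong₂ ℤ._+_ (IsSum.*-homo (sumC-isSum (suc n)) (+ 4) (λ i j → + i ℤ.* (c i ℤ.* c j)))
             (IsSum.*-homo (sumC-isSum (suc n)) (+ 2) (λ i j → c i ℤ.* c j)) ⟩
      + 4 ℤ.* W′ ℤ.+ + 2 ℤ.* S′ ∎

  -- Doubling by constructors: `parity` can be matched against `refl`, and sums over indices of one
  -- parity peel off two terms at a time.
  dbl : ℕ → ℕ
  dbl zero    = zero
  dbl (suc n) = suc (suc (dbl n))

  dbl≡2* : ∀ n → dbl n ≡ 2 ℕ.* n
  dbl≡2* zero    = refl
  dbl≡2* (suc n) = trans (cong (λ u → suc (suc u)) (dbl≡2* n)) (sym (ℕ.*-suc 2 n))

  parity : ∀ n → (∃ λ r → n ≡ dbl r) ⊎ (∃ λ r → n ≡ suc (dbl r))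
  parity zero    = inj₁ (0 , refl)
  parity (suc n) with parity n
  ... | inj₁ (r , refl) = inj₂ (r , refl)
  ... | inj₂ (r , refl) = inj₁ (suc r , refl)

  sumC-even : ∀ r (F : Summand) → (∀ i j → F (suc (dbl i)) j ≡ 0ℤ) →
    sumC (dbl r) F ≡ sumC r (λ i j → F (dbl i) (suc (dbl j)))
  sumC-even zero    F odd = refl
  sumC-even (suc r) F odd = cong (ℤ._+_ (F 0 (suc (dbl r))))
    (trans (cong₂ ℤ._+_ (odd 0 (dbl r)) (sumC-even r (λ i → F (suc (suc i))) λ i j → odd (suc i) j)) (ℤ.+-identityˡ _))

  sumC-odd : ∀ r (F : Summand) → (∀ i j → F (suc (dbl i)) j ≡ 0ℤ) →
    sumC (suc (dbl r)) F ≡ sumC (suc r) (λ i j → F (dbl i) (dbl j))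
  sumC-odd zero    F odd = refl
  sumC-odd (suc r) F odd = cong (ℤ._+_ (F 0 (dbl (suc r))))
    (trans (cong₂ ℤ._+_ (odd 0 (suc (dbl r))) (sumC-odd r (λ i → F (suc (suc i))) λ i j → odd (suc i) j)) (ℤ.+-identityˡ _))

  -- The moments of the semicircle distribution, with variance -1.
  moment′ : ℕ → ℕ → ℤ
  moment′ h zero          = -1ℤ ℤ.^ h ℤ.* c h
  moment′ h (suc zero)    = 0ℤ
  moment′ h (suc (suc n)) = moment′ (suc h) n

  moment : ℕ → ℤ
  moment = moment′ 0

  moment′-even : ∀ h i → moment′ h (dbl i) ≡ -1ℤ ℤ.^ (h ℕ.+ i) ℤ.* c (h ℕ.+ i)
  moment′-even h zero    = cong (λ u → -1ℤ ℤ.^ u ℤ.* c u) (sym (ℕ.+-identityʳ h))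
  moment′-even h (suc i) = trans (moment′-even (suc h) i) (cong (λ u → -1ℤ ℤ.^ u ℤ.* c u) (sym (ℕ.+-suc h i)))

  moment-even : ∀ i → moment (dbl i) ≡ -1ℤ ℤ.^ i ℤ.* c i
  moment-even = moment′-even 0

  moment′-odd : ∀ h i → moment′ h (suc (dbl i)) ≡ 0ℤ
  moment′-odd h zero    = refl
  moment′-odd h (suc i) = moment′-odd (suc h) i

  moment-odd : ∀ i → moment (suc (dbl i)) ≡ 0ℤ
  moment-odd = moment′-odd 0

  -- If n is even, one index of every product is odd and all terms vanish. If n is odd, this is
  -- Segner's recurrence: one of the signs stands in front and the others are shared between the two
  -- factors.
  moment-suc : ∀ n → moment (suc n) ≡ ℤ.- sumC n (λ i j → moment i ℤ.* moment j)
  moment-suc n with parity n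
  ... | inj₁ (r , refl) = begin
    moment (suc (dbl r))                                              ≡⟨ moment-odd r ⟩
    0ℤ                                                                ≡⟨ cong ℤ.-_ (IsSum.0-homo (sumC-isSum r)) ⟨
    ℤ.- sumC r (λ _ _ → 0ℤ)
      ≡⟨ cong ℤ.-_ (IsSum.≗-cong (sumC-isSum r) λ i j →
           trans (cong (moment (dbl i) ℤ.*_) (moment-odd j)) (ℤ.*-zeroʳ (moment (dbl i)))) ⟨
    ℤ.- sumC r (λ i j → moment (dbl i) ℤ.* moment (suc (dbl j)))
      ≡⟨ cong ℤ.-_ (sumC-even r (λ i j → moment i ℤ.* moment j) λ i j → cong (ℤ._* moment j) (moment-odd i)) ⟨
    ℤ.- sumC (dbl r) (λ i j → moment i ℤ.* moment j) ∎
  ... | inj₂ (r , refl) = begin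
    moment (dbl (suc r))
      ≡⟨ moment-even (suc r) ⟩
    -1ℤ ℤ.^ suc r ℤ.* c (suc r)
      ≡⟨ cong (-1ℤ ℤ.^ suc r ℤ.*_) (segner r) ⟩
    -1ℤ ℤ.^ suc r ℤ.* sumC (suc r) (λ i j → c i ℤ.* c j)
      ≡⟨ algebra (-1ℤ ℤ.^ r) (sumC (suc r) (λ i j → c i ℤ.* c j)) ⟩
    ℤ.- (-1ℤ ℤ.^ r ℤ.* sumC (suc r) (λ i j → c i ℤ.* c j))
      ≡⟨ cong ℤ.-_ (IsSum.*-homo (sumC-isSum (suc r)) (-1ℤ ℤ.^ r) (λ i j → c i ℤ.* c j)) ⟨
    ℤ.- sumC (suc r) (λ i j → -1ℤ ℤ.^ r ℤ.* (c i ℤ.* c j))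
      ≡⟨ cong ℤ.-_ (sumC-cong (suc r) term) ⟨
    ℤ.- sumC (suc r) (λ i j → moment (dbl i) ℤ.* moment (dbl j))
      ≡⟨ cong ℤ.-_ (sumC-odd r (λ i j → moment i ℤ.* moment j) λ i j → cong (ℤ._* moment j) (moment-odd i)) ⟨
    ℤ.- sumC (suc (dbl r)) (λ i j → moment i ℤ.* moment j) ∎
    where
    algebra : ∀ x s → (-1ℤ ℤ.* x) ℤ.* s ≡ ℤ.- (x ℤ.* s)
    algebra = solve-∀
    regroup : ∀ x y u v → (x ℤ.* u) ℤ.* (y ℤ.* v) ≡ (x ℤ.* y) ℤ.* (u ℤ.* v)
    regroup = solve-∀
    term : ∀ i j → suc (i ℕ.+ j) ≡ suc r → moment (dbl i) ℤ.* moment (dbl j) ≡ -1ℤ ℤ.^ r ℤ.* (c i ℤ.* c j)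
    term i j refl = begin
      moment (dbl i) ℤ.* moment (dbl j)                       ≡⟨ cong₂ ℤ._*_ (moment-even i) (moment-even j) ⟩
      (-1ℤ ℤ.^ i ℤ.* c i) ℤ.* (-1ℤ ℤ.^ j ℤ.* c j)             ≡⟨ regroup (-1ℤ ℤ.^ i) (-1ℤ ℤ.^ j) (c i) (c j) ⟩
      (-1ℤ ℤ.^ i ℤ.* -1ℤ ℤ.^ j) ℤ.* (c i ℤ.* c j)             ≡⟨ cong (ℤ._* (c i ℤ.* c j)) (ℤ.^-distribˡ-+-* -1ℤ i j) ⟨
      -1ℤ ℤ.^ (i ℕ.+ j) ℤ.* (c i ℤ.* c j)                     ∎

  sumS-binomial : ∀ n F → sumS n F ≡ sumC (suc n) (λ i j → + (n C i) ℤ.* F i j)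
  sumS-binomial zero    F = sym (trans (ℤ.+-identityʳ _) (ℤ.*-identityˡ (F 0 0)))
  sumS-binomial (suc n) F = begin
    sumS n (λ i j → F (suc i) j) ℤ.+ sumS n (λ i j → F i (suc j))
      ≡⟨ cong₂ ℤ._+_ (sumS-binomial n λ i → F (suc i)) (sumS-binomial n λ i j → F i (suc j)) ⟩
    X ℤ.+ (Z ℤ.+ sumC n (λ i j → + (n C suc i) ℤ.* F (suc i) (suc j)))
      ≡⟨ cong (λ u → X ℤ.+ (Z ℤ.+ u)) (trans (sym (ℤ.+-identityʳ _))
           (cong (ℤ._+_ (sumC n (λ i j → + (n C suc i) ℤ.* F (suc i) (suc j))))
             (sym (cong (λ u → + u ℤ.* F (suc n) 0) (k>n⇒nCk≡0 {n} {suc n} ℕ.≤-refl))))) ⟩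
    X ℤ.+ (Z ℤ.+ (sumC n (λ i j → + (n C suc i) ℤ.* F (suc i) (suc j)) ℤ.+ + (n C suc n) ℤ.* F (suc n) 0))
      ≡⟨ cong (λ u → X ℤ.+ (Z ℤ.+ u)) (sumC-snoc n (λ i j → + (n C suc i) ℤ.* F (suc i) j)) ⟨
    X ℤ.+ (Z ℤ.+ Y)
      ≡⟨ rotate X Z Y ⟩
    Z ℤ.+ (X ℤ.+ Y)
      ≡⟨ cong (ℤ._+_ Z) (IsSum.+-homo (sumC-isSum (suc n)) (λ i j → + (n C i) ℤ.* F (suc i) j) (λ i j → + (n C suc i) ℤ.* F (suc i) j)) ⟨
    Z ℤ.+ sumC (suc n) (λ i j → + (n C i) ℤ.* F (suc i) j ℤ.+ + (n C suc i) ℤ.* F (suc i) j)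
      ≡⟨ cong (ℤ._+_ Z) (IsSum.≗-cong (sumC-isSum (suc n)) λ i j → trans
           (sym (ℤ.*-distribʳ-+ (F (suc i) j) (+ (n C i)) (+ (n C suc i))))
           (cong (ℤ._* F (suc i) j) (trans (sym (pos-+ (n C i) (n C suc i))) (cong +_ (nCk+nC[k+1]≡[n+1]C[k+1] n i))))) ⟩
    Z ℤ.+ sumC (suc n) (λ i j → + (suc n C suc i) ℤ.* F (suc i) j) ∎
    where
    X = sumC (suc n) (λ i j → + (n C i) ℤ.* F (suc i) j)
    Y = sumC (suc n) (λ i j → + (n C suc i) ℤ.* F (suc i) j)
    Z = + 1 ℤ.* F 0 (suc n)
    rotate : ∀ x z y → x ℤ.+ (z ℤ.+ y) ≡ z ℤ.+ (x ℤ.+ y)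
    rotate = solve-∀

  sum≡sumC : ∀ n {f : Fin n → ℤ} {F : Summand} → (∀ j i → suc (toℕ j ℕ.+ i) ≡ n → f j ≡ F (toℕ j) i) → sum f ≡ sumC n F
  sum≡sumC zero    h = refl
  sum≡sumC (suc n) h = cong₂ ℤ._+_ (h zero n refl) (sum≡sumC n λ j i e → h (suc j) i (cong suc e))

  -- Lassalle's recurrence is the moment-cumulant relation total-*.
  lassalle≡total : ∀ n m k → k ℕ.< m → suc (dbl k) ℕ.≤ n → lassalle (suc k) ≡ total moment refl moment-suc n (suc (dbl k))
  lassalle≡total n (suc m) k (s≤s k≤m) K≤n = begin
    lassalle (suc k)
      ≡⟨ lassalle-recurrence k ⟩
    -1ℤ ℤ.^ k ℤ.* c (suc k) ℤ.+ _
      ≡⟨ cong (ℤ._+_ (-1ℤ ℤ.^ k ℤ.* c (suc k))) (sum≡sumC k term) ⟩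
    -1ℤ ℤ.^ k ℤ.* c (suc k) ℤ.+ sumC k (λ a b → -1ℤ ℤ.* (+ (K C suc (dbl b)) ℤ.* (T (suc (dbl b)) ℤ.* moment (dbl (suc a)))))
      ≡⟨ cong (ℤ._+_ (-1ℤ ℤ.^ k ℤ.* c (suc k))) (IsSum.*-homo (sumC-isSum k) -1ℤ _) ⟩
    -1ℤ ℤ.^ k ℤ.* c (suc k) ℤ.+ -1ℤ ℤ.* rest
      ≡⟨ algebra (-1ℤ ℤ.^ k) (c (suc k)) rest ⟩
    ℤ.- (-1ℤ ℤ.* -1ℤ ℤ.^ k ℤ.* c (suc k)) ℤ.- rest
      ≡⟨ cong (λ u → ℤ.- u ℤ.- rest) (moment-even (suc k)) ⟨
    ℤ.- moment (suc K) ℤ.- rest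
      ≡⟨ cong (ℤ._- rest) (total-* moment refl moment-suc n K K≤n) ⟨
    sumS K (λ u r → T u ℤ.* moment r) ℤ.- rest
      -- Only even moments survive. The term with moment 0 is the unknown `T K`; the others are the
      -- terms of Lassalle's sum.
      ≡⟨ cong (ℤ._- rest) (trans (sumS-binomial K (λ u r → T u ℤ.* moment r))
           (trans (sumC-reverse (suc K) (λ i j → + (K C i) ℤ.* (T i ℤ.* moment j)))
           (sumC-even (suc k) (λ i j → + (K C j) ℤ.* (T j ℤ.* moment i)) λ i j → trans (cong (λ u → + (K C j) ℤ.* (T j ℤ.* u)) (moment-odd i)) (zero* (+ (K C j)) (T j))))) ⟩
    + (K C K) ℤ.* (T K ℤ.* 1ℤ) ℤ.+ rest ℤ.- rest
      ≡⟨ cong (λ u → + u ℤ.* (T K ℤ.* 1ℤ) ℤ.+ rest ℤ.- rest) (nCn≡1 K) ⟩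
    1ℤ ℤ.* (T K ℤ.* 1ℤ) ℤ.+ rest ℤ.- rest
      ≡⟨ cancel (T K) rest ⟩
    T K ∎
    where
    K = suc (dbl k)
    T = total moment refl moment-suc n
    rest = sumC k (λ a b → + (K C suc (dbl b)) ℤ.* (T (suc (dbl b)) ℤ.* moment (dbl (suc a))))
    algebra : ∀ x y r → x ℤ.* y ℤ.+ -1ℤ ℤ.* r ≡ ℤ.- (-1ℤ ℤ.* x ℤ.* y) ℤ.- r
    algebra = solve-∀
    cancel : ∀ t r → 1ℤ ℤ.* (t ℤ.* 1ℤ) ℤ.+ r ℤ.- r ≡ t
    cancel = solve-∀
    zero* : ∀ x y → x ℤ.* (y ℤ.* 0ℤ) ≡ 0ℤ
    zero* = solve-∀
    regroup : ∀ s b t x → s ℤ.* b ℤ.* t ℤ.* x ≡ -1ℤ ℤ.* (b ℤ.* (t ℤ.* (-1ℤ ℤ.* s ℤ.* x)))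
    regroup = solve-∀
    term : ∀ (j : Fin k) i → suc (toℕ j ℕ.+ i) ≡ k →
      -1ℤ ℤ.^ toℕ j ℤ.* + ((2 ℕ.* (1 ℕ.+ k) ℕ.∸ 1) C (2 ℕ.* (1 ℕ.+ k) ℕ.∸ 2 ℕ.* (1 ℕ.+ toℕ j) ℕ.∸ 1))
        ℤ.* lassalle (1 ℕ.+ (k ℕ.∸ (1 ℕ.+ toℕ j))) ℤ.* c (1 ℕ.+ toℕ j)
      ≡ -1ℤ ℤ.* (+ (K C suc (dbl i)) ℤ.* (T (suc (dbl i)) ℤ.* moment (dbl (suc (toℕ j)))))
    term j i e = begin
      -1ℤ ℤ.^ t ℤ.* + ((2 ℕ.* (1 ℕ.+ k) ℕ.∸ 1) C (2 ℕ.* (1 ℕ.+ k) ℕ.∸ 2 ℕ.* (1 ℕ.+ t) ℕ.∸ 1))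
        ℤ.* lassalle (1 ℕ.+ (k ℕ.∸ (1 ℕ.+ t))) ℤ.* c (1 ℕ.+ t)
        ≡⟨ cong₂ (λ u v → -1ℤ ℤ.^ t ℤ.* + u ℤ.* v ℤ.* c (1 ℕ.+ t)) (cong₂ _C_ top bottom)
             (trans (cong (λ u → lassalle (1 ℕ.+ u)) (trans (cong (ℕ._∸ suc t) (sym e)) (ℕ.m+n∸m≡n t i)))
               -- The index i is smaller than k but not a part of it, so the recursion runs on the
               -- bound `m`.
               (lassalle≡total n m i (ℕ.≤-trans i<k k≤m) (ℕ.≤-trans (s≤s (dbl-mono (ℕ.<⇒≤ i<k))) K≤n))) ⟩
      -1ℤ ℤ.^ t ℤ.* + (K C suc (dbl i)) ℤ.* T (suc (dbl i)) ℤ.* c (suc t)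
        ≡⟨ regroup (-1ℤ ℤ.^ t) (+ (K C suc (dbl i))) (T (suc (dbl i))) (c (suc t)) ⟩
      -1ℤ ℤ.* (+ (K C suc (dbl i)) ℤ.* (T (suc (dbl i)) ℤ.* (-1ℤ ℤ.^ suc t ℤ.* c (suc t))))
        ≡⟨ cong (λ u → -1ℤ ℤ.* (+ (K C suc (dbl i)) ℤ.* (T (suc (dbl i)) ℤ.* u))) (moment-even (suc t)) ⟨
      -1ℤ ℤ.* (+ (K C suc (dbl i)) ℤ.* (T (suc (dbl i)) ℤ.* moment (dbl (suc t)))) ∎
      where
      t = toℕ j
      i<k : i ℕ.< k
      i<k = ℕ.≤-trans (s≤s (ℕ.m≤n+m i t)) (ℕ.≤-reflexive e)
      dbl-mono : ∀ {a b} → a ℕ.≤ b → dbl a ℕ.≤ dbl b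
      dbl-mono z≤n     = z≤n
      dbl-mono (s≤s p) = s≤s (s≤s (dbl-mono p))
      top : 2 ℕ.* (1 ℕ.+ k) ℕ.∸ 1 ≡ K
      top = cong (ℕ._∸ 1) (sym (dbl≡2* (1 ℕ.+ k)))
      bottom : 2 ℕ.* (1 ℕ.+ k) ℕ.∸ 2 ℕ.* (1 ℕ.+ t) ℕ.∸ 1 ≡ suc (dbl i)
      bottom = begin
        2 ℕ.* (1 ℕ.+ k) ℕ.∸ 2 ℕ.* (1 ℕ.+ t) ℕ.∸ 1    ≡⟨ cong (ℕ._∸ 1) (ℕ.*-distribˡ-∸ 2 (1 ℕ.+ k) (1 ℕ.+ t)) ⟨
        2 ℕ.* (k ℕ.∸ t) ℕ.∸ 1                        ≡⟨ cong (λ u → 2 ℕ.* (u ℕ.∸ t) ℕ.∸ 1) (trans (ℕ.+-suc t i) e) ⟨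
        2 ℕ.* ((t ℕ.+ suc i) ℕ.∸ t) ℕ.∸ 1            ≡⟨ cong (λ u → 2 ℕ.* u ℕ.∸ 1) (ℕ.m+n∸m≡n t (suc i)) ⟩
        2 ℕ.* suc i ℕ.∸ 1                            ≡⟨ cong (ℕ._∸ 1) (dbl≡2* (suc i)) ⟨
        suc (dbl i)                                  ∎

-- Relative order of elements in a list

module Before where

  data Before {A : Set} (x y : A) : List A → Set where
    here  : ∀ {xs} → y ∈ xs → Before x y (x ∷ xs)
    there : ∀ {z xs} → Before x y xs → Before x y (z ∷ xs)

  module _ {A : Set} where

    before-∈ : ∀ {x y} {xs : List A} → Before x y xs → x ∈ xs × y ∈ xs
    before-∈ (here y∈)  = here refl , there y∈
    before-∈ (there b)  = there (proj₁ (before-∈ b)) , there (proj₂ (before-∈ b))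

    before-asym : ∀ {x y} {xs : List A} → Unique xs → Before x y xs → ¬ Before y x xs
    before-asym (x∉ ∷ u) (here y∈) (here x∈) = All.lookup x∉ x∈ refl
    before-asym (x∉ ∷ u) (here y∈) (there b) = All.lookup x∉ (proj₂ (before-∈ b)) refl
    before-asym (y∉ ∷ u) (there b) (here x∈) = All.lookup y∉ (proj₂ (before-∈ b)) refl
    before-asym (z∉ ∷ u) (there b) (there b′) = before-asym u b b′

    before-total : ∀ {x y} {xs : List A} → x ∈ xs → y ∈ xs → x ≢ y → Before x y xs ⊎ Before y x xs
    before-total (here refl) (here refl) x≢y = contradiction refl x≢y
    before-total (here refl) (there y∈)  x≢y = inj₁ (here y∈)
    before-total (there x∈)  (here refl) x≢y = inj₂ (here x∈)
    before-total (there x∈)  (there y∈)  x≢y with before-total x∈ y∈ x≢y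
    ... | inj₁ b = inj₁ (there b)
    ... | inj₂ b = inj₂ (there b)

    before-++ : ∀ {x y} {xs ys : List A} → x ∈ xs → y ∈ ys → Before x y (xs ++ ys)
    before-++ {xs = _ ∷ xs} (here refl) y∈ = here (∈-++⁺ʳ xs y∈)
    before-++ (there x∈) y∈ = there (before-++ x∈ y∈)

    before-++ˡ : ∀ {x y} {xs : List A} ys → Before x y xs → Before x y (xs ++ ys)
    before-++ˡ ys (here y∈) = here (∈-++⁺ˡ y∈)
    before-++ˡ ys (there b) = there (before-++ˡ ys b)

    before-++ʳ : ∀ {x y} (xs : List A) {ys} → Before x y ys → Before x y (xs ++ ys)
    before-++ʳ []       b = b
    before-++ʳ (_ ∷ xs) b = there (before-++ʳ xs b)

    before-++⁻ : ∀ {x y} (xs : List A) {ys} → Before x y (xs ++ ys) →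
      Before x y xs ⊎ (x ∈ xs × y ∈ ys) ⊎ Before x y ys
    before-++⁻ [] b = inj₂ (inj₂ b)
    before-++⁻ (x ∷ xs) (here y∈) with ∈-++⁻ xs y∈
    ... | inj₁ y∈xs = inj₁ (here y∈xs)
    ... | inj₂ y∈ys = inj₂ (inj₁ (here refl , y∈ys))
    before-++⁻ (_ ∷ xs) (there b) with before-++⁻ xs b
    ... | inj₁ b′               = inj₁ (there b′)
    ... | inj₂ (inj₁ (x∈ , y∈)) = inj₂ (inj₁ (there x∈ , y∈))
    ... | inj₂ (inj₂ b′)        = inj₂ (inj₂ b′)

    ∈-insert : ∀ (xs : List A) {ys x z} → z ∈ xs ++ ys → z ∈ xs ++ x ∷ ys
    ∈-insert xs z∈ with ∈-++⁻ xs z∈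
    ... | inj₁ p = ∈-++⁺ˡ p
    ... | inj₂ p = ∈-++⁺ʳ xs (there p)

    ∈-delete : ∀ (xs : List A) {ys x z} → z ≢ x → z ∈ xs ++ x ∷ ys → z ∈ xs ++ ys
    ∈-delete xs z≢x z∈ with ∈-++⁻ xs z∈
    ... | inj₁ p           = ∈-++⁺ˡ p
    ... | inj₂ (here refl) = contradiction refl z≢x
    ... | inj₂ (there p)   = ∈-++⁺ʳ xs p

    before-insert : ∀ (xs : List A) {ys x y z} → Before y z (xs ++ ys) → Before y z (xs ++ x ∷ ys)
    before-insert []       b         = there b
    before-insert (_ ∷ xs) (here z∈) = here (∈-insert xs z∈)
    before-insert (_ ∷ xs) (there b) = there (before-insert xs b)

    before-delete : ∀ (xs : List A) {ys x y z} → y ≢ x → z ≢ x → Before y z (xs ++ x ∷ ys) → Before y z (xs ++ ys)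
    before-delete []       y≢x z≢x (here z∈) = contradiction refl y≢x
    before-delete []       y≢x z≢x (there b) = b
    before-delete (_ ∷ xs) y≢x z≢x (here z∈) = here (∈-delete xs z≢x z∈)
    before-delete (_ ∷ xs) y≢x z≢x (there b) = there (before-delete xs y≢x z≢x b)

    unique-++⁻ : ∀ (xs : List A) {ys} → Unique (xs ++ ys) → Unique xs × Unique ys × (∀ {z} → z ∈ xs → z ∉ ys)
    unique-++⁻ [] u = [] , u , λ ()
    unique-++⁻ (x ∷ xs) (x∉ ∷ u) with unique-++⁻ xs u
    ... | uxs , uys , dis = All.tabulate (λ z∈ → All.lookup x∉ (∈-++⁺ˡ z∈)) ∷ uxs , uys ,
      λ { (here refl) z∈ys → All.lookup x∉ (∈-++⁺ʳ xs z∈ys) refl ; (there z∈xs) → dis z∈xs }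

    unique-delete : ∀ (xs : List A) {ys x z} → Unique (xs ++ x ∷ ys) → z ∈ xs ++ ys → z ≢ x
    unique-delete xs u z∈ refl with unique-++⁻ xs u | ∈-++⁻ xs z∈
    ... | _ , _ , dis      | inj₁ p = dis p (here refl)
    ... | _ , (x∉ ∷ _) , _ | inj₂ p = All.lookup x∉ p refl

-- Push-pop trees and heaps of arcs

module Trees where
  open import Data.List.Base using (initLast; _∷ʳ′_)

  open Before
  open import Data.List.Relation.Unary.Any.Properties using (++⁺ˡ; ++⁺ʳ)

  module _ {n : ℕ} where

    Arc : Set
    Arc = Fin n × Fin n

    -- In `node P U b` the letters of P come first, the descent from the last letter of P to
    -- `root U` opens a hook, and the pop `b` closes it. Nodes on the left spine are hooks in
    -- sequence, those in U are nested under the hook.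
    data Tree : Set where
      leaf : Fin n → Tree
      node : Tree → Tree → Fin n → Tree

    leaf-injective : ∀ {c c′} → leaf c ≡ leaf c′ → c ≡ c′
    leaf-injective refl = refl

    node-injective : ∀ {P P′ U U′ b b′} → node P U b ≡ node P′ U′ b′ → P ≡ P′ × U ≡ U′ × b ≡ b′
    node-injective refl = refl , refl , refl

    root last : Tree → Fin n
    root (leaf c)     = c
    root (node P U b) = root P
    last (leaf c)     = c
    last (node P U b) = b

    word : Tree → List (Fin n)
    word (leaf c)     = c ∷ []
    word (node P U b) = word P ++ word U ++ b ∷ []

    -- The arcs are listed in the order of their pushes, since `root U` is the first letter of U.
    -- This list is the linear extension that the tree selects.
    inner : Tree → List Arc
    inner (leaf c)     = []
    inner (node P U b) = inner P ++ (root U , b) ∷ inner U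

    -- The label `β` closes `t`: for the part U of `node P U b` it is `b`, for the whole tree it is
    -- the largest label.
    arcs : Tree → Fin n → List Arc
    arcs t β = (root t , β) ∷ inner t

    Cross : Arc → Arc → Set
    Cross (a , b) (a′ , b′) = (a < a′ × a′ < b × b < b′) ⊎ (a′ < a × a < b′ × b′ < b)

    cross? : ∀ x y → Dec (Cross x y)
    cross? (a , b) (a′ , b′) =
      (a <? a′ ×-dec a′ <? b ×-dec b <? b′) ⊎-dec (a′ <? a ×-dec a <? b′ ×-dec b′ <? b)

    cross-sym : ∀ {x y} → Cross x y → Cross y x
    cross-sym (inj₁ p) = inj₂ p
    cross-sym (inj₂ p) = inj₁ p

    cross-≢ : ∀ {x y} → Cross x y → x ≢ y
    cross-≢ (inj₁ (p , _)) refl = ℕ.<-irrefl refl p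
    cross-≢ (inj₂ (p , _)) refl = ℕ.<-irrefl refl p

    -- The inequalities say that the push of root U is a descent and that the pop b exceeds everything
    -- since the letter before that push.
    data Valid : Tree → Set where
      leaf : ∀ {c} → Valid (leaf c)
      node : ∀ {P U b} → Valid P → Valid U → (∀ {z} → z ∈ word P → z ∉ word U) →
        root U < last P → last P < b → last U < b → Valid (node P U b)

    root∈ : ∀ t → root t ∈ word t
    root∈ (leaf c)     = here refl
    root∈ (node P U b) = ∈-++⁺ˡ (root∈ P)

    ∈-word⁻ : ∀ P U {b z} → z ∈ word (node P U b) → z ∈ word P ⊎ z ∈ word U ⊎ z ≡ b
    ∈-word⁻ P U z∈ with ∈-++⁻ (word P) z∈
    ... | inj₁ p = inj₁ p
    ... | inj₂ p with ∈-++⁻ (word U) p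
    ... | inj₁ q           = inj₂ (inj₁ q)
    ... | inj₂ (here refl) = inj₂ (inj₂ refl)

    ∈-wordˡ : ∀ P U {b z} → z ∈ word P → z ∈ word (node P U b)
    ∈-wordˡ P U p = ∈-++⁺ˡ p

    ∈-wordᵐ : ∀ P U {b z} → z ∈ word U → z ∈ word (node P U b)
    ∈-wordᵐ P U p = ∈-++⁺ʳ (word P) (∈-++⁺ˡ p)

    ∈-wordʳ : ∀ P U {b} → b ∈ word (node P U b)
    ∈-wordʳ P U = ∈-++⁺ʳ (word P) (∈-++⁺ʳ (word U) (here refl))

    last∈ : ∀ t → last t ∈ word t
    last∈ (leaf c)     = here refl
    last∈ (node P U b) = ∈-wordʳ P U

    ≤-last : ∀ {t} → Valid t → ∀ {z} → z ∈ word t → z ≤ last t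
    ≤-last leaf (here refl) = ℕ.≤-refl
    ≤-last (node {P} {U} vP vU _ _ P<b U<b) z∈ with ∈-word⁻ P U z∈
    ... | inj₁ p           = ℕ.≤-trans (≤-last vP p) (ℕ.<⇒≤ P<b)
    ... | inj₂ (inj₁ p)    = ℕ.≤-trans (≤-last vU p) (ℕ.<⇒≤ U<b)
    ... | inj₂ (inj₂ refl) = ℕ.≤-refl

    inner-∈ : ∀ {t} → Valid t → ∀ {a b} → (a , b) ∈ inner t → a ∈ word t × b ∈ word t × a < b
    inner-∈ (node {P} {U} {b} vP vU _ _ _ U<b) x∈ with ∈-++⁻ (inner P) x∈
    ... | inj₁ p with inner-∈ vP p
    ... | a∈ , b∈ , a<b = ∈-wordˡ P U a∈ , ∈-wordˡ P U b∈ , a<b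
    inner-∈ (node {P} {U} vP vU _ _ _ U<b) x∈ | inj₂ (here refl) =
      ∈-wordᵐ P U (root∈ U) , ∈-wordʳ P U , ℕ.≤-<-trans (≤-last vU (root∈ U)) U<b
    inner-∈ (node {P} {U} vP vU _ _ _ _) x∈ | inj₂ (there p) with inner-∈ vU p
    ... | a∈ , b∈ , a<b = ∈-wordᵐ P U a∈ , ∈-wordᵐ P U b∈ , a<b

    inner-unique : ∀ {t} → Valid t → Unique (inner t)
    inner-unique leaf = []
    inner-unique (node {P} {U} vP vU dis _ _ U<b) = Unique.++⁺ (inner-unique vP)
      (All.tabulate (λ x∈ e → ℕ.<⇒≢ (ℕ.≤-<-trans (≤-last vU (proj₁ (proj₂ (inner-∈ vU x∈)))) U<b)
                                (cong (λ x → toℕ (proj₂ x)) (sym e))) ∷ inner-unique vU)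
      λ { (p , here refl) → dis (proj₁ (inner-∈ vP p)) (root∈ U)
        ; (p , there q)   → dis (proj₁ (inner-∈ vP p)) (proj₁ (inner-∈ vU q)) }

    -- The tree of the heap obtained by dropping the piece x on top of the heap of t.
    insert : Arc → Tree → Tree
    insert (a , b) (leaf c) = node (leaf c) (leaf a) b
    insert (a , b) (node P U b′) with b′ <? b | Any.any? (cross? (a , b)) (arcs U b′)
    ... | yes _ | _     = node (node P U b′) (leaf a) b
    -- The new arc crosses the arc of this node or one inside U, so it has to come after that arc.
    -- If it crosses none of them, it may pass to the left of them all, into P.
    ... | no  _ | yes _ = node P (insert (a , b) U) b′
    ... | no  _ | no  _ = node (insert (a , b) P) U b′

    insert-max : ∀ {P U b′ a b} → b′ < b → insert (a , b) (node P U b′) ≡ node (node P U b′) (leaf a) b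
    insert-max {P} {U} {b′} {a} {b} b′<b with b′ <? b | Any.any? (cross? (a , b)) (arcs U b′)
    ... | yes _  | _ = refl
    ... | no b′≮b | _ = contradiction b′<b b′≮b

    insert-right : ∀ {P U b′ a b} → ¬ b′ < b → Any (Cross (a , b)) (arcs U b′) →
      insert (a , b) (node P U b′) ≡ node P (insert (a , b) U) b′
    insert-right {P} {U} {b′} {a} {b} b′≮b x with b′ <? b | Any.any? (cross? (a , b)) (arcs U b′)
    ... | yes b′<b | _     = contradiction b′<b b′≮b
    ... | no  _    | yes _ = refl
    ... | no  _    | no ¬x = contradiction x ¬x

    insert-left : ∀ {P U b′ a b} → ¬ b′ < b → ¬ Any (Cross (a , b)) (arcs U b′) →
      insert (a , b) (node P U b′) ≡ node (insert (a , b) P) U b′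
    insert-left {P} {U} {b′} {a} {b} b′≮b ¬x with b′ <? b | Any.any? (cross? (a , b)) (arcs U b′)
    ... | yes b′<b | _     = contradiction b′<b b′≮b
    ... | no  _    | yes x = contradiction x ¬x
    ... | no  _    | no  _ = refl

    root-insert : ∀ x t → root (insert x t) ≡ root t
    root-insert x (leaf c) = refl
    root-insert (a , b) (node P U b′) with b′ <? b | Any.any? (cross? (a , b)) (arcs U b′)
    ... | yes _ | _     = refl
    ... | no  _ | yes _ = refl
    ... | no  _ | no  _ = root-insert (a , b) P

    word-insert⁻ : ∀ {a b} t {z} → z ∈ word (insert (a , b) t) → z ∈ word t ⊎ z ≡ a ⊎ z ≡ b
    word-insert⁻ (leaf c) (here refl)                 = inj₁ (here refl)
    word-insert⁻ (leaf c) (there (here refl))         = inj₂ (inj₁ refl)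
    word-insert⁻ (leaf c) (there (there (here refl))) = inj₂ (inj₂ refl)
    word-insert⁻ {a} {b} (node P U b′) z∈ with b′ <? b | Any.any? (cross? (a , b)) (arcs U b′)
    word-insert⁻ {a} {b} (node P U b′) z∈ | yes _ | _ with ∈-word⁻ (node P U b′) (leaf a) z∈
    ... | inj₁ p                  = inj₁ p
    ... | inj₂ (inj₁ (here refl)) = inj₂ (inj₁ refl)
    ... | inj₂ (inj₂ refl)        = inj₂ (inj₂ refl)
    word-insert⁻ {a} {b} (node P U b′) z∈ | no _ | yes _ with ∈-word⁻ P (insert (a , b) U) z∈
    ... | inj₁ p           = inj₁ (∈-wordˡ P U p)
    ... | inj₂ (inj₂ refl) = inj₁ (∈-wordʳ P U)
    ... | inj₂ (inj₁ p) with word-insert⁻ U p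
    ... | inj₁ q = inj₁ (∈-wordᵐ P U q)
    ... | inj₂ q = inj₂ q
    word-insert⁻ {a} {b} (node P U b′) z∈ | no _ | no _ with ∈-word⁻ (insert (a , b) P) U z∈
    ... | inj₂ (inj₁ p)    = inj₁ (∈-wordᵐ P U p)
    ... | inj₂ (inj₂ refl) = inj₁ (∈-wordʳ P U)
    ... | inj₁ p with word-insert⁻ P p
    ... | inj₁ q = inj₁ (∈-wordˡ P U q)
    ... | inj₂ q = inj₂ q

    word-insert⁺ : ∀ {a b} t {z} → z ∈ word t ⊎ z ≡ a ⊎ z ≡ b → z ∈ word (insert (a , b) t)
    word-insert⁺ (leaf c) (inj₁ (here refl))  = here refl
    word-insert⁺ (leaf c) (inj₂ (inj₁ refl))  = there (here refl)
    word-insert⁺ (leaf c) (inj₂ (inj₂ refl))  = there (there (here refl))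
    word-insert⁺ {a} {b} (node P U b′) z∈ with b′ <? b | Any.any? (cross? (a , b)) (arcs U b′)
    word-insert⁺ {a} {b} (node P U b′) (inj₁ p)           | yes _ | _ = ∈-wordˡ (node P U b′) (leaf a) p
    word-insert⁺ {a} {b} (node P U b′) (inj₂ (inj₁ refl)) | yes _ | _ = ∈-wordᵐ (node P U b′) (leaf a) (here refl)
    word-insert⁺ {a} {b} (node P U b′) (inj₂ (inj₂ refl)) | yes _ | _ = ∈-wordʳ (node P U b′) (leaf a)
    word-insert⁺ {a} {b} (node P U b′) (inj₂ q) | no _ | yes _ = ∈-wordᵐ P (insert (a , b) U) (word-insert⁺ U (inj₂ q))
    word-insert⁺ {a} {b} (node P U b′) (inj₁ p) | no _ | yes _ with ∈-word⁻ P U p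
    ... | inj₁ q           = ∈-wordˡ P (insert (a , b) U) q
    ... | inj₂ (inj₁ q)    = ∈-wordᵐ P (insert (a , b) U) (word-insert⁺ U (inj₁ q))
    ... | inj₂ (inj₂ refl) = ∈-wordʳ P (insert (a , b) U)
    word-insert⁺ {a} {b} (node P U b′) (inj₂ q) | no _ | no _ = ∈-wordˡ (insert (a , b) P) U (word-insert⁺ P (inj₂ q))
    word-insert⁺ {a} {b} (node P U b′) (inj₁ p) | no _ | no _ with ∈-word⁻ P U p
    ... | inj₁ q           = ∈-wordˡ (insert (a , b) P) U (word-insert⁺ P (inj₁ q))
    ... | inj₂ (inj₁ q)    = ∈-wordᵐ (insert (a , b) P) U q
    ... | inj₂ (inj₂ refl) = ∈-wordʳ (insert (a , b) P) U

    -- Whatever the search for a place leaves behind on its way to the left has been tested not to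
    -- cross x. Hence x is a maximal piece of the new heap.
    inner-insert : ∀ x t → ∃₂ λ l r →
      inner t ≡ l ++ r × inner (insert x t) ≡ l ++ x ∷ r × All (λ y → ¬ Cross x y) r
    inner-insert x (leaf c) = [] , [] , refl , refl , []
    inner-insert (a , b) (node P U b′) with b′ <? b | Any.any? (cross? (a , b)) (arcs U b′)
    ... | yes _ | _ = inner (node P U b′) , [] , sym (++-identityʳ _) , refl , []
    ... | no  _ | yes _ with inner-insert (a , b) U
    ... | l , r , e , e′ , ¬x = inner P ++ (root U , b′) ∷ l , r ,
      trans (cong (λ u → inner P ++ (root U , b′) ∷ u) e) (sym (++-assoc (inner P) _ r)) ,
      trans (cong₂ (λ u v → inner P ++ (u , b′) ∷ v) (root-insert (a , b) U) e′) (sym (++-assoc (inner P) _ _)) ,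
      ¬x
    inner-insert (a , b) (node P U b′) | no _ | no ¬any with inner-insert (a , b) P
    ... | l , r , e , e′ , ¬x = l , r ++ arcs U b′ ,
      trans (cong (_++ arcs U b′) e) (++-assoc l r _) ,
      trans (cong (_++ arcs U b′) e′) (++-assoc l _ _) ,
      All.++⁺ ¬x (All.¬Any⇒All¬ _ ¬any)

    -- In the second case the arc is appended; the letter before its push is then the old last
    -- letter, and validity makes this a descent.
    last-insert : ∀ a b t → last (insert (a , b) t) ≡ last t ⊎
      (last (insert (a , b) t) ≡ b × (Valid (insert (a , b) t) → a < last t))
    last-insert a b (leaf c) = inj₂ (refl , λ { (node _ _ _ a<c _ _) → a<c })
    last-insert a b (node P U b′) with b′ <? b | Any.any? (cross? (a , b)) (arcs U b′)
    ... | yes _ | _     = inj₂ (refl , λ { (node _ _ _ a<b′ _ _) → a<b′ })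
    ... | no  _ | yes _ = inj₁ refl
    ... | no  _ | no  _ = inj₁ refl

    last-insert-≤ : ∀ {a b} t → Valid (insert (a , b) t) → last t ≤ last (insert (a , b) t)
    last-insert-≤ t v = ≤-last v (word-insert⁺ t (inj₁ (last∈ t)))

    last-insert-< : ∀ {a b} {β : Fin n} t → last t < β → b < β → last (insert (a , b) t) < β
    last-insert-< {a} {b} {β} t t<β b<β with last-insert a b t
    ... | inj₁ e       = subst (_< β) (sym e) t<β
    ... | inj₂ (e , _) = subst (_< β) (sym e) b<β

    Fresh : Arc → Tree → Set
    Fresh (a , b) t = ∀ {z} → z ∈ word t → z ≢ a × z ≢ b

    <-from-≮ : ∀ {x y : Fin n} → ¬ x < y → x ≢ y → y < x
    <-from-≮ x≮y x≢y = ℕ.≤∧≢⇒< (ℕ.≮⇒≥ x≮y) λ e → x≢y (toℕ-injective (sym e))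

    -- An arc that pops below `β` and crosses some arc of `arcs t β` has its push below the last
    -- letter of `t`, so an appended arc starts with a descent. An arc that is not appended enters a
    -- subtree in which it still crosses something, and the induction goes on.
    insert-valid : ∀ {a b β t} → Valid t → last t < β → a < b → b < β → Fresh (a , b) t →
      Any (Cross (a , b)) (arcs t β) → Valid (insert (a , b) t)
    insert-valid {a} {b} {t = leaf c} leaf c<β a<b b<β fresh (here (inj₁ (a<c , c<b , _))) =
      node leaf leaf (λ { (here refl) (here e) → proj₁ (fresh (here refl)) e }) a<c c<b a<b
    insert-valid {t = leaf c} leaf c<β a<b b<β fresh (here (inj₂ (_ , _ , β<b))) = contradiction β<b (ℕ.<-asym b<β)
    insert-valid {a} {b} {β} {node P U b′} v@(node vP vU dis U<P P<b′ U<b′) t<β a<b b<β fresh x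
      with b′ <? b | Any.any? (cross? (a , b)) (arcs U b′)
    ... | yes b′<b | _ = node v leaf (λ { z∈ (here refl) → proj₁ (fresh z∈) refl }) (below x) b′<b a<b
      where
      bound : ∀ {z} → z ∈ word (node P U b′) → z ≤ b′
      bound = ≤-last v
      below : Any (Cross (a , b)) (arcs (node P U b′) β) → a < b′
      below (here (inj₁ (a<p , _)))     = ℕ.<-≤-trans a<p (bound (∈-wordˡ P U (root∈ P)))
      below (here (inj₂ (_ , _ , β<b))) = contradiction β<b (ℕ.<-asym b<β)
      below (there p) = go p (λ q → q)
        where
        go : ∀ {l} → Any (Cross (a , b)) l → (∀ {q} → q ∈ l → q ∈ inner (node P U b′)) → a < b′
        go (here (inj₁ (a<p , _)))     ⊆ = ℕ.<-≤-trans a<p (bound (proj₁ (inner-∈ v (⊆ (here refl)))))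
        go (here (inj₂ (_ , a<q , _))) ⊆ = ℕ.<-≤-trans a<q (bound (proj₁ (proj₂ (inner-∈ v (⊆ (here refl))))))
        go (there p)                   ⊆ = go p λ q → ⊆ (there q)
    ... | no b′≮b | yes y = node vP vU′
            (λ z∈P z∈ → disjoint z∈P (word-insert⁻ U z∈))
            (subst (_< last P) (sym (root-insert (a , b) U)) U<P)
            P<b′ (last-insert-< {β = b′} U U<b′ b<b′)
      where
      b<b′ : b < b′
      b<b′ = <-from-≮ b′≮b (proj₂ (fresh (∈-wordʳ P U)))
      vU′ : Valid (insert (a , b) U)
      vU′ = insert-valid vU U<b′ a<b b<b′ (λ z∈ → fresh (∈-wordᵐ P U z∈)) y
      disjoint : ∀ {z} → z ∈ word P → ¬ (z ∈ word U ⊎ z ≡ a ⊎ z ≡ b)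
      disjoint z∈P (inj₁ z∈U)      = dis z∈P z∈U
      disjoint z∈P (inj₂ (inj₁ e)) = proj₁ (fresh (∈-wordˡ P U z∈P)) e
      disjoint z∈P (inj₂ (inj₂ e)) = proj₂ (fresh (∈-wordˡ P U z∈P)) e
    ... | no b′≮b | no ¬y = node vP′ vU
            (λ z∈ z∈U → disjoint (word-insert⁻ P z∈) z∈U)
            (ℕ.<-≤-trans U<P (last-insert-≤ P vP′))
            (last-insert-< {β = b′} P P<b′ b<b′) U<b′
      where
      b<b′ : b < b′
      b<b′ = <-from-≮ b′≮b (proj₂ (fresh (∈-wordʳ P U)))
      split : Any (Cross (a , b)) (arcs (node P U b′) β) → Any (Cross (a , b)) (arcs P β)
      split (here c)  = here c
      split (there p) with Data.List.Relation.Unary.Any.Properties.++⁻ (inner P) p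
      ... | inj₁ q = there q
      ... | inj₂ q = contradiction q ¬y
      vP′ : Valid (insert (a , b) P)
      vP′ = insert-valid vP (ℕ.<-trans P<b′ t<β) a<b b<β (λ z∈ → fresh (∈-wordˡ P U z∈)) (split x)
      disjoint : ∀ {z} → z ∈ word P ⊎ z ≡ a ⊎ z ≡ b → z ∉ word U
      disjoint (inj₁ z∈P)      z∈U = dis z∈P z∈U
      disjoint (inj₂ (inj₁ e)) z∈U = proj₁ (fresh (∈-wordᵐ P U z∈U)) e
      disjoint (inj₂ (inj₂ e)) z∈U = proj₂ (fresh (∈-wordᵐ P U z∈U)) e

    ∈-split : ∀ {A : Set} (xs : List A) {ys l x r} → xs ++ ys ≡ l ++ x ∷ r →
      (∃ λ m → xs ≡ l ++ x ∷ m × r ≡ m ++ ys) ⊎ (∃ λ m → l ≡ xs ++ m × ys ≡ m ++ x ∷ r)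
    ∈-split []       {l = l} e    = inj₂ (l , refl , e)
    ∈-split (_ ∷ xs) {l = []} refl = inj₁ (xs , refl , refl)
    ∈-split (z ∷ xs) {l = w ∷ l} e with ∷-injective e
    ... | refl , e′ with ∈-split xs e′
    ... | inj₁ (m , p , q) = inj₁ (m , cong (z ∷_) p , q)
    ... | inj₂ (m , p , q) = inj₂ (m , cong (z ∷_) p , q)

    -- The arc of the first pop does it: its push comes directly after the root and is a descent, so
    -- it starts below the root and ends above it. Consequently the arc that closes a subtree is
    -- maximal only if the subtree is a leaf.
    root-crossed : ∀ {P U b} {β : Fin n} → Valid (node P U b) → b < β →
      Any (Cross (root P , β)) (inner (node P U b))
    root-crossed {leaf c} (node vP vU dis U<c c<b _) b<β = here (inj₂ (U<c , c<b , b<β))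
    root-crossed {node _ _ _} (node vP vU dis _ P<b _) b<β = ++⁺ˡ (root-crossed vP (ℕ.<-trans P<b b<β))

    -- Along the left spine the last letters climb from the root to `last t`. At the node where they
    -- pass `a`, one has root U < last P < a < b.
    straddled : ∀ {t} → Valid t → ∀ {a} → a ∉ word t → root t < a → a < last t →
      Any (λ (p , q) → p < a × a < q × q ≤ last t) (inner t)
    straddled {leaf c} leaf a∉ c<a a<c = contradiction a<c (ℕ.<-asym c<a)
    straddled {node P U b} (node vP vU _ U<P P<b _) {a} a∉ P<a a<b with ℕ.<-cmp (toℕ a) (toℕ (last P))
    ... | tri< a<P _ _ = ++⁺ˡ (Any.map (λ (p<a , a<q , q≤P) → p<a , a<q , ℕ.≤-trans q≤P (ℕ.<⇒≤ P<b))
                                 (straddled vP (λ a∈ → a∉ (∈-wordˡ P U a∈)) P<a a<P))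
    ... | tri≈ _ a≡P _ = contradiction (subst (_∈ word (node P U b)) (toℕ-injective (sym a≡P)) (∈-wordˡ P U (last∈ P))) a∉
    ... | tri> _ _ P<a′ = ++⁺ʳ (inner P) (here (ℕ.<-trans U<P P<a′ , a<b , ℕ.≤-refl))

    -- A counterpart of `below` in `insert-valid`. If `a` lies under the root, the arc crosses the
    -- root arc; otherwise it crosses an arc that straddles `a`. This provides the crossing under
    -- which a removed arc can be put back.
    appended-crosses : ∀ {P a b} {β : Fin n} → Valid P → a ∉ word P → a < last P → last P < b → b < β →
      Any (Cross (a , b)) (arcs P β)
    appended-crosses {P} {a} {b} {β} vP a∉ a<P P<b b<β with ℕ.<-cmp (toℕ a) (toℕ (root P))
    ... | tri< a<c _ _ = here (inj₁ (a<c , ℕ.≤-<-trans (≤-last vP (root∈ P)) P<b , b<β))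
    ... | tri≈ _ a≡c _ = contradiction (subst (_∈ word P) (toℕ-injective (sym a≡c)) (root∈ P)) a∉
    ... | tri> _ _ c<a = there (Any.map (λ (p<a , a<q , q≤P) → inj₂ (p<a , a<q , ℕ.≤-<-trans q≤P P<b))
                                  (straddled vP a∉ c<a a<P))

    any-⊆ : ∀ {A : Set} {P : A → Set} {xs ys : List A} → (∀ {x} → x ∈ xs → x ∈ ys) → Any P xs → Any P ys
    any-⊆ ⊆ p with find p
    ... | x , x∈ , px = lose (⊆ x∈) px

    -- The hypothesis on r says that (a , b) is a maximal piece of the heap of t.
    remove : ∀ {t l a b r} {β : Fin n} → Valid t → last t < β →
      inner t ≡ l ++ (a , b) ∷ r → All (λ y → ¬ Cross (a , b) y) r →
      ∃ λ t₀ → Valid t₀ × inner t₀ ≡ l ++ r × insert (a , b) t₀ ≡ t × Any (Cross (a , b)) (arcs t₀ β)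
    remove {leaf c} {[]} leaf t<β () ¬x
    remove {leaf c} {_ ∷ _} leaf t<β () ¬x
    remove {node P U b′} {l} {a} {b} {r} {β} (node vP vU dis U<P P<b′ U<b′) t<β e ¬x with ∈-split (inner P) {l = l} e
    ... | inj₁ (m , e₁ , refl) = removeP (remove vP (ℕ.<-trans P<b′ t<β) e₁ (All.++⁻ˡ m ¬x))
      where
      ab∈ : (a , b) ∈ inner P
      ab∈ = subst ((a , b) ∈_) (sym e₁) (∈-++⁺ʳ l (here refl))
      b<b′ : b < b′
      b<b′ = ℕ.≤-<-trans (≤-last vP (proj₁ (proj₂ (inner-∈ vP ab∈)))) P<b′
      ¬U : ¬ Any (Cross (a , b)) (arcs U b′)
      ¬U = All.All¬⇒¬Any (All.++⁻ʳ m ¬x)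
      removeP : (∃ λ P₀ → Valid P₀ × inner P₀ ≡ l ++ m × insert (a , b) P₀ ≡ P × Any (Cross (a , b)) (arcs P₀ β)) → _
      removeP (P₀ , vP₀ , e₀ , refl , x) =
        node P₀ U b′ ,
        node vP₀ vU (λ z∈ → dis (word-insert⁺ P₀ (inj₁ z∈))) (bound (last-insert a b P₀))
          (ℕ.≤-<-trans (last-insert-≤ P₀ vP) P<b′) U<b′ ,
        trans (cong (_++ arcs U b′) e₀) (++-assoc l m _) ,
        insert-left (ℕ.<-asym b<b′) ¬U ,
        any-⊆ (λ { (here p) → here p ; (there p) → there (∈-++⁺ˡ p) }) x
        where
        -- If `b` was the last letter of P, the push of U now follows `last P₀` and must still be a
        -- descent. With `a` below `root U`, the removed arc would cross the arc of U, against
        -- maximality; hence root U < a < last P₀.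
        bound : last P ≡ last P₀ ⊎ (last P ≡ b × (Valid P → a < last P₀)) → root U < last P₀
        bound (inj₁ e)       = subst (λ u → root U < u) e U<P
        bound (inj₂ (e , f)) with ℕ.<-cmp (toℕ a) (toℕ (root U))
        ... | tri< a<U _ _ = contradiction (here (inj₁ (a<U , subst (λ u → root U < u) e U<P , b<b′))) ¬U
        ... | tri≈ _ a≡U _ = contradiction (root∈ U)
                               (dis (subst (_∈ word P) (toℕ-injective a≡U) (proj₁ (inner-∈ vP ab∈))))
        ... | tri> _ _ U<a = ℕ.<-trans U<a (f vP)
    -- The removed piece is the arc of the last node. By `root-crossed`, its maximality forces U to
    -- be a leaf.
    ... | inj₂ ([] , refl , refl) = removeRoot U vU U<P U<b′ dis ¬x
      where
      removeRoot : ∀ U → Valid U → root U < last P → last U < b′ → (∀ {z} → z ∈ word P → z ∉ word U) →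
        All (λ y → ¬ Cross (root U , b′) y) (inner U) →
        ∃ λ t₀ → Valid t₀ × inner t₀ ≡ (inner P ++ []) ++ inner U × insert (root U , b′) t₀ ≡ node P U b′ × Any (Cross (root U , b′)) (arcs t₀ β)
      removeRoot (node V W q) vU U<P U<b′ dis ¬x = contradiction (root-crossed vU U<b′) (All.All¬⇒¬Any ¬x)
      removeRoot (leaf c) vU c<P c<b′ dis ¬x =
        P , vP , sym (trans (++-identityʳ _) (++-identityʳ _)) , restore P P<b′ ,
        appended-crosses vP (λ c∈ → dis c∈ (here refl)) c<P P<b′ t<β
        where
        restore : ∀ P → last P < b′ → insert (c , b′) P ≡ node P (leaf c) b′
        restore (leaf _)     P<b′ = refl
        restore (node _ _ _) P<b′ = insert-max P<b′
    ... | inj₂ (_ ∷ m , refl , e₂) with ∷-injective e₂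
    ... | refl , e₃ = removeU (remove vU U<b′ e₃ ¬x)
      where
      ab∈ : (a , b) ∈ inner U
      ab∈ = subst ((a , b) ∈_) (sym e₃) (∈-++⁺ʳ m (here refl))
      b<b′ : b < b′
      b<b′ = ℕ.≤-<-trans (≤-last vU (proj₁ (proj₂ (inner-∈ vU ab∈)))) U<b′
      removeU : (∃ λ U₀ → Valid U₀ × inner U₀ ≡ m ++ r × insert (a , b) U₀ ≡ U × Any (Cross (a , b)) (arcs U₀ b′)) → _
      removeU (U₀ , vU₀ , e₀ , refl , x) =
        node P U₀ b′ ,
        node vP vU₀ (λ z∈ z∈U₀ → dis z∈ (word-insert⁺ U₀ (inj₁ z∈U₀)))
          (subst (_< last P) (root-insert (a , b) U₀) U<P) P<b′
          (ℕ.≤-<-trans (last-insert-≤ U₀ vU) U<b′) ,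
        trans (cong₂ (λ u v → inner P ++ (u , b′) ∷ v) (sym (root-insert (a , b) U₀)) e₀) (sym (++-assoc (inner P) _ r)) ,
        insert-right (ℕ.<-asym b<b′) x ,
        there (++⁺ʳ (inner P) x)

    inner-[] : ∀ t → inner t ≡ [] → t ≡ leaf (root t)
    inner-[] (leaf c) e = refl
    inner-[] (node P U b) e = contradiction e (λ e → nonempty (inner P) e)
      where
      nonempty : ∀ (xs : List Arc) {y ys} → xs ++ y ∷ ys ≢ []
      nonempty [] ()
      nonempty (_ ∷ _) ()

    no-member : ∀ {A : Set} (xs : List A) → (∀ {x} → x ∉ xs) → xs ≡ []
    no-member []       h = refl
    no-member (x ∷ xs) h = contradiction (here refl) h

    unsnoc : ∀ {A : Set} (xs : List A) → xs ≡ [] ⊎ ∃₂ λ l x → xs ≡ l ++ x ∷ []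
    unsnoc xs with initLast xs
    ... | []      = inj₁ refl
    ... | l ∷ʳ′ x = inj₂ (l , x , refl)

    -- Induction on the number of arcs. The last arc of `inner t` is maximal in `t`, and the
    -- agreement of orders on crossing pairs makes it maximal in `t′`. It is removed from both
    -- trees, and putting it back is the same function `insert` on equal trees.
    heap-injective : ∀ k {t t′} {β : Fin n} → length (inner t) ≡ k → Valid t → Valid t′ →
      last t < β → last t′ < β → root t ≡ root t′ →
      (∀ {x} → x ∈ inner t ⇔ x ∈ inner t′) →
      (∀ {x y} → Cross x y → Before x y (inner t) → Before x y (inner t′)) → t ≡ t′
    heap-injective k {t} {t′} {β} len v v′ t<β t′<β r mem ord with unsnoc (inner t)
    ... | inj₁ e = trans (inner-[] t e) (trans (cong leaf r) (sym (inner-[] t′ (no-member _ none))))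
      where
      none : ∀ {x} → x ∉ inner t′
      none x∈ with subst (_ ∈_) e (Equivalence.from mem x∈)
      ... | ()
    ... | inj₂ (l , x@(a , b) , e) with k | trans (sym len) (trans (cong length e) (length-++-sucʳ l x []))
    ... | zero   | ()
    ... | suc k′ | len′ with ∈-∃++ (Equivalence.to mem (subst (x ∈_) (sym e) (∈-++⁺ʳ l (here refl))))
    ... | l′ , r′ , e′ with remove v t<β e [] | remove v′ t′<β e′ ¬x
      where
      ¬x : All (λ y → ¬ Cross x y) r′
      ¬x = All.tabulate λ {y} y∈ c → before-asym (inner-unique v′)
        (subst (Before x y) (sym e′) (before-++ʳ l′ (here y∈)))
        (ord (cross-sym c) (subst (Before y x) (sym e)
          (before-++ (y∈l y∈ (cross-≢ c)) (here refl))))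
        where
        y∈l : ∀ {y} → y ∈ r′ → x ≢ y → y ∈ l
        y∈l y∈ x≢y = subst (_ ∈_) (++-identityʳ l)
          (∈-delete l (λ y≡x → x≢y (sym y≡x)) (subst (_ ∈_) e (Equivalence.from mem (subst (_ ∈_) (sym e′) (∈-++⁺ʳ l′ (there y∈))))))
    ... | t₀ , v₀ , e₀ , refl , _ | t₀′ , v₀′ , e₀′ , refl , _ =
      cong (insert x) (heap-injective k′ (trans (cong length e₀) (ℕ.suc-injective (sym len′))) v₀ v₀′
        (ℕ.≤-<-trans (last-insert-≤ t₀ v) t<β) (ℕ.≤-<-trans (last-insert-≤ t₀′ v′) t′<β)
        (trans (sym (root-insert x t₀)) (trans r (root-insert x t₀′)))
        (mk⇔ to from) ord′)
      where
      u : Unique (l ++ x ∷ [])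
      u = subst Unique e (inner-unique v)
      u′ : Unique (l′ ++ x ∷ r′)
      u′ = subst Unique e′ (inner-unique v′)
      to : ∀ {y} → y ∈ inner t₀ → y ∈ inner t₀′
      to {y} y∈ = subst (y ∈_) (sym e₀′) (∈-delete l′ (unique-delete l u y∈′) (subst (y ∈_) e′
          (Equivalence.to mem (subst (y ∈_) (sym e) (∈-insert l y∈′)))))
        where y∈′ = subst (y ∈_) e₀ y∈
      from : ∀ {y} → y ∈ inner t₀′ → y ∈ inner t₀
      from {y} y∈ = subst (y ∈_) (sym e₀) (∈-delete l (unique-delete l′ u′ y∈′) (subst (y ∈_) e
          (Equivalence.from mem (subst (y ∈_) (sym e′) (∈-insert l′ y∈′)))))
        where y∈′ = subst (y ∈_) e₀′ y∈
      ord′ : ∀ {y z} → Cross y z → Before y z (inner t₀) → Before y z (inner t₀′)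
      ord′ {y} {z} c p = subst (Before y z) (sym e₀′)
        (before-delete l′ (unique-delete l u (proj₁ (before-∈ p′))) (unique-delete l u (proj₂ (before-∈ p′)))
          (subst (Before y z) e′ (ord c (subst (Before y z) (sym e) (before-insert l p′)))))
        where p′ = subst (Before y z) e₀ p

    -- Dropped on done one after another, no piece of xs becomes minimal in the heap.
    data Linked (done : List Arc) : List Arc → Set where
      []  : Linked done []
      _∷_ : ∀ {x xs} → Any (Cross x) done → Linked (x ∷ done) xs → Linked done (x ∷ xs)

    Separate : Arc → Arc → Set
    Separate (a , b) (a′ , b′) = a′ ≢ a × a′ ≢ b × b′ ≢ a × b′ ≢ b

    record Realises (t : Tree) (β : Fin n) (xs : List Arc) (t* : Tree) : Set where
      field
        valid : Valid t*
        bound : last t* < β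
        roots : root t* ≡ root t
        to    : ∀ {x} → x ∈ inner t ++ xs → x ∈ inner t*
        from  : ∀ {x} → x ∈ inner t* → x ∈ inner t ++ xs
        order : ∀ {x y} → Cross x y → Before x y (inner t ++ xs) → Before x y (inner t*)

    -- The tree accumulates the dropped pieces. Since `done` lies among its arcs, `Linked` supplies
    -- the crossing that `insert-valid` asks for at every step.
    heap-surjective : ∀ {done} {β : Fin n} t xs → Valid t → last t < β →
      (∀ {x} → x ∈ done → x ∈ arcs t β) → Linked done xs →
      All (λ (a , b) → a < b × b < β) xs → All (λ x → Fresh x t) xs → AllPairs Separate xs →
      ∃ λ t* → Realises t β xs t*
    heap-surjective t [] v t<β done linked small fresh sep = t , record
      { valid = v ; bound = t<β ; roots = refl
      ; to = subst (_ ∈_) (++-identityʳ (inner t)) ; from = subst (_ ∈_) (sym (++-identityʳ (inner t)))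
      ; order = λ _ → subst (Before _ _) (++-identityʳ (inner t)) }
    heap-surjective {β = β} t (x@(a , b) ∷ xs) v t<β done (x-linked ∷ linked) ((a<b , b<β) ∷ small) (x-fresh ∷ fresh) (x-sep ∷ sep)
      with inner-insert x t
    ... | l , r , e , e′ , ¬x = extend (heap-surjective (insert x t) xs v′ (last-insert-< {β = β} t t<β b<β) done′ linked small
            (All.tabulate λ y∈ → fresh′ (All.lookup fresh y∈) (All.lookup x-sep y∈)) sep)
      where
      v′ : Valid (insert x t)
      v′ = insert-valid v t<β a<b b<β x-fresh (any-⊆ done x-linked)
      done′ : ∀ {y} → y ∈ x ∷ _ → y ∈ arcs (insert x t) β
      done′ (here refl) = there (subst (x ∈_) (sym e′) (∈-++⁺ʳ l (here refl)))
      done′ (there y∈) with done y∈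
      ... | here refl = here (cong (_, β) (sym (root-insert x t)))
      ... | there y∈t = there (subst (_ ∈_) (sym e′) (∈-insert l (subst (_ ∈_) e y∈t)))
      fresh′ : ∀ {y} → Fresh y t → Separate x y → Fresh y (insert x t)
      fresh′ f (a′≢a , a′≢b , b′≢a , b′≢b) z∈ with word-insert⁻ t z∈
      ... | inj₁ z∈t         = f z∈t
      ... | inj₂ (inj₁ refl) = (λ z≡ → a′≢a (sym z≡)) , (λ z≡ → b′≢a (sym z≡))
      ... | inj₂ (inj₂ refl) = (λ z≡ → a′≢b (sym z≡)) , (λ z≡ → b′≢b (sym z≡))
      to′ : ∀ {y} → y ∈ inner t ++ x ∷ xs → y ∈ inner (insert x t) ++ xs
      to′ y∈ with ∈-++⁻ (inner t) y∈
      ... | inj₁ p           = ∈-++⁺ˡ (subst (_ ∈_) (sym e′) (∈-insert l (subst (_ ∈_) e p)))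
      ... | inj₂ (here refl) = ∈-++⁺ˡ (subst (_ ∈_) (sym e′) (∈-++⁺ʳ l (here refl)))
      ... | inj₂ (there p)   = ∈-++⁺ʳ (inner (insert x t)) p
      from′ : ∀ {y} → y ∈ inner (insert x t) ++ xs → y ∈ inner t ++ x ∷ xs
      from′ y∈ with ∈-++⁻ (inner (insert x t)) y∈
      ... | inj₂ p = ∈-++⁺ʳ (inner t) (there p)
      ... | inj₁ p with ∈-++⁻ l (subst (_ ∈_) e′ p)
      ... | inj₁ q           = ∈-++⁺ˡ (subst (_ ∈_) (sym e) (∈-++⁺ˡ q))
      ... | inj₂ (here refl) = ∈-++⁺ʳ (inner t) (here refl)
      ... | inj₂ (there q)   = ∈-++⁺ˡ (subst (_ ∈_) (sym e) (∈-++⁺ʳ l q))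
      -- Only pieces not crossing x change their order relative to x.
      order′ : ∀ {y z} → Cross y z → Before y z (inner t ++ x ∷ xs) → Before y z (inner (insert x t) ++ xs)
      order′ {y} {z} c p with before-++⁻ (inner t) p
      ... | inj₁ q = before-++ˡ xs (subst (Before y z) (sym e′) (before-insert l (subst (Before y z) e q)))
      ... | inj₂ (inj₂ (here z∈)) = before-++ (subst (x ∈_) (sym e′) (∈-++⁺ʳ l (here refl))) z∈
      ... | inj₂ (inj₂ (there q)) = before-++ʳ (inner (insert x t)) q
      ... | inj₂ (inj₁ (y∈ , there z∈)) = before-++ (subst (y ∈_) (sym e′) (∈-insert l (subst (y ∈_) e y∈))) z∈
      ... | inj₂ (inj₁ (y∈ , here refl)) with ∈-++⁻ l (subst (y ∈_) e y∈)
      ... | inj₁ y∈l = before-++ˡ xs (subst (Before y z) (sym e′) (before-++ y∈l (here refl)))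
      ... | inj₂ y∈r = contradiction (cross-sym c) (All.lookup ¬x y∈r)
      extend : (∃ λ t* → Realises (insert x t) β xs t*) → ∃ λ t* → Realises t β (x ∷ xs) t*
      extend (t* , R) = t* , record
        { valid = R.valid ; bound = R.bound ; roots = trans R.roots (root-insert x t)
        ; to = λ y∈ → R.to (to′ y∈) ; from = λ y∈ → from′ (R.from y∈)
        ; order = λ c p → R.order c (order′ c p) }
        where module R = Realises R

-- Cuts and splits of lists, and their numbers

module Lists where
  open Sums using (Summand; sumC; sumS)
  open Before using (unique-++⁻)
  open import Data.Integer.Base as ℤ using (ℤ; +_; 0ℤ)
  import Data.Integer.Properties as ℤ
  open import Data.List.Relation.Binary.Sublist.Propositional using (_⊆_; []; _∷_; _∷ʳ_)
  import Data.List.Relation.Binary.Sublist.Propositional as Sublist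
  open import Data.List.Relation.Binary.Sublist.Propositional.Properties using (All-resp-⊆)

  module _ {A : Set} where

    -- `cuts` and `splits` list the choices over which `sumC` and `sumS` sum; see `sumL-cuts` and
    -- `sumL-splits`.
    cuts : List A → List (List A × A × List A)
    cuts []       = []
    cuts (x ∷ xs) = ([] , x , xs) ∷ map (λ (l , y , r) → x ∷ l , y , r) (cuts xs)

    splits : List A → List (List A × List A)
    splits []       = ([] , []) ∷ []
    splits (x ∷ xs) = map (λ (l , r) → x ∷ l , r) (splits xs) ++ map (λ (l , r) → l , x ∷ r) (splits xs)

    ∈-cuts⁻ : ∀ xs {l y r} → (l , y , r) ∈ cuts xs → xs ≡ l ++ y ∷ r
    ∈-cuts⁻ (x ∷ xs) (here refl) = refl
    ∈-cuts⁻ (x ∷ xs) (there p) with ∈-map⁻ _ p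
    ... | _ , q , refl = cong (x ∷_) (∈-cuts⁻ xs q)

    ∈-cuts⁺ : ∀ l {y r} → (l , y , r) ∈ cuts (l ++ y ∷ r)
    ∈-cuts⁺ []      = here refl
    ∈-cuts⁺ (x ∷ l) = there (∈-map⁺ _ (∈-cuts⁺ l))

    cuts-unique : ∀ xs → Unique (cuts xs)
    cuts-unique []       = []
    cuts-unique (x ∷ xs) = All.tabulate (λ p e → differ (∈-map⁻ _ p) e) ∷
      Unique.map⁺ (λ { refl → refl }) (cuts-unique xs)
      where
      differ : ∀ {c} → (∃ λ d → d ∈ cuts xs × c ≡ (x ∷ proj₁ d , proj₂ d)) → ([] , x , xs) ≢ c
      differ (_ , _ , refl) ()

    cut-determined : ∀ l {l′ : List A} {y r r′} → Unique (l ++ y ∷ r) → l ++ y ∷ r ≡ l′ ++ y ∷ r′ →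
      (l , y , r) ≡ (l′ , y , r′)
    cut-determined []      {[]}     u refl = refl
    cut-determined []      {x ∷ l′} (y∉ ∷ u) refl = contradiction refl (All.lookup y∉ (∈-++⁺ʳ l′ (here refl)))
    cut-determined (x ∷ l) {[]}     (x∉ ∷ u) refl = contradiction refl (All.lookup x∉ (∈-++⁺ʳ l (here refl)))
    cut-determined (x ∷ l) {x′ ∷ l′} (x∉ ∷ u) e with cong (λ { [] → x ; (z ∷ _) → z }) e | cong (λ { [] → [] ; (_ ∷ zs) → zs }) e
    ... | refl | e′ with cut-determined l u e′
    ... | refl = refl

    ∈-splits⁻ : ∀ xs {l r} → (l , r) ∈ splits xs → l ⊆ xs × r ⊆ xs × (∀ {x} → x ∈ xs → x ∈ l ⊎ x ∈ r)
    ∈-splits⁻ [] (here refl) = [] , [] , λ ()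
    ∈-splits⁻ (x ∷ xs) p with ∈-++⁻ (map (λ (l , r) → x ∷ l , r) (splits xs)) p
    ... | inj₁ q with ∈-map⁻ _ q
    ... | _ , q′ , refl with ∈-splits⁻ xs q′
    ... | l⊆ , r⊆ , cover = refl ∷ l⊆ , x ∷ʳ r⊆ , λ { (here refl) → inj₁ (here refl) ; (there z∈) → shift (cover z∈) }
      where
      shift : ∀ {z l r} → z ∈ l ⊎ z ∈ r → z ∈ x ∷ l ⊎ z ∈ r
      shift (inj₁ z∈) = inj₁ (there z∈)
      shift (inj₂ z∈) = inj₂ z∈
    ∈-splits⁻ (x ∷ xs) p | inj₂ q with ∈-map⁻ _ q
    ... | _ , q′ , refl with ∈-splits⁻ xs q′
    ... | l⊆ , r⊆ , cover = x ∷ʳ l⊆ , refl ∷ r⊆ , λ { (here refl) → inj₂ (here refl) ; (there z∈) → shift (cover z∈) }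
      where
      shift : ∀ {z l r} → z ∈ l ⊎ z ∈ r → z ∈ l ⊎ z ∈ x ∷ r
      shift (inj₁ z∈) = inj₁ z∈
      shift (inj₂ z∈) = inj₂ (there z∈)

    splits-disjoint : ∀ {xs} → Unique xs → ∀ {l r} → (l , r) ∈ splits xs → ∀ {x} → x ∈ l → x ∉ r
    splits-disjoint {[]} [] (here refl) ()
    splits-disjoint {x ∷ xs} (x∉ ∷ u) p with ∈-++⁻ (map (λ (l , r) → x ∷ l , r) (splits xs)) p
    ... | inj₁ q with ∈-map⁻ _ q
    ... | _ , q′ , refl = λ
      { (here refl) x∈r → All.lookup x∉ (Sublist.lookup (proj₁ (proj₂ (∈-splits⁻ xs q′))) x∈r) refl
      ; (there z∈)  z∈r → splits-disjoint u q′ z∈ z∈r }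
    splits-disjoint {x ∷ xs} (x∉ ∷ u) p | inj₂ q with ∈-map⁻ _ q
    ... | _ , q′ , refl = λ
      { x∈l (here refl) → All.lookup x∉ (Sublist.lookup (proj₁ (∈-splits⁻ xs q′)) x∈l) refl
      ; z∈l (there z∈)  → splits-disjoint u q′ z∈l z∈ }

    ∈-splits⁺ : ∀ {P : A → Set} (P? : Decidable P) xs → (filter P? xs , filter (λ x → ¬? (P? x)) xs) ∈ splits xs
    ∈-splits⁺ P? [] = here refl
    ∈-splits⁺ P? (x ∷ xs) with P? x
    ... | yes _ = ∈-++⁺ˡ (∈-map⁺ _ (∈-splits⁺ P? xs))
    ... | no  _ = ∈-++⁺ʳ (map (λ (l , r) → x ∷ l , r) (splits xs)) (∈-map⁺ _ (∈-splits⁺ P? xs))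

    -- Lets a split be recovered from the tree that is built with it, P being membership in one of
    -- the parts.
    split-determined : ∀ {P : A → Set} (P? : Decidable P) xs {l r} → (l , r) ∈ splits xs →
      (∀ {x} → x ∈ l → P x) → (∀ {x} → x ∈ r → ¬ P x) → (l , r) ≡ (filter P? xs , filter (λ x → ¬? (P? x)) xs)
    split-determined P? [] (here refl) hl hr = refl
    split-determined P? (x ∷ xs) p hl hr with ∈-++⁻ (map (λ (l , r) → x ∷ l , r) (splits xs)) p
    ... | inj₁ q with ∈-map⁻ _ q
    ... | _ , q′ , refl with P? x | split-determined P? xs q′ (λ z∈ → hl (there z∈)) hr
    ... | yes _ | refl = refl
    ... | no ¬p | _    = contradiction (hl (here refl)) ¬p
    split-determined P? (x ∷ xs) p hl hr | inj₂ q with ∈-map⁻ _ q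
    ... | _ , q′ , refl with P? x | split-determined P? xs q′ hl (λ z∈ → hr (there z∈))
    ... | no  _ | refl = refl
    ... | yes p | _    = contradiction p (hr (here refl))

    splits-unique : ∀ {xs} → Unique xs → Unique (splits xs)
    splits-unique []             = [] ∷ []
    splits-unique {x ∷ xs} (x∉ ∷ u) = Unique.++⁺
      (Unique.map⁺ (λ { refl → refl }) (splits-unique u)) (Unique.map⁺ (λ { refl → refl }) (splits-unique u)) disjoint
      where
      disjoint : ∀ {s} → ¬ (s ∈ map (λ (l , r) → x ∷ l , r) (splits xs) × s ∈ map (λ (l , r) → l , x ∷ r) (splits xs))
      disjoint (p , q) with ∈-map⁻ _ p | ∈-map⁻ _ q
      ... | (l , _) , _ , refl | _ , q′ , refl =
        All.lookup x∉ (Sublist.lookup (proj₁ (∈-splits⁻ xs q′)) (here refl)) refl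

    AllPairs-resp-⊆ : ∀ {R : A → A → Set} {xs ys} → xs ⊆ ys → AllPairs R ys → AllPairs R xs
    AllPairs-resp-⊆ []         []       = []
    AllPairs-resp-⊆ (_ ∷ʳ τ)   (_ ∷ ps) = AllPairs-resp-⊆ τ ps
    AllPairs-resp-⊆ (refl ∷ τ) (p ∷ ps) = All-resp-⊆ τ p ∷ AllPairs-resp-⊆ τ ps

    AllPairs-++⁻ : ∀ {R : A → A → Set} xs {ys x y} → AllPairs R (xs ++ ys) → x ∈ xs → y ∈ ys → R x y
    AllPairs-++⁻ (_ ∷ xs) (p ∷ ps) (here refl) y∈ = All.lookup p (∈-++⁺ʳ xs y∈)
    AllPairs-++⁻ (_ ∷ xs) (p ∷ ps) (there x∈)  y∈ = AllPairs-++⁻ xs ps x∈ y∈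

    sumL : List A → (A → ℤ) → ℤ
    sumL []       f = 0ℤ
    sumL (x ∷ xs) f = f x ℤ.+ sumL xs f

    sumL-cong : ∀ xs {f g : A → ℤ} → (∀ {x} → x ∈ xs → f x ≡ g x) → sumL xs f ≡ sumL xs g
    sumL-cong []       h = refl
    sumL-cong (x ∷ xs) h = cong₂ ℤ._+_ (h (here refl)) (sumL-cong xs λ p → h (there p))

    sumL-++ : ∀ xs ys {f : A → ℤ} → sumL (xs ++ ys) f ≡ sumL xs f ℤ.+ sumL ys f
    sumL-++ []       ys = sym (ℤ.+-identityˡ _)
    sumL-++ (x ∷ xs) ys {f} = trans (cong (ℤ._+_ (f x)) (sumL-++ xs ys)) (sym (ℤ.+-assoc (f x) _ _))

  module _ {A B : Set} where

    sumL-map : ∀ (h : A → B) xs {f : B → ℤ} → sumL (map h xs) f ≡ sumL xs (λ x → f (h x))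
    sumL-map h []       = refl
    sumL-map h (x ∷ xs) {f} = cong (ℤ._+_ (f (h x))) (sumL-map h xs)

    length-concatMap : ∀ (h : A → List B) xs → + length (concatMap h xs) ≡ sumL xs (λ x → + length (h x))
    length-concatMap h [] = refl
    length-concatMap h (x ∷ xs) = trans (cong +_ (length-++ (h x)))
      (trans (ℤ.pos-+ (length (h x)) _) (cong (ℤ._+_ (+ length (h x))) (length-concatMap h xs)))

    concatMap-unique : ∀ {h : A → List B} {xs} → Unique xs → (∀ {x} → x ∈ xs → Unique (h x)) →
      (∀ {x y z} → x ∈ xs → y ∈ xs → z ∈ h x → z ∈ h y → x ≡ y) → Unique (concatMap h xs)
    concatMap-unique {xs = []} u uh dis = []
    concatMap-unique {h} {x ∷ xs} (x∉ ∷ u) uh dis = Unique.++⁺ (uh (here refl))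
      (concatMap-unique u (λ p → uh (there p)) λ p q → dis (there p) (there q))
      λ (z∈ , z∈′) → clash z∈ (find (∈-concatMap⁻ h z∈′))
      where
      clash : ∀ {z} → z ∈ h x → ¬ (∃ λ y → y ∈ xs × z ∈ h y)
      clash z∈ (y , y∈ , z∈′) = All.lookup x∉ y∈ (dis (here refl) (there y∈) z∈ z∈′)

  length-product : ∀ {A B C : Set} (f : A → B → C) xs ys →
    + length (cartesianProductWith f xs ys) ≡ + length xs ℤ.* + length ys
  length-product f []       ys = sym (ℤ.*-zeroˡ (+ length ys))
  length-product f (x ∷ xs) ys = begin
    + length (map (f x) ys ++ cartesianProductWith f xs ys)
      ≡⟨ cong +_ (length-++ (map (f x) ys)) ⟩
    + (length (map (f x) ys) ℕ.+ length (cartesianProductWith f xs ys))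
      ≡⟨ ℤ.pos-+ (length (map (f x) ys)) _ ⟩
    + length (map (f x) ys) ℤ.+ + length (cartesianProductWith f xs ys)
      ≡⟨ cong₂ (λ u v → + u ℤ.+ v) (length-map (f x) ys) (length-product f xs ys) ⟩
    + length ys ℤ.+ + length xs ℤ.* + length ys
      ≡⟨ ℤ.suc-* (+ length xs) (+ length ys) ⟨
    + length (x ∷ xs) ℤ.* + length ys ∎
    where open ≡-Reasoning

  sumL-cuts : ∀ {A : Set} (xs : List A) (F : Summand) → sumL (cuts xs) (λ (l , _ , r) → F (length l) (length r)) ≡ sumC (length xs) F
  sumL-cuts []       F = refl
  sumL-cuts (x ∷ xs) F = cong (ℤ._+_ (F 0 (length xs))) (trans (sumL-map _ (cuts xs)) (sumL-cuts xs λ i → F (suc i)))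

  sumL-splits : ∀ {A : Set} (xs : List A) (F : Summand) → sumL (splits xs) (λ (l , r) → F (length l) (length r)) ≡ sumS (length xs) F
  sumL-splits []       F = ℤ.+-identityʳ (F 0 0)
  sumL-splits (x ∷ xs) F = trans (sumL-++ (map (λ (l , r) → x ∷ l , r) (splits xs)) _) (cong₂ ℤ._+_
    (trans (sumL-map _ (splits xs)) (sumL-splits xs λ i → F (suc i)))
    (trans (sumL-map _ (splits xs)) (sumL-splits xs λ i j → F i (suc j))))

-- Enumeration of the valid trees by their first pop

module Enum where
  open Sums using (sumC; sumS; g; δ; IsSum; sumC-cong; sumC-isSum; sumS-isSum)
  open Before using (unique-++⁻)
  open Trees
  open Lists
  open import Data.Integer.Base as ℤ using (ℤ; +_; 0ℤ)
  import Data.Integer.Properties as ℤ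
  open import Data.List.Relation.Binary.Sublist.Propositional using (_⊆_; []; _∷_; _∷ʳ_; ⊆-refl; ⊆-trans; ⊆-reflexive)
  import Data.List.Relation.Binary.Sublist.Propositional as Sublist
  open import Data.List.Relation.Binary.Sublist.Propositional.Properties using (++⁺; ++⁺ˡ; ++⁺ʳ)

  open Equivalence using (to; from)

  module _ {n : ℕ} where

    open DecMembership (_≟_ {n}) using (_∈?_)

    -- The tree with word c ∷ word U ++ word R: its first pop is root R.
    cons : Fin n → Tree → Tree → Tree
    cons c U (leaf b)     = node (leaf c) U b
    cons c U (node P V b) = node (cons c U P) V b

    uncons : ∀ (t : Tree {n}) → t ≡ leaf (root t) ⊎ (∃₂ λ U R → t ≡ cons (root t) U R)
    uncons (leaf c) = inj₁ refl
    uncons (node P V b) with uncons P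
    ... | inj₁ e           = inj₂ (V , leaf b , cong (λ T → node T V b) e)
    ... | inj₂ (U , R , e) = inj₂ (U , node R V b , cong (λ T → node T V b) e)

    root-cons : ∀ c U R → root (cons c U R) ≡ c
    root-cons c U (leaf b)     = refl
    root-cons c U (node P V b) = root-cons c U P

    last-cons : ∀ c U R → last (cons c U R) ≡ last R
    last-cons c U (leaf b)     = refl
    last-cons c U (node P V b) = refl

    leaf≢cons : ∀ {c c′ : Fin n} {U} R → leaf c ≢ cons c′ U R
    leaf≢cons (leaf _)     ()
    leaf≢cons (node _ _ _) ()

    cons-injective : ∀ {c c′ U U′} R R′ → cons c U R ≡ cons c′ U′ R′ → U ≡ U′ × R ≡ R′
    cons-injective (leaf b)     (leaf b′)       refl = refl , refl
    cons-injective (leaf b)     (node P′ V′ b′) e = contradiction (proj₁ (node-injective e)) (leaf≢cons P′)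
    cons-injective (node P V b) (leaf b′)       e = contradiction (sym (proj₁ (node-injective e))) (leaf≢cons P)
    cons-injective (node P V b) (node P′ V′ b′) e with node-injective e
    ... | e′ , refl , refl with cons-injective P P′ e′
    ... | eU , refl = eU , refl

    word-cons⁻ : ∀ c U R {z} → z ∈ word (cons c U R) → z ≡ c ⊎ z ∈ word U ⊎ z ∈ word R
    word-cons⁻ c U (leaf b) z∈ with ∈-word⁻ (leaf c) U z∈
    ... | inj₁ (here refl)  = inj₁ refl
    ... | inj₂ (inj₁ p)     = inj₂ (inj₁ p)
    ... | inj₂ (inj₂ refl)  = inj₂ (inj₂ (here refl))
    word-cons⁻ c U (node P V b) z∈ with ∈-word⁻ (cons c U P) V z∈
    ... | inj₂ (inj₁ p)     = inj₂ (inj₂ (∈-wordᵐ P V p))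
    ... | inj₂ (inj₂ refl)  = inj₂ (inj₂ (∈-wordʳ P V))
    ... | inj₁ p with word-cons⁻ c U P p
    ... | inj₁ q        = inj₁ q
    ... | inj₂ (inj₁ q) = inj₂ (inj₁ q)
    ... | inj₂ (inj₂ q) = inj₂ (inj₂ (∈-wordˡ P V q))

    word-cons⁺ : ∀ c U R {z} → z ≡ c ⊎ z ∈ word U ⊎ z ∈ word R → z ∈ word (cons c U R)
    word-cons⁺ c U (leaf b) (inj₁ refl)               = here refl
    word-cons⁺ c U (leaf b) (inj₂ (inj₁ p))           = ∈-wordᵐ (leaf c) U p
    word-cons⁺ c U (leaf b) (inj₂ (inj₂ (here refl))) = ∈-wordʳ (leaf c) U
    word-cons⁺ c U (node P V b) (inj₁ p)        = ∈-wordˡ (cons c U P) V (word-cons⁺ c U P (inj₁ p))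
    word-cons⁺ c U (node P V b) (inj₂ (inj₁ p)) = ∈-wordˡ (cons c U P) V (word-cons⁺ c U P (inj₂ (inj₁ p)))
    word-cons⁺ c U (node P V b) (inj₂ (inj₂ p)) with ∈-word⁻ P V p
    ... | inj₁ q           = ∈-wordˡ (cons c U P) V (word-cons⁺ c U P (inj₂ (inj₂ q)))
    ... | inj₂ (inj₁ q)    = ∈-wordᵐ (cons c U P) V q
    ... | inj₂ (inj₂ refl) = ∈-wordʳ (cons c U P) V

    -- At the first pop the letter before the push is the root itself. The inequalities of `Valid`
    -- there become the three between `c`, U and `root R`.
    record ValidCons (c : Fin n) (U R : Tree) : Set where
      field
        validU   : Valid U
        validR   : Valid R
        U<c      : root U < c
        c<R      : c < root R
        U<R      : last U < root R
        disjoint : ∀ {z} → z ∈ word U → z ∉ word R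
        c∉U      : c ∉ word U
        c∉R      : c ∉ word R

    valid-cons⁺ : ∀ {c U} R → ValidCons c U R → Valid (cons c U R)
    valid-cons⁺ (leaf b) v = node leaf validU (λ { (here refl) → c∉U }) U<c c<R U<R
      where open ValidCons v
    valid-cons⁺ {c} {U} (node P V b) v = helper validR
      where
      open ValidCons v
      helper : Valid (node P V b) → Valid (cons c U (node P V b))
      helper (node vP vV dis V<P P<b V<b) = node vP′ vV dis′
        (subst (λ z → root V < z) (sym (last-cons c U P)) V<P) (subst (_< b) (sym (last-cons c U P)) P<b) V<b
        where
        vP′ : Valid (cons c U P)
        vP′ = valid-cons⁺ P (record
          { validU = validU ; validR = vP ; U<c = U<c ; c<R = c<R ; U<R = U<R
          ; disjoint = λ z∈ z∈P → disjoint z∈ (∈-wordˡ P V z∈P) ; c∉U = c∉U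
          ; c∉R = λ c∈P → c∉R (∈-wordˡ P V c∈P) })
        dis′ : ∀ {z} → z ∈ word (cons c U P) → z ∉ word V
        dis′ z∈ z∈V with word-cons⁻ c U P z∈
        ... | inj₁ refl       = c∉R (∈-wordᵐ P V z∈V)
        ... | inj₂ (inj₁ z∈U) = disjoint z∈U (∈-wordᵐ P V z∈V)
        ... | inj₂ (inj₂ z∈P) = dis z∈P z∈V

    valid-cons⁻ : ∀ {c U} R → Valid (cons c U R) → ValidCons c U R
    valid-cons⁻ (leaf b) (node _ vU dis U<c c<b U<b) = record
      { validU = vU ; validR = leaf ; U<c = U<c ; c<R = c<b ; U<R = U<b
      ; disjoint = λ { z∈ (here refl) → ℕ.<⇒≱ U<b (≤-last vU z∈) }
      ; c∉U = dis (here refl) ; c∉R = λ { (here refl) → ℕ.<-irrefl refl c<b } }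
    valid-cons⁻ {c} {U} (node P V b) (node vP′ vV dis V<P P<b V<b) = record
      { validU = validU
      ; validR = node validR vV (λ z∈P → dis (word-cons⁺ c U P (inj₂ (inj₂ z∈P))))
          (subst (λ z → root V < z) (last-cons c U P) V<P) P<b′ V<b
      ; U<c = U<c ; c<R = c<R ; U<R = U<R
      ; disjoint = disjoint′
      ; c∉U = c∉U
      ; c∉R = c∉R′ }
      where
      open ValidCons (valid-cons⁻ P vP′)
      P<b′ : last P < b
      P<b′ = subst (_< b) (last-cons c U P) P<b
      disjoint′ : ∀ {z} → z ∈ word U → z ∉ word (node P V b)
      disjoint′ z∈U z∈ with ∈-word⁻ P V z∈
      ... | inj₁ z∈P         = disjoint z∈U z∈P
      ... | inj₂ (inj₁ z∈V)  = dis (word-cons⁺ c U P (inj₂ (inj₁ z∈U))) z∈V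
      ... | inj₂ (inj₂ refl) = ℕ.<⇒≱ (ℕ.<-≤-trans (ℕ.≤-<-trans (≤-last validU z∈U) U<R) (≤-last validR (root∈ P)))
                                 (ℕ.<⇒≤ P<b′)
      c∉R′ : c ∉ word (node P V b)
      c∉R′ c∈ with ∈-word⁻ P V c∈
      ... | inj₁ c∈P         = c∉R c∈P
      ... | inj₂ (inj₁ c∈V)  = dis (word-cons⁺ c U P (inj₁ refl)) c∈V
      ... | inj₂ (inj₂ refl) = ℕ.<⇒≱ (ℕ.<-≤-trans c<R (≤-last validR (root∈ P))) (ℕ.<⇒≤ P<b′)

    -- The measure behind the bound of `trees`: by `size-cons`, both parts of a `cons` are smaller
    -- than the whole.
    size : Tree {n} → ℕ
    size (leaf c)     = 1
    size (node P U b) = suc (size P ℕ.+ size U)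

    size-cons : ∀ c U R → size (cons c U R) ≡ suc (size U ℕ.+ size R)
    size-cons c U (leaf b)     = cong suc (ℕ.+-comm 1 (size U))
    size-cons c U (node P V b) = cong suc (trans (cong (ℕ._+ size V) (size-cons c U P))
      (trans (cong suc (ℕ.+-assoc (size U) (size P) (size V))) (sym (ℕ.+-suc (size U) _))))

    size≤length : ∀ t → size t ℕ.≤ length (word t)
    size≤length (leaf c) = ℕ.≤-refl
    size≤length (node P U b) = begin
      suc (size P ℕ.+ size U)                            ≤⟨ s≤s (ℕ.+-mono-≤ (size≤length P) (size≤length U)) ⟩
      suc (length (word P) ℕ.+ length (word U))          ≡⟨ ℕ.+-suc (length (word P)) _ ⟨
      length (word P) ℕ.+ suc (length (word U))          ≡⟨ cong (length (word P) ℕ.+_) (ℕ.+-comm 1 (length (word U))) ⟩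
      length (word P) ℕ.+ (length (word U) ℕ.+ 1)        ≡⟨ cong (length (word P) ℕ.+_) (length-++ (word U)) ⟨
      length (word P) ℕ.+ length (word U ++ b ∷ [])      ≡⟨ length-++ (word P) ⟨
      length (word (node P U b))                         ∎
      where open ℕ.≤-Reasoning

    bare : List (Fin n) → Fin n → List (Fin n) → List Tree
    bare []      c []      = leaf c ∷ []
    bare []      c (_ ∷ _) = []
    bare (_ ∷ _) c _       = []

    Cut Split : Set
    Cut   = List (Fin n) × Fin n × List (Fin n)
    Split = List (Fin n) × List (Fin n)

    -- The valid trees of size at most k with root c and further letters lo below and hi above c.
    trees : ℕ → List (Fin n) → Fin n → List (Fin n) → List Tree
    grow₁ : ℕ → List (Fin n) → Fin n → Cut → List Tree
    grow₂ : ℕ → Fin n → Cut → Cut → List Tree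
    grow₃ : ℕ → Fin n → Cut → Cut → Split → List Tree
    grown : ℕ → Fin n → Cut → Cut → Split → Split → List Tree
    trees zero    lo c hi = []
    trees (suc k) lo c hi = bare lo c hi ++ concatMap (grow₁ k lo c) (cuts hi)
    grow₁ k lo c B = concatMap (grow₂ k c B) (cuts lo)
    grow₂ k c B A@(s , _ , _) = concatMap (grow₃ k c B A) (splits s)
    grow₃ k c B@(z , _ , _) A@(_ , _ , s′) S = concatMap (grown k c B A S) (splits (s′ ++ z))
    -- `a` and `b` are the roots of the two parts. Letters below `a` and letters between `a` and `b`
    -- may go to either part; letters above `b` belong to the second, because the first pop exceeds
    -- all of the first part.
    grown k c (z , b , y) (s , a , s′) (l , r) (l′ , r′) =
      cartesianProductWith (cons c) (trees k l a l′) (trees k (r ++ r′) b y)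

    length-trees : ∀ k lo c hi → + length (trees k lo c hi) ≡ g k (length lo) (length hi)
    length-trees zero lo c hi = refl
    length-trees (suc k) lo c hi = begin
      + length (bare lo c hi ++ G)
        ≡⟨ cong +_ (length-++ (bare lo c hi)) ⟩
      + (length (bare lo c hi) ℕ.+ length G)
        ≡⟨ ℤ.pos-+ (length (bare lo c hi)) (length G) ⟩
      + length (bare lo c hi) ℤ.+ + length G
        ≡⟨ cong₂ ℤ._+_ (length-bare lo hi) count ⟩
      g (suc k) (length lo) (length hi) ∎
      where
      open ≡-Reasoning
      length-bare : ∀ lo hi → + length (bare lo c hi) ≡ δ (length lo) (length hi)
      length-bare []      []      = refl
      length-bare []      (_ ∷ _) = refl
      length-bare (_ ∷ _) _       = refl
      G = concatMap (grow₁ k lo c) (cuts hi)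
      count : + length G ≡ sumC (length hi) λ Z Y → sumC (length lo) λ S S′ →
        sumS S λ s r → sumS (S′ ℕ.+ Z) λ u r′ → g k s u ℤ.* g k (r ℕ.+ r′) Y
      count = trans (length-concatMap (grow₁ k lo c) (cuts hi)) (trans (sumL-cong (cuts hi) λ {B@(z , b , y)} _ →
        trans (length-concatMap (grow₂ k c B) (cuts lo)) (trans (sumL-cong (cuts lo) λ {A@(s , a , s′)} _ →
          trans (length-concatMap (grow₃ k c B A) (splits s)) (trans (sumL-cong (splits s) λ {S@(l , r)} _ →
            trans (length-concatMap (grown k c B A S) (splits (s′ ++ z))) (trans (sumL-cong (splits (s′ ++ z)) λ {(l′ , r′)} _ →
              trans (length-product (cons c) (trees k l a l′) (trees k (r ++ r′) b y))
                (cong₂ ℤ._*_ (length-trees k l a l′)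
                  (trans (length-trees k (r ++ r′) b y) (cong (λ i → g k i (length y)) (length-++ r)))))
              (trans (sumL-splits (s′ ++ z) λ i j → g k (length l) i ℤ.* g k (length r ℕ.+ j) (length y))
                     (cong (λ i → sumS i λ u r′ → g k (length l) u ℤ.* g k (length r ℕ.+ r′) (length y)) (length-++ s′)))))
            (sumL-splits s λ i j → sumS (length s′ ℕ.+ length z) λ u r′ → g k i u ℤ.* g k (j ℕ.+ r′) (length y))))
          (sumL-cuts lo λ S S′ → sumS S λ s r → sumS (S′ ℕ.+ length z) λ u r′ → g k s u ℤ.* g k (r ℕ.+ r′) (length y))))
        (sumL-cuts hi λ Z Y → sumC (length lo) λ S S′ →
          sumS S λ s r → sumS (S′ ℕ.+ Z) λ u r′ → g k s u ℤ.* g k (r ℕ.+ r′) Y))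

    record Spec (t : Tree) (lo : List (Fin n)) (c : Fin n) (hi : List (Fin n)) : Set where
      field
        valid   : Valid t
        rooted  : root t ≡ c
        letters : ∀ {z} → z ∈ word t ⇔ z ∈ lo ++ c ∷ hi

    Sorted : List (Fin n) → Set
    Sorted = AllPairs _<_

    sorted-unique : ∀ {xs} → Sorted xs → Unique xs
    sorted-unique = AllPairs.map λ { p refl → ℕ.<-irrefl refl p }

    module _ {lo c hi} (sorted : Sorted (lo ++ c ∷ hi)) where

      lo< : ∀ {x} → x ∈ lo → x < c
      lo< x∈ = AllPairs-++⁻ lo sorted x∈ (here refl)

      <hi : ∀ {x} → x ∈ hi → c < x
      <hi x∈ = All.lookup (AllPairs.head (AllPairs-resp-⊆ (++⁺ˡ lo ⊆-refl) sorted)) x∈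

      ∈-lo : ∀ {x} → x ∈ lo ++ c ∷ hi → x < c → x ∈ lo
      ∈-lo x∈ x<c with ∈-++⁻ lo x∈
      ... | inj₁ p           = p
      ... | inj₂ (here refl) = contradiction x<c (ℕ.<-irrefl refl)
      ... | inj₂ (there p)   = contradiction (<hi p) (ℕ.<-asym x<c)

      ∈-hi : ∀ {x} → x ∈ lo ++ c ∷ hi → c < x → x ∈ hi
      ∈-hi x∈ c<x with ∈-++⁻ lo x∈
      ... | inj₁ p           = contradiction (lo< p) (ℕ.<-asym c<x)
      ... | inj₂ (here refl) = contradiction c<x (ℕ.<-irrefl refl)
      ... | inj₂ (there p)   = p

    module _ {s a s′ c z b y l r l′ r′} (sorted : Sorted ((s ++ a ∷ s′) ++ c ∷ (z ++ b ∷ y)))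
             (low : (l , r) ∈ splits s) (mid : (l′ , r′) ∈ splits (s′ ++ z)) where

      private
        lo hi whole left right : List (Fin n)
        lo    = s ++ a ∷ s′
        hi    = z ++ b ∷ y
        whole = lo ++ c ∷ hi
        left  = l ++ a ∷ l′
        right = (r ++ r′) ++ b ∷ y

      left⊆ : left ⊆ whole
      left⊆ = ⊆-trans (++⁺ (proj₁ (∈-splits⁻ s low))
          (refl ∷ ⊆-trans (proj₁ (∈-splits⁻ (s′ ++ z) mid)) (++⁺ ⊆-refl (c ∷ʳ ++⁺ʳ (b ∷ y) ⊆-refl))))
        (⊆-reflexive (sym (++-assoc s (a ∷ s′) _)))

      right⊆ : right ⊆ whole
      right⊆ = ⊆-trans (⊆-reflexive (++-assoc r r′ (b ∷ y)))
        (⊆-trans (++⁺ (proj₁ (proj₂ (∈-splits⁻ s low))) (a ∷ʳ ⊆-trans (++⁺ (proj₁ (proj₂ (∈-splits⁻ (s′ ++ z) mid))) ⊆-refl)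
                   (⊆-trans (⊆-reflexive (++-assoc s′ z (b ∷ y))) (++⁺ ⊆-refl (c ∷ʳ ⊆-refl)))))
                 (⊆-reflexive (sym (++-assoc s (a ∷ s′) _))))

      sorted-left : Sorted left
      sorted-left = AllPairs-resp-⊆ left⊆ sorted

      sorted-right : Sorted right
      sorted-right = AllPairs-resp-⊆ right⊆ sorted

      private
        sorted-lo : Sorted lo
        sorted-lo = AllPairs-resp-⊆ (++⁺ʳ (c ∷ hi) ⊆-refl) sorted

        sorted-hi : Sorted hi
        sorted-hi = AllPairs-resp-⊆ (++⁺ˡ lo (c ∷ʳ ⊆-refl)) sorted

        <a : ∀ {x} → x ∈ s → x < a
        <a = lo< sorted-lo

        a< : ∀ {x} → x ∈ s′ ++ z → a < x
        a< x∈ with ∈-++⁻ s′ x∈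
        ... | inj₁ p = <hi sorted-lo p
        ... | inj₂ p = ℕ.<-trans (lo< sorted (∈-++⁺ʳ s (here refl))) (<hi sorted (∈-++⁺ˡ p))

      c<b : c < b
      c<b = <hi sorted (∈-++⁺ʳ z (here refl))

      a<c : a < c
      a<c = lo< sorted (∈-++⁺ʳ s (here refl))

      l⊆ : ∀ {x} → x ∈ l → x ∈ s
      l⊆ = Sublist.lookup (proj₁ (∈-splits⁻ s low))

      r⊆ : ∀ {x} → x ∈ r → x ∈ s
      r⊆ = Sublist.lookup (proj₁ (proj₂ (∈-splits⁻ s low)))

      l′⊆ : ∀ {x} → x ∈ l′ → x ∈ s′ ++ z
      l′⊆ = Sublist.lookup (proj₁ (∈-splits⁻ (s′ ++ z) mid))

      r′⊆ : ∀ {x} → x ∈ r′ → x ∈ s′ ++ z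
      r′⊆ = Sublist.lookup (proj₁ (proj₂ (∈-splits⁻ (s′ ++ z) mid)))

      s′z-≢c : ∀ {x} → x ∈ s′ ++ z → x ≢ c
      s′z-≢c x∈ refl with ∈-++⁻ s′ x∈
      ... | inj₁ p = ℕ.<-irrefl refl (lo< sorted (∈-++⁺ʳ s (there p)))
      ... | inj₂ p = ℕ.<-irrefl refl (<hi sorted (∈-++⁺ˡ p))

      s-≢c : ∀ {x} → x ∈ s → x ≢ c
      s-≢c x∈ refl = ℕ.<-irrefl refl (lo< sorted (∈-++⁺ˡ x∈))

      left-≢c : c ∉ left
      left-≢c x∈ with ∈-++⁻ l x∈
      ... | inj₁ p           = s-≢c (l⊆ p) refl
      ... | inj₂ (here refl) = ℕ.<-irrefl refl a<c
      ... | inj₂ (there p)   = s′z-≢c (l′⊆ p) refl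

      right-≢c : c ∉ right
      right-≢c x∈ with ∈-++⁻ (r ++ r′) x∈
      ... | inj₂ p = ℕ.<-irrefl refl (<hi sorted (∈-++⁺ʳ z p))
      ... | inj₁ p with ∈-++⁻ r p
      ... | inj₁ q = s-≢c (r⊆ q) refl
      ... | inj₂ q = s′z-≢c (r′⊆ q) refl

      left<b : ∀ {x} → x ∈ left → x < b
      left<b x∈ with ∈-++⁻ l x∈
      ... | inj₁ p           = ℕ.<-trans (<a (l⊆ p)) (ℕ.<-trans a<c c<b)
      ... | inj₂ (here refl) = ℕ.<-trans a<c c<b
      ... | inj₂ (there p) with ∈-++⁻ s′ (l′⊆ p)
      ... | inj₁ q = ℕ.<-trans (lo< sorted (∈-++⁺ʳ s (there q))) c<b
      ... | inj₂ q = lo< sorted-hi q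

      r∌left : ∀ {x} → x ∈ r → x ∉ left
      r∌left x∈r x∈ with ∈-++⁻ l x∈
      ... | inj₁ p           = splits-disjoint (sorted-unique (AllPairs-resp-⊆ (++⁺ʳ (a ∷ s′) ⊆-refl) sorted-lo)) low p x∈r
      ... | inj₂ (here refl) = ℕ.<-irrefl refl (<a (r⊆ x∈r))
      ... | inj₂ (there p)   = ℕ.<-asym (<a (r⊆ x∈r)) (a< (l′⊆ p))

      sorted-s′z : Sorted (s′ ++ z)
      sorted-s′z = AllPairs-resp-⊆ (⊆-trans (⊆-trans (++⁺ ⊆-refl (c ∷ʳ ++⁺ʳ (b ∷ y) ⊆-refl)) (++⁺ˡ s (a ∷ʳ ⊆-refl)))
        (⊆-reflexive (sym (++-assoc s (a ∷ s′) _)))) sorted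

      r′∌left : ∀ {x} → x ∈ r′ → x ∉ left
      r′∌left x∈r x∈ with ∈-++⁻ l x∈
      ... | inj₁ p           = ℕ.<-asym (a< (r′⊆ x∈r)) (<a (l⊆ p))
      ... | inj₂ (here refl) = ℕ.<-irrefl refl (a< (r′⊆ x∈r))
      ... | inj₂ (there p)   = splits-disjoint (sorted-unique sorted-s′z) mid p x∈r

      by∌left : ∀ {x} → x ∈ b ∷ y → x ∉ left
      by∌left (here refl) x∈ = ℕ.<-irrefl refl (left<b x∈)
      by∌left (there p)   x∈ = ℕ.<-asym (left<b x∈) (<hi sorted-hi p)

      right∌left : ∀ {x} → x ∈ left → x ∉ right
      right∌left x∈ x∈′ with ∈-++⁻ (r ++ r′) x∈′
      ... | inj₂ p = by∌left p x∈
      ... | inj₁ p with ∈-++⁻ r p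
      ... | inj₁ q = r∌left q x∈
      ... | inj₂ q = r′∌left q x∈

      ∈-whole : ∀ {x} → x ∈ whole → x ≡ c ⊎ x ∈ left ⊎ x ∈ right
      ∈-whole x∈ with ∈-++⁻ lo x∈
      ... | inj₂ (here refl) = inj₁ refl
      ... | inj₁ p with ∈-++⁻ s p
      ∈-whole x∈ | inj₁ p | inj₂ (here refl) = inj₂ (inj₁ (∈-++⁺ʳ l (here refl)))
      ∈-whole x∈ | inj₁ p | inj₁ q with proj₂ (proj₂ (∈-splits⁻ s low)) q
      ... | inj₁ u = inj₂ (inj₁ (∈-++⁺ˡ u))
      ... | inj₂ u = inj₂ (inj₂ (∈-++⁺ˡ (∈-++⁺ˡ u)))
      ∈-whole x∈ | inj₁ p | inj₂ (there q) with proj₂ (proj₂ (∈-splits⁻ (s′ ++ z) mid)) (∈-++⁺ˡ q)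
      ... | inj₁ u = inj₂ (inj₁ (∈-++⁺ʳ l (there u)))
      ... | inj₂ u = inj₂ (inj₂ (∈-++⁺ˡ (∈-++⁺ʳ r u)))
      ∈-whole x∈ | inj₂ (there p) with ∈-++⁻ z p
      ... | inj₂ q = inj₂ (inj₂ (∈-++⁺ʳ (r ++ r′) q))
      ... | inj₁ q with proj₂ (proj₂ (∈-splits⁻ (s′ ++ z) mid)) (∈-++⁺ʳ s′ q)
      ... | inj₁ u = inj₂ (inj₁ (∈-++⁺ʳ l (there u)))
      ... | inj₂ u = inj₂ (inj₂ (∈-++⁺ˡ (∈-++⁺ʳ r u)))

      combine : ∀ {U R} → Spec U l a l′ → Spec R (r ++ r′) b y → Spec (cons c U R) lo c hi
      combine {U} {R} SU SR = record
        { valid = valid-cons⁺ R (record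
          { validU = U.valid ; validR = R.valid
          ; U<c = subst (_< c) (sym U.rooted) a<c
          ; c<R = subst (λ u → c < u) (sym R.rooted) c<b
          ; U<R = subst (λ u → last U < u) (sym R.rooted) (left<b (to U.letters (last∈ U)))
          ; disjoint = λ x∈U x∈R → right∌left (to U.letters x∈U) (to R.letters x∈R)
          ; c∉U = λ c∈ → left-≢c (to U.letters c∈)
          ; c∉R = λ c∈ → right-≢c (to R.letters c∈) })
        ; rooted = root-cons c U R
        ; letters = mk⇔ to′ λ x∈ → word-cons⁺ c U R (from′ (∈-whole x∈)) }
        where
        module U = Spec SU
        module R = Spec SR
        to′ : ∀ {x} → x ∈ word (cons c U R) → x ∈ whole
        to′ x∈ with word-cons⁻ c U R x∈
        ... | inj₁ refl     = ∈-++⁺ʳ lo (here refl)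
        ... | inj₂ (inj₁ p) = Sublist.lookup left⊆ (to U.letters p)
        ... | inj₂ (inj₂ p) = Sublist.lookup right⊆ (to R.letters p)
        from′ : ∀ {x} → x ≡ c ⊎ x ∈ left ⊎ x ∈ right → x ≡ c ⊎ x ∈ word U ⊎ x ∈ word R
        from′ (inj₁ p)        = inj₁ p
        from′ (inj₂ (inj₁ p)) = inj₂ (inj₁ (from U.letters p))
        from′ (inj₂ (inj₂ p)) = inj₂ (inj₂ (from R.letters p))

    trees-sound : ∀ k {lo c hi t} → Sorted (lo ++ c ∷ hi) → t ∈ trees k lo c hi → Spec t lo c hi
    grown-sound : ∀ k {s a s′ c z b y l r l′ r′ t} → Sorted ((s ++ a ∷ s′) ++ c ∷ (z ++ b ∷ y)) →
      (l , r) ∈ splits s → (l′ , r′) ∈ splits (s′ ++ z) →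
      t ∈ grown k c (z , b , y) (s , a , s′) (l , r) (l′ , r′) →
      ∃₂ λ U R → t ≡ cons c U R × Spec U l a l′ × Spec R (r ++ r′) b y × U ∈ trees k l a l′ × R ∈ trees k (r ++ r′) b y

    trees-sound (suc k) {lo} {c} {hi} sorted t∈ with ∈-++⁻ (bare lo c hi) t∈
    trees-sound (suc k) {[]} {c} {[]} sorted t∈ | inj₁ (here refl) = record
      { valid = leaf ; rooted = refl ; letters = mk⇔ (λ p → p) (λ p → p) }
    ... | inj₂ p with find (∈-concatMap⁻ (grow₁ k lo c) p)
    ... | (z , b , y) , B∈ , p₁ with find (∈-concatMap⁻ (grow₂ k c (z , b , y)) p₁)
    ... | (s , a , s′) , A∈ , p₂ with find (∈-concatMap⁻ (grow₃ k c (z , b , y) (s , a , s′)) p₂)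
    ... | (l , r) , S∈ , p₃ with find (∈-concatMap⁻ (grown k c (z , b , y) (s , a , s′) (l , r)) p₃)
    ... | (l′ , r′) , S′∈ , p₄ with ∈-cuts⁻ hi B∈ | ∈-cuts⁻ lo A∈
    ... | refl | refl with grown-sound k sorted S∈ S′∈ p₄
    ... | U , R , refl , SU , SR , _ = combine sorted S∈ S′∈ SU SR

    grown-sound k {a = a} {c = c} {b = b} {y} {l} {r} {l′} {r′} sorted S∈ S′∈ t∈
      with ∈-cartesianProductWith⁻ (cons c) (trees k l a l′) (trees k (r ++ r′) b y) t∈
    ... | U , R , U∈ , R∈ , refl = U , R , refl ,
      trees-sound k (sorted-left sorted S∈ S′∈) U∈ , trees-sound k (sorted-right sorted S∈ S′∈) R∈ , U∈ , R∈

    -- No tree arises twice because all choices can be read off it: the two cuts are at the roots of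
    -- R and U, and both splits are given by membership in U.
    trees-unique : ∀ k {lo c hi} → Sorted (lo ++ c ∷ hi) → Unique (trees k lo c hi)
    trees-unique zero sorted = []
    trees-unique (suc k) {lo} {c} {hi} sorted = Unique.++⁺ (bare-unique lo hi) unique₁ disjoint
      where
      bare-unique : ∀ lo hi → Unique (bare lo c hi)
      bare-unique []      []      = [] ∷ []
      bare-unique []      (_ ∷ _) = []
      bare-unique (_ ∷ _) _       = []

      sorted-at : ∀ {s a s′ z b y} → (z , b , y) ∈ cuts hi → (s , a , s′) ∈ cuts lo →
        Sorted ((s ++ a ∷ s′) ++ c ∷ (z ++ b ∷ y))
      sorted-at B∈ A∈ = subst₂ (λ u v → Sorted (u ++ c ∷ v)) (∈-cuts⁻ lo A∈) (∈-cuts⁻ hi B∈) sorted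

      Parts : Cut → Cut → Split → Split → Tree → Set
      Parts (z , b , y) (s , a , s′) (l , r) (l′ , r′) t =
        ∃₂ λ U R → t ≡ cons c U R × Spec U l a l′ × Spec R (r ++ r′) b y

      parts₃ : ∀ {B : Cut} {A@(s , _ , s′) : Cut} {S : Split} {t} → B ∈ cuts hi → A ∈ cuts lo → S ∈ splits s → t ∈ grow₃ k c B A S →
        ∃ λ S′ → S′ ∈ splits (s′ ++ proj₁ B) × Parts B A S S′ t
      parts₃ {B} {A} {S} B∈ A∈ S∈ t∈ with find (∈-concatMap⁻ (grown k c B A S) t∈)
      ... | S′ , S′∈ , p with grown-sound k (sorted-at B∈ A∈) S∈ S′∈ p
      ... | U , R , e , SU , SR , _ = S′ , S′∈ , U , R , e , SU , SR

      parts₂ : ∀ {B : Cut} {A@(s , _ , s′) : Cut} {t} → B ∈ cuts hi → A ∈ cuts lo → t ∈ grow₂ k c B A →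
        ∃₂ λ S S′ → S ∈ splits s × S′ ∈ splits (s′ ++ proj₁ B) × Parts B A S S′ t
      parts₂ {B} {A} B∈ A∈ t∈ with find (∈-concatMap⁻ (grow₃ k c B A) t∈)
      ... | S , S∈ , p with parts₃ B∈ A∈ S∈ p
      ... | S′ , S′∈ , q = S , S′ , S∈ , S′∈ , q

      parts₁ : ∀ {B : Cut} {t} → B ∈ cuts hi → t ∈ grow₁ k lo c B → ∃ λ A → ∃₂ λ S S′ → A ∈ cuts lo × Parts B A S S′ t
      parts₁ {B} B∈ t∈ with find (∈-concatMap⁻ (grow₂ k c B) t∈)
      ... | A , A∈ , p with parts₂ B∈ A∈ p
      ... | S , S′ , _ , _ , q = A , S , S′ , A∈ , q

      split-of : ∀ {B : Cut} {A@(s , _ , s′) : Cut} {S S′ : Split} {t} U R → t ≡ cons c U R → B ∈ cuts hi → A ∈ cuts lo →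
        S ∈ splits s → S′ ∈ splits (s′ ++ proj₁ B) → Parts B A S S′ t →
        S ≡ (filter (_∈? word U) s , filter (λ x → ¬? (x ∈? word U)) s) ×
        S′ ≡ (filter (_∈? word U) (s′ ++ proj₁ B) , filter (λ x → ¬? (x ∈? word U)) (s′ ++ proj₁ B))
      split-of {z , b , y} {s , a , s′} {l , r} {l′ , r′} U R e B∈ A∈ S∈ S′∈ (U′ , R′ , e′ , SU , SR) with cons-injective R R′ (trans (sym e) e′)
      ... | refl , refl =
        split-determined (_∈? word U) s S∈ (λ x∈ → from (Spec.letters SU) (∈-++⁺ˡ x∈))
          (λ x∈ x∈U → r∌left (sorted-at B∈ A∈) S∈ S′∈ x∈ (to (Spec.letters SU) x∈U)) ,
        split-determined (_∈? word U) (s′ ++ z) S′∈ (λ x∈ → from (Spec.letters SU) (∈-++⁺ʳ l (there x∈)))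
          (λ x∈ x∈U → r′∌left (sorted-at B∈ A∈) S∈ S′∈ x∈ (to (Spec.letters SU) x∈U))

      unique-s : ∀ {s a s′} → (s , a , s′) ∈ cuts lo → Unique s
      unique-s {s} A∈ = proj₁ (unique-++⁻ s (subst Unique (∈-cuts⁻ lo A∈) (proj₁ (unique-++⁻ lo (sorted-unique sorted)))))

      unique₄ : ∀ {B : Cut} {A@(s , _ , s′) : Cut} {S S′ : Split} → B ∈ cuts hi → A ∈ cuts lo → S ∈ splits s → S′ ∈ splits (s′ ++ proj₁ B) → Unique (grown k c B A S S′)
      unique₄ B∈ A∈ S∈ S′∈ = product-unique (λ {U} {U′} {R} {R′} → cons-injective {c = c} {c} {U} {U′} R R′)
        (trees-unique k (sorted-left (sorted-at B∈ A∈) S∈ S′∈)) (trees-unique k (sorted-right (sorted-at B∈ A∈) S∈ S′∈))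
        where
        product-unique : ∀ {A B C : Set} {f : A → B → C} {xs ys} → (∀ {w x y z} → f w y ≡ f x z → w ≡ x × y ≡ z) →
          Unique xs → Unique ys → Unique (cartesianProductWith f xs ys)
        product-unique {f = f} inj = Unique.cartesianProductWith⁺ f inj

      unique₃ : ∀ {B : Cut} {A@(s , _ , s′) : Cut} {S : Split} → B ∈ cuts hi → A ∈ cuts lo → S ∈ splits s → Unique (grow₃ k c B A S)
      unique₃ {B} {A@(s , a , s′)} {S} B∈ A∈ S∈ = concatMap-unique
        (splits-unique (sorted-unique (sorted-s′z′ B∈ A∈))) (unique₄ B∈ A∈ S∈) dis
        where
        sorted-s′z′ : ∀ {s a s′ z b y} → (z , b , y) ∈ cuts hi → (s , a , s′) ∈ cuts lo → Sorted (s′ ++ z)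
        -- `sorted-s′z` lives in a context with a split of each list. Membership in the empty list
        -- gives one, with everything in the second half.
        sorted-s′z′ {s} {s′ = s′} {z} B∈ A∈ = sorted-s′z (sorted-at B∈ A∈) (∈-splits⁺ (_∈? []) s) (∈-splits⁺ (_∈? []) (s′ ++ z))
        dis : ∀ {S₁ S₂ t} → S₁ ∈ splits (s′ ++ proj₁ B) → S₂ ∈ splits (s′ ++ proj₁ B) →
          t ∈ grown k c B A S S₁ → t ∈ grown k c B A S S₂ → S₁ ≡ S₂
        dis S₁∈ S₂∈ p q with grown-sound k (sorted-at B∈ A∈) S∈ S₁∈ p | grown-sound k (sorted-at B∈ A∈) S∈ S₂∈ q
        ... | U , R , e , SU , SR , _ | U′ , R′ , e′ , SU′ , SR′ , _ =
          trans (proj₂ (split-of U R e B∈ A∈ S∈ S₁∈ (U , R , e , SU , SR)))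
                (sym (proj₂ (split-of U R e B∈ A∈ S∈ S₂∈ (U′ , R′ , e′ , SU′ , SR′))))

      unique₂ : ∀ {B A : Cut} → B ∈ cuts hi → A ∈ cuts lo → Unique (grow₂ k c B A)
      unique₂ {B} {A@(s , a , s′)} B∈ A∈ = concatMap-unique (splits-unique (unique-s A∈)) (unique₃ B∈ A∈) dis
        where
        dis : ∀ {S₁ S₂ t} → S₁ ∈ splits s → S₂ ∈ splits s → t ∈ grow₃ k c B A S₁ → t ∈ grow₃ k c B A S₂ → S₁ ≡ S₂
        dis {S₁} {S₂} {t} S₁∈ S₂∈ p q = agree (parts₃ B∈ A∈ S₁∈ p) (parts₃ B∈ A∈ S₂∈ q)
          where
          agree : (∃ λ S′ → S′ ∈ splits (s′ ++ proj₁ B) × Parts B A S₁ S′ t) →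
            (∃ λ S′ → S′ ∈ splits (s′ ++ proj₁ B) × Parts B A S₂ S′ t) → S₁ ≡ S₂
          agree (_ , S₁′∈ , P@(U , R , e , _)) (_ , S₂′∈ , Q) =
            trans (proj₁ (split-of U R e B∈ A∈ S₁∈ S₁′∈ P)) (sym (proj₁ (split-of U R e B∈ A∈ S₂∈ S₂′∈ Q)))

      unique₁ : Unique (concatMap (grow₁ k lo c) (cuts hi))
      unique₁ = concatMap-unique (cuts-unique hi)
        (λ B∈ → concatMap-unique (cuts-unique lo) (unique₂ B∈) (disA B∈)) disB
        where
        disA : ∀ {B A₁ A₂ : Cut} {t} → B ∈ cuts hi → A₁ ∈ cuts lo → A₂ ∈ cuts lo → t ∈ grow₂ k c B A₁ → t ∈ grow₂ k c B A₂ → A₁ ≡ A₂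
        disA {B} {A₁} {A₂} {t} B∈ A₁∈ A₂∈ p q = agree (parts₂ B∈ A₁∈ p) (parts₂ B∈ A₂∈ q)
          where
          cut-at : ∀ {A₁ A₂} → A₁ ∈ cuts lo → A₂ ∈ cuts lo → proj₁ (proj₂ A₁) ≡ proj₁ (proj₂ A₂) → A₁ ≡ A₂
          cut-at {s₁ , a₁ , s₁′} A₁∈ A₂∈ refl = cut-determined s₁
            (subst Unique (∈-cuts⁻ lo A₁∈) (proj₁ (unique-++⁻ lo (sorted-unique sorted))))
            (trans (sym (∈-cuts⁻ lo A₁∈)) (∈-cuts⁻ lo A₂∈))
          agree : (∃₂ λ S S′ → S ∈ splits (proj₁ A₁) × S′ ∈ splits (proj₂ (proj₂ A₁) ++ proj₁ B) × Parts B A₁ S S′ t) →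
            (∃₂ λ S S′ → S ∈ splits (proj₁ A₂) × S′ ∈ splits (proj₂ (proj₂ A₂) ++ proj₁ B) × Parts B A₂ S S′ t) → A₁ ≡ A₂
          agree (_ , _ , _ , _ , U , R , e , SU , _) (_ , _ , _ , _ , U′ , R′ , e′ , SU′ , _) = cut-at A₁∈ A₂∈
            (trans (sym (Spec.rooted SU)) (trans (cong root (proj₁ (cons-injective R R′ (trans (sym e) e′)))) (Spec.rooted SU′)))
        disB : ∀ {B₁ B₂ : Cut} {t} → B₁ ∈ cuts hi → B₂ ∈ cuts hi → t ∈ grow₁ k lo c B₁ → t ∈ grow₁ k lo c B₂ → B₁ ≡ B₂
        disB {B₁} {B₂} {t} B₁∈ B₂∈ p q = agree (parts₁ B₁∈ p) (parts₁ B₂∈ q)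
          where
          cut-at : ∀ {B₁ B₂} → B₁ ∈ cuts hi → B₂ ∈ cuts hi → proj₁ (proj₂ B₁) ≡ proj₁ (proj₂ B₂) → B₁ ≡ B₂
          cut-at {z₁ , b₁ , y₁} B₁∈ B₂∈ refl = cut-determined z₁
            (subst Unique (∈-cuts⁻ hi B₁∈) (AllPairs.tail (proj₁ (proj₂ (unique-++⁻ lo (sorted-unique sorted))))))
            (trans (sym (∈-cuts⁻ hi B₁∈)) (∈-cuts⁻ hi B₂∈))
          agree : (∃ λ A → ∃₂ λ S S′ → A ∈ cuts lo × Parts B₁ A S S′ t) → (∃ λ A → ∃₂ λ S S′ → A ∈ cuts lo × Parts B₂ A S S′ t) → B₁ ≡ B₂
          agree (_ , _ , _ , _ , U , R , e , _ , SR) (_ , _ , _ , _ , U′ , R′ , e′ , _ , SR′) = cut-at B₁∈ B₂∈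
            (trans (sym (Spec.rooted SR)) (trans (cong root (proj₂ (cons-injective R R′ (trans (sym e) e′)))) (Spec.rooted SR′)))

      disjoint : ∀ {t} → ¬ (t ∈ bare lo c hi × t ∈ concatMap (grow₁ k lo c) (cuts hi))
      disjoint {t} (p , q) = grown≢ (find (∈-concatMap⁻ (grow₁ k lo c) q))
        where
        bare≢ : ∀ lo hi U R → t ∈ bare lo c hi → t ≢ cons c U R
        bare≢ [] [] U R (here refl) e = leaf≢cons R e
        split≢ : ∀ {B} → ¬ (∃ λ A → ∃₂ λ S S′ → A ∈ cuts lo × Parts B A S S′ t)
        split≢ (_ , _ , _ , _ , U , R , e , _) = bare≢ lo hi U R p e
        grown≢ : ¬ (∃ λ B → B ∈ cuts hi × t ∈ grow₁ k lo c B)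
        grown≢ (B , B∈ , q′) = split≢ {B} (parts₁ B∈ q′)

    -- `uncons` exposes the first pop. The cuts are then forced, and filtering by membership in U
    -- yields the splits with which the two parts meet their specifications.
    trees-complete : ∀ k {lo c hi t} → Sorted (lo ++ c ∷ hi) → Spec t lo c hi → size t ℕ.≤ k → t ∈ trees k lo c hi
    trees-complete zero {t = leaf _}     sorted S ()
    trees-complete zero {t = node _ _ _} sorted S ()
    trees-complete (suc k) {lo} {c} {hi} {t} sorted S size≤ with uncons t
    ... | inj₁ e = ∈-++⁺ˡ (subst (_∈ bare lo c hi) (sym e′) (in-bare lo hi (λ x∈ → ¬lo (∈-++⁺ˡ x∈) x∈) (λ x∈ → ¬hi (∈-++⁺ʳ lo (there x∈)) x∈)))
      where
      module S = Spec S
      e′ : t ≡ leaf c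
      e′ = trans e (cong leaf S.rooted)
      only : ∀ {x} → x ∈ lo ++ c ∷ hi → x ≡ c
      only {x} x∈ with subst (λ u → x ∈ word u) e′ (from S.letters x∈)
      ... | here refl = refl
      ¬lo : ∀ {x} → x ∈ lo ++ c ∷ hi → x ∉ lo
      ¬lo x∈ x∈lo = ℕ.<⇒≢ (lo< sorted x∈lo) (cong toℕ (only x∈))
      ¬hi : ∀ {x} → x ∈ lo ++ c ∷ hi → x ∉ hi
      ¬hi x∈ x∈hi = ℕ.<⇒≢ (<hi sorted x∈hi) (cong toℕ (sym (only x∈)))
      in-bare : ∀ lo hi → (∀ {x} → x ∉ lo) → (∀ {x} → x ∉ hi) → leaf c ∈ bare lo c hi
      in-bare []      []      _ _ = here refl
      in-bare []      (_ ∷ _) _ h = contradiction (here refl) h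
      in-bare (_ ∷ _) _       h _ = contradiction (here refl) h
    ... | inj₂ (U , R , e) with trans e (cong (λ u → cons u U R) (Spec.rooted S))
    ... | refl = locate (∈-∃++ (∈-lo sorted (to S.letters (word-cons⁺ c U R (inj₂ (inj₁ (root∈ U))))) V.U<c))
                        (∈-∃++ (∈-hi sorted (to S.letters (word-cons⁺ c U R (inj₂ (inj₂ (root∈ R))))) V.c<R))
      where
      module S = Spec S
      module V = ValidCons (valid-cons⁻ R S.valid)
      size-U : size U ℕ.≤ k
      size-U = ℕ.≤-pred (ℕ.≤-trans (s≤s (ℕ.m≤m+n (size U) (size R))) (ℕ.≤-trans (ℕ.≤-reflexive (sym (size-cons c U R))) size≤))
      size-R : size R ℕ.≤ k
      size-R = ℕ.≤-pred (ℕ.≤-trans (s≤s (ℕ.m≤n+m (size R) (size U))) (ℕ.≤-trans (ℕ.≤-reflexive (sym (size-cons c U R))) size≤))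
      locate : (∃₂ λ s s′ → lo ≡ s ++ root U ∷ s′) → (∃₂ λ z y → hi ≡ z ++ root R ∷ y) → cons c U R ∈ trees (suc k) lo c hi
      locate (s , s′ , refl) (z , y , refl) = ∈-++⁺ʳ (bare (s ++ a ∷ s′) c (z ++ b ∷ y))
        (∈-concatMap⁺ (grow₁ k (s ++ a ∷ s′) c) (lose (∈-cuts⁺ z) (∈-concatMap⁺ (grow₂ k c B) (lose (∈-cuts⁺ s)
          (∈-concatMap⁺ (grow₃ k c B A) (lose S∈ (∈-concatMap⁺ (grown k c B A (l , r)) (lose S′∈
            (∈-cartesianProductWith⁺ (cons c)
              (trees-complete k (sorted-left sorted S∈ S′∈) SU size-U)
              (trees-complete k (sorted-right sorted S∈ S′∈) SR size-R))))))))))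
        where
        a = root U
        b = root R
        A B : Cut
        A = s , a , s′
        B = z , b , y
        U? = _∈? word U
        l  = filter U? s
        r  = filter (λ x → ¬? (U? x)) s
        l′ = filter U? (s′ ++ z)
        r′ = filter (λ x → ¬? (U? x)) (s′ ++ z)
        S∈ = ∈-splits⁺ U? s
        S′∈ = ∈-splits⁺ U? (s′ ++ z)
        U<b : ∀ {x} → x ∈ word U → x < b
        U<b x∈ = ℕ.≤-<-trans (≤-last V.validU x∈) V.U<R
        inU : ∀ {x} → x ∈ l ++ a ∷ l′ → x ∈ word U
        inU x∈ with ∈-++⁻ l x∈
        ... | inj₁ p           = proj₂ (∈-filter⁻ U? {xs = s} p)
        ... | inj₂ (here refl) = root∈ U
        ... | inj₂ (there p)   = proj₂ (∈-filter⁻ U? {xs = s′ ++ z} p)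
        notU : ∀ {x} → x ∈ (r ++ r′) ++ b ∷ y → x ∉ word U
        notU x∈ x∈U with ∈-++⁻ (r ++ r′) x∈
        ... | inj₂ (here refl) = ℕ.<-irrefl refl (U<b x∈U)
        ... | inj₂ (there p)   = ℕ.<-asym (U<b x∈U) (<hi (AllPairs-resp-⊆ (++⁺ˡ (s ++ a ∷ s′) (c ∷ʳ ⊆-refl)) sorted) p)
        ... | inj₁ p with ∈-++⁻ r p
        ... | inj₁ q = proj₂ (∈-filter⁻ (λ x → ¬? (U? x)) {xs = s} q) x∈U
        ... | inj₂ q = proj₂ (∈-filter⁻ (λ x → ¬? (U? x)) {xs = s′ ++ z} q) x∈U
        SU : Spec U l a l′
        SU = record { valid = V.validU ; rooted = refl ; letters = mk⇔ to′ inU }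
          where
          to′ : ∀ {x} → x ∈ word U → x ∈ l ++ a ∷ l′
          to′ x∈ with ∈-whole sorted S∈ S′∈ (to S.letters (word-cons⁺ c U R (inj₂ (inj₁ x∈))))
          ... | inj₁ refl     = contradiction x∈ V.c∉U
          ... | inj₂ (inj₁ p) = p
          ... | inj₂ (inj₂ p) = contradiction x∈ (notU p)
        SR : Spec R (r ++ r′) b y
        SR = record { valid = V.validR ; rooted = refl ; letters = mk⇔ to′ from′ }
          where
          to′ : ∀ {x} → x ∈ word R → x ∈ (r ++ r′) ++ b ∷ y
          to′ x∈ with ∈-whole sorted S∈ S′∈ (to S.letters (word-cons⁺ c U R (inj₂ (inj₂ x∈))))
          ... | inj₁ refl     = contradiction x∈ V.c∉R
          ... | inj₂ (inj₁ p) = contradiction x∈ (V.disjoint (inU p))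
          ... | inj₂ (inj₂ p) = p
          from′ : ∀ {x} → x ∈ (r ++ r′) ++ b ∷ y → x ∈ word R
          from′ x∈ with word-cons⁻ c U R (from S.letters (Sublist.lookup (right⊆ sorted S∈ S′∈) x∈))
          ... | inj₁ refl     = contradiction x∈ (right-≢c sorted S∈ S′∈)
          ... | inj₂ (inj₁ p) = contradiction p (notU x∈)
          ... | inj₂ (inj₂ p) = p

    treesAt : ℕ → Cut → List Tree
    treesAt k (lo , c , hi) = trees k lo c hi

    allTrees : List (Fin n) → List Tree
    allTrees xs = concatMap (treesAt (length xs)) (cuts xs)

    length-allTrees : ∀ xs → + length (allTrees xs) ≡ sumC (length xs) (g (length xs))
    length-allTrees xs = trans (length-concatMap (treesAt (length xs)) (cuts xs))
      (trans (sumL-cong (cuts xs) λ {(lo , c , hi)} _ → length-trees (length xs) lo c hi)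
             (sumL-cuts xs (g (length xs))))

    allTrees-unique : ∀ {xs} → Sorted xs → Unique (allTrees xs)
    allTrees-unique {xs} sorted = concatMap-unique (cuts-unique xs)
      (λ C∈ → trees-unique (length xs) (subst Sorted (∈-cuts⁻ xs C∈) sorted)) dis
      where
      dis : ∀ {C₁ C₂ : Cut} {t} → C₁ ∈ cuts xs → C₂ ∈ cuts xs →
        t ∈ trees (length xs) (proj₁ C₁) (proj₁ (proj₂ C₁)) (proj₂ (proj₂ C₁)) →
        t ∈ trees (length xs) (proj₁ C₂) (proj₁ (proj₂ C₂)) (proj₂ (proj₂ C₂)) → C₁ ≡ C₂
      dis {lo₁ , c₁ , hi₁} {lo₂ , c₂ , hi₂} C₁∈ C₂∈ p q
        with trans (sym (Spec.rooted (trees-sound (length xs) (subst Sorted (∈-cuts⁻ xs C₁∈) sorted) p)))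
                   (Spec.rooted (trees-sound (length xs) (subst Sorted (∈-cuts⁻ xs C₂∈) sorted) q))
      ... | refl = cut-determined lo₁ (subst Unique (∈-cuts⁻ xs C₁∈) (sorted-unique sorted))
                     (trans (sym (∈-cuts⁻ xs C₁∈)) (∈-cuts⁻ xs C₂∈))

    ∈-allTrees⁻ : ∀ {xs t} → Sorted xs → t ∈ allTrees xs → Valid t × (∀ {z} → z ∈ word t ⇔ z ∈ xs)
    ∈-allTrees⁻ {xs} sorted t∈ with find (∈-concatMap⁻ (treesAt (length xs)) t∈)
    ... | (lo , c , hi) , C∈ , p with ∈-cuts⁻ xs C∈
    ... | refl = Spec.valid S , Spec.letters S
      where S = trees-sound (length xs) sorted p

    ∈-allTrees⁺ : ∀ {xs t} → Sorted xs → Valid t → (∀ {z} → z ∈ word t ⇔ z ∈ xs) → length (word t) ℕ.≤ length xs → t ∈ allTrees xs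
    ∈-allTrees⁺ {xs} {t} sorted v letters len with ∈-∃++ (to letters (root∈ t))
    ... | lo , hi , refl = ∈-concatMap⁺ (treesAt (length xs)) (lose (∈-cuts⁺ lo)
      (trees-complete (length xs) sorted (record { valid = v ; rooted = refl ; letters = letters }) (ℕ.≤-trans (size≤length t) len)))

-- Colours of a valid hook configuration, and why its image lies in P̃ᶜ

module Hooks where
  open import Data.Vec.Base using (tabulate)
  open import Data.Maybe.Properties using (≡-dec)
  open import Relation.Nullary.Decidable using (dec-true)

  open import Data.Fin.Subset.Properties using (⊆-antisym)
  open import Data.List.Extrema.Nat using (argmin; argmin-sel; f[argmin]≤f[⊤]; f[argmin]≤f[xs])
  import Data.Product.Properties as Product
  open import Data.Vec.Properties using (lookup∘tabulate; lookup⇒[]=; []=⇒lookup)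
  open import Relation.Binary.Construct.Closure.ReflexiveTransitive using (Star; ε; _◅_; _◅◅_; reverse)

  open Equivalence using (to; from)

  module _ {n : ℕ} {P : Fin n → Set} (P? : Decidable P) where

    ⟪_⟫ : Subset n
    ⟪_⟫ = tabulate λ i → does (P? i)

    ∈-⟪⟫⁺ : ∀ {i} → P i → i ∈ˢ ⟪_⟫
    ∈-⟪⟫⁺ {i} p = lookup⇒[]= i ⟪_⟫ (trans (lookup∘tabulate _ i) (dec-true (P? i) p))

    ∈-⟪⟫⁻ : ∀ {i} → i ∈ˢ ⟪_⟫ → P i
    ∈-⟪⟫⁻ {i} i∈ with P? i in e | trans (sym (lookup∘tabulate (λ i → does (P? i)) i)) ([]=⇒lookup i∈)
    ... | yes p | _ = p
    ... | no ¬p | ()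

  subset-≡ : ∀ {n} {B C : Subset n} → (∀ {i} → i ∈ˢ B ⇔ i ∈ˢ C) → B ≡ C
  subset-≡ h = ⊆-antisym (λ p → to h p) (λ p → from h p)

  map-injective-on : ∀ {A B : Set} {f : A → B} {xs x y} → Unique (map f xs) → x ∈ xs → y ∈ xs → f x ≡ f y → x ≡ y
  map-injective-on (_ ∷ u)  (here refl) (here refl) e = refl
  map-injective-on (x∉ ∷ u) (here refl) (there y∈)  e = contradiction e (All.lookup x∉ (∈-map⁺ _ y∈))
  map-injective-on (x∉ ∷ u) (there x∈)  (here refl) e = contradiction (sym e) (All.lookup x∉ (∈-map⁺ _ x∈))
  map-injective-on (_ ∷ u)  (there x∈)  (there y∈)  e = map-injective-on u x∈ y∈ e

  module Configuration {M : ℕ} (π : Permutation′ (suc M)) (H : VHC π) where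

    N : ℕ
    N = suc M

    hs : List (Hook N)
    hs = hooks H

    height : Fin N → ℕ
    height i = toℕ (π ⟨$⟩ʳ i)

    height-injective : ∀ {i j} → height i ≡ height j → i ≡ j
    height-injective {i} {j} e = trans (sym (inverseˡ π)) (trans (cong (π ⟨$⟩ˡ_) (toℕ-injective e)) (inverseˡ π))

    sw-unique : Unique (map sw hs)
    sw-unique = subst Unique (sym (southwest H)) (Unique.filter⁺ (isDescent? π) (Unique.allFin⁺ N))

    sw-injective : ∀ {h h′} → h ∈ hs → h′ ∈ hs → sw h ≡ sw h′ → h ≡ h′
    sw-injective = map-injective-on sw-unique

    sw<ne : ∀ {h} → h ∈ hs → sw h < ne h
    sw<ne h∈ = proj₁ (isHook H h∈)

    rising : ∀ {h} → h ∈ hs → height (sw h) ℕ.< height (ne h)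
    rising h∈ = proj₂ (isHook H h∈)

    sw-descent : ∀ {h} → h ∈ hs → IsDescent π (sw h)
    sw-descent h∈ = proj₂ (∈-filter⁻ (isDescent? π) {xs = allFin N} (subst (_ ∈_) (southwest H) (∈-map⁺ sw h∈)))

    bottom : ∀ {h} → h ∈ hs → Fin N
    bottom h∈ = proj₁ (sw-descent h∈)

    toℕ-bottom : ∀ {h} (h∈ : h ∈ hs) → toℕ (bottom h∈) ≡ suc (toℕ (sw h))
    toℕ-bottom h∈ = proj₁ (proj₂ (sw-descent h∈))

    falling : ∀ {h} (h∈ : h ∈ hs) → height (bottom h∈) ℕ.< height (sw h)
    falling h∈ = proj₂ (proj₂ (sw-descent h∈))

    hook-≟ : (h h′ : Hook N) → Dec (h ≡ h′)
    hook-≟ = Product.≡-dec _≟_ _≟_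

    -- Two hooks with a common northeast end meet there, so that end would have to be the southwest
    -- end of one of them.
    ne-injective : ∀ {h h′} → h ∈ hs → h′ ∈ hs → ne h ≡ ne h′ → h ≡ h′
    ne-injective {h} {h′} h∈ h′∈ e with hook-≟ h h′
    ... | yes p = p
    ... | no h≢h′ with nonIntersecting H h∈ h′∈ h≢h′ (plot π (ne h))
          (inj₂ (ℕ.<⇒≤ (sw<ne h∈) , ℕ.≤-refl , refl))
          (inj₂ (subst (λ u → sw h′ ≤ u) (sym e) (ℕ.<⇒≤ (sw<ne h′∈)) , ℕ.≤-reflexive (cong toℕ e) , cong (π ⟨$⟩ʳ_) e))
    ... | inj₁ (_ , q) = contradiction (sw<ne h′∈) (ℕ.≤⇒≯ (ℕ.≤-reflexive (cong toℕ (trans (sym e) (cong proj₁ q)))))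
    ... | inj₂ (q , _) = contradiction (sw<ne h∈) (ℕ.≤⇒≯ (ℕ.≤-reflexive (cong toℕ (cong proj₁ q))))

    -- Otherwise the vertical part of `h′` would cross the horizontal part of `h` above `sw h′`: by
    -- `nothingAbove`, the top of `h` is higher than the start of `h′` and lower than its end.
    nested : ∀ {h h′} → h ∈ hs → h′ ∈ hs → sw h < sw h′ → sw h′ < ne h → ne h′ < ne h
    nested {h} {h′} h∈ h′∈ sw< sw<′ with ℕ.<-cmp (toℕ (ne h′)) (toℕ (ne h))
    ... | tri< p _ _ = p
    ... | tri≈ _ e _ = contradiction sw< (ℕ.<-irrefl (cong (λ h → toℕ (sw h)) (ne-injective h∈ h′∈ (sym (toℕ-injective e)))))
    ... | tri> _ _ p with nonIntersecting H h∈ h′∈ (λ e → ℕ.<-irrefl (cong (λ h → toℕ (sw h)) e) sw<) (sw h′ , π ⟨$⟩ʳ ne h)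
          (inj₂ (ℕ.<⇒≤ sw< , ℕ.<⇒≤ sw<′ , refl))
          (inj₁ (refl , ℕ.<⇒≤ (nothingAbove H h∈ (sw h′) sw< sw<′) , ℕ.<⇒≤ (nothingAbove H h′∈ (ne h) sw<′ p)))
    ... | inj₁ (q , _) = contradiction sw<′ (ℕ.<-irrefl (cong (λ p → toℕ (proj₁ p)) q))
    ... | inj₂ (q , _) = contradiction sw< (ℕ.<-irrefl (cong (λ p → toℕ (proj₁ p)) (sym q)))

    sw<bottom : ∀ {h} (h∈ : h ∈ hs) → sw h < bottom h∈
    sw<bottom h∈ = ℕ.≤-reflexive (sym (toℕ-bottom h∈))

    bottom-≤ : ∀ {h} (h∈ : h ∈ hs) {i : Fin N} → sw h < i → bottom h∈ ≤ i
    bottom-≤ h∈ sw<i = ℕ.≤-trans (ℕ.≤-reflexive (toℕ-bottom h∈)) sw<i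

    <bottom : ∀ {h} (h∈ : h ∈ hs) {i : Fin N} → i < bottom h∈ → i ≤ sw h
    <bottom h∈ i< = ℕ.≤-pred (ℕ.≤-trans i< (ℕ.≤-reflexive (toℕ-bottom h∈)))

    -- A hook ending at a descent bottom would either have the descent top above it or start from
    -- the descent top, which is higher than the end.
    bottom≢ne : ∀ {h h′} (h∈ : h ∈ hs) → h′ ∈ hs → ne h′ ≢ bottom h∈
    bottom≢ne {h} {h′} h∈ h′∈ e with ℕ.m≤n⇒m<n∨m≡n (<bottom h∈ {sw h′} (subst (λ u → sw h′ < u) e (sw<ne h′∈)))
    ... | inj₁ p = ℕ.<-asym (falling h∈)
          (subst (λ u → height (sw h) ℕ.< height u) e (nothingAbove H h′∈ (sw h) p (subst (λ u → sw h < u) (sym e) (sw<bottom h∈))))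
    ... | inj₂ p = ℕ.<-asym (falling h∈) (subst₂ (λ u v → height u ℕ.< height v) (toℕ-injective p) e (rising h′∈))

    bottom<ne : ∀ {h} (h∈ : h ∈ hs) → bottom h∈ < ne h
    bottom<ne h∈ = ℕ.≤∧≢⇒< (bottom-≤ h∈ (sw<ne h∈)) λ e → bottom≢ne h∈ h∈ (sym (toℕ-injective e))

    -- A relational form of `lookUp` without the choice made by `argmin`. It determines the colour
    -- by `seen-unique`, and it can be carried over to an equal configuration.
    data Seen (l : Fin N) : Colour N → Set where
      sees : ∀ {h} → h ∈ hs → sw h < l → l < ne h →
        (∀ {h′} → h′ ∈ hs → sw h′ < l → l < ne h′ → height (ne h) ℕ.≤ height (ne h′)) → Seen l (just h)
      sky  : (∀ {h} → h ∈ hs → sw h < l → ¬ l < ne h) → Seen l nothing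

    seen : ∀ l → Seen l (lookUp π H l)
    seen l with filter (λ h → (sw h <? l) ×-dec (l <? ne h)) (hooks H) in e
    ... | [] = sky λ h∈ p q → case (subst (_ ∈_) e (∈-filter⁺ covers? h∈ (p , q)))
      where
      covers? : (h : Hook N) → Dec (sw h < l × l < ne h)
      covers? h = (sw h <? l) ×-dec (l <? ne h)
      case : ∀ {A : Set} {x : Hook N} → x ∈ [] → A
      case ()
    ... | h ∷ rest = sees (proj₁ best) (proj₁ (proj₂ best)) (proj₂ (proj₂ best))
          λ h′∈ p q → minimal (subst (_ ∈_) e (∈-filter⁺ covers? h′∈ (p , q)))
      where
      covers? : (h : Hook N) → Dec (sw h < l × l < ne h)
      covers? h = (sw h <? l) ×-dec (l <? ne h)
      f : Hook N → ℕ
      f h = height (ne h)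
      best : argmin f h rest ∈ hs × sw (argmin f h rest) < l × l < ne (argmin f h rest)
      best with argmin-sel f h rest
      ... | inj₁ p = ∈-filter⁻ covers? (subst (argmin f h rest ∈_) (sym e) (here p))
      ... | inj₂ p = ∈-filter⁻ covers? (subst (argmin f h rest ∈_) (sym e) (there p))
      minimal : ∀ {h′} → h′ ∈ h ∷ rest → f (argmin f h rest) ℕ.≤ f h′
      minimal (here refl) = f[argmin]≤f[⊤] {f = f} h rest
      minimal (there p)   = All.lookup (f[argmin]≤f[xs] {f = f} h rest) p

    data Coloured (l : Fin N) : Colour N → Set where
      top   : ∀ {h} → h ∈ hs → ne h ≡ l → Coloured l (just h)
      below : ∀ {c} → (∀ {h} → h ∈ hs → ne h ≢ l) → Seen l c → Coloured l c

    coloured : ∀ l → Coloured l (pointColour π H l)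
    coloured l with filter (λ h → ne h ≟ l) (hooks H) in e
    ... | [] = below (λ h∈ p → case (subst (_ ∈_) e (∈-filter⁺ (λ h → ne h ≟ l) h∈ p))) (seen l)
      where
      case : ∀ {A : Set} {x : Hook N} → x ∈ [] → A
      case ()
    ... | h ∷ _ with ∈-filter⁻ (λ h → ne h ≟ l) (subst (h ∈_) (sym e) (here refl))
    ... | h∈ , p = top h∈ p

    seen-unique : ∀ {l c c′} → Seen l c → Seen l c′ → c ≡ c′
    seen-unique (sees h∈ p q m) (sees h′∈ p′ q′ m′) = cong just (ne-injective h∈ h′∈
      (height-injective (ℕ.≤-antisym (m h′∈ p′ q′) (m′ h∈ p q))))
    seen-unique (sees h∈ p q _) (sky s) = contradiction q (s h∈ p)
    seen-unique (sky s) (sees h∈ p q _) = contradiction q (s h∈ p)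
    seen-unique (sky _) (sky _) = refl

    coloured-unique : ∀ {l c c′} → Coloured l c → Coloured l c′ → c ≡ c′
    coloured-unique (top h∈ p) (top h′∈ p′) = cong just (ne-injective h∈ h′∈ (trans p (sym p′)))
    coloured-unique (top h∈ p) (below s _)  = contradiction p (s h∈)
    coloured-unique (below s _) (top h∈ p)  = contradiction p (s h∈)
    coloured-unique (below _ s) (below _ s′) = seen-unique s s′

    label : Fin N → Fin (suc N)
    label i = inject₁ (π ⟨$⟩ʳ i)

    toℕ-label : ∀ i → toℕ (label i) ≡ height i
    toℕ-label i = toℕ-inject₁ (π ⟨$⟩ʳ i)

    label-< : ∀ {i j} → height i ℕ.< height j → label i < label j
    label-< {i} {j} = subst₂ ℕ._<_ (sym (toℕ-label i)) (sym (toℕ-label j))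

    ∞ : Fin (suc N)
    ∞ = fromℕ N

    label<∞ : ∀ i → label i < ∞
    label<∞ i = subst₂ ℕ._<_ (sym (toℕ-label i)) (sym (toℕ-fromℕ N)) (toℕ<n (π ⟨$⟩ʳ i))

    data Labelled : Fin (suc N) → Set where
      is-label : ∀ i → Labelled (label i)
      is-∞     : Labelled ∞

    labelled : ∀ v → Labelled v
    labelled v with view v
    ... | ‵fromℕ     = is-∞
    ... | ‵inject₁ y = subst (λ u → Labelled (inject₁ u)) (inverseʳ π) (is-label (π ⟨$⟩ˡ y))

    colour-∞ : colour π H ∞ ≡ nothing
    colour-∞ rewrite view-fromℕ N = refl

    colour-label : ∀ i → colour π H (label i) ≡ pointColour π H i
    colour-label i rewrite view-inject₁ (π ⟨$⟩ʳ i) = cong (pointColour π H) (inverseˡ π)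

    colour-of : ∀ {i c} → Coloured i c → colour π H (label i) ≡ c
    colour-of {i} p = trans (colour-label i) (coloured-unique (coloured i) p)

    coloured-label : ∀ i → Coloured i (colour π H (label i))
    coloured-label i = subst (Coloured i) (sym (colour-label i)) (coloured i)

    colour-ne : ∀ {h} → h ∈ hs → colour π H (label (ne h)) ≡ just h
    colour-ne h∈ = colour-of (top h∈ refl)

    -- Another hook above the descent bottom starts before `sw h`; by `nested` it reaches beyond
    -- `ne h`, so it lies higher and is seen later.
    colour-bottom : ∀ {h} (h∈ : h ∈ hs) → colour π H (label (bottom h∈)) ≡ just h
    colour-bottom {h} h∈ = colour-of (below (λ h′∈ → bottom≢ne h∈ h′∈) (sees h∈ (sw<bottom h∈) (bottom<ne h∈) lowest))
      where
      lowest : ∀ {h′} → h′ ∈ hs → sw h′ < bottom h∈ → bottom h∈ < ne h′ → height (ne h) ℕ.≤ height (ne h′)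
      lowest {h′} h′∈ p q with ℕ.m≤n⇒m<n∨m≡n (<bottom h∈ {sw h′} p)
      ... | inj₁ sw< = ℕ.<⇒≤ (nothingAbove H h′∈ (ne h) (ℕ.<-trans sw< (sw<ne h∈))
            (nested h′∈ h∈ sw< (ℕ.<-trans (sw<bottom h∈) q)))
      ... | inj₂ e with sw-injective h′∈ h∈ (toℕ-injective e)
      ... | refl = ℕ.≤-refl

    colour-zero : colour π H (label zero) ≡ nothing
    colour-zero = colour-of (below (λ {h} h∈ e → ℕ.n≮0 (subst (λ u → sw h < u) e (sw<ne h∈))) (sky λ _ ()))

    coloured-range : ∀ {l h} → Coloured l (just h) → h ∈ hs × sw h < l × l ≤ ne h
    coloured-range (top h∈ refl)              = h∈ , sw<ne h∈ , ℕ.≤-refl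
    coloured-range (below _ (sees h∈ p q _))  = h∈ , p , ℕ.<⇒≤ q

    colour-≟ : (c c′ : Colour N) → Dec (c ≡ c′)
    colour-≟ = ≡-dec hook-≟

    SameColour : Fin (suc N) → Fin (suc N) → Set
    SameColour v w = colour π H w ≡ colour π H v

    same-colour? : ∀ v → Decidable (SameColour v)
    same-colour? v w = colour-≟ (colour π H w) (colour π H v)

    block : Fin (suc N) → Subset (suc N)
    block v = ⟪ same-colour? v ⟫

    ∈-block : ∀ v w → w ∈ˢ block v ⇔ colour π H w ≡ colour π H v
    ∈-block v w = mk⇔ (∈-⟪⟫⁻ (same-colour? v)) (∈-⟪⟫⁺ (same-colour? v))

    block-class : ∀ v → ColourClass π H (block v)
    block-class v = v , ∈-block v

    class-≡ : ∀ {B v} → ColourClass π H B → v ∈ˢ B → B ≡ block v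
    class-≡ {v = v} (u , h) v∈ = subset-≡ λ {w} → mk⇔
      (λ w∈ → from (∈-block v w) (trans (to (h w) w∈) (sym (to (h _) v∈))))
      (λ w∈ → from (h w) (trans (to (∈-block v w) w∈) (to (h _) v∈)))

    class-≡-class : ∀ {B C v} → ColourClass π H B → ColourClass π H C → v ∈ˢ B → v ∈ˢ C → B ≡ C
    class-≡-class cB cC p q = trans (class-≡ cB p) (sym (class-≡ cC q))

    data Kind (B : Subset (suc N)) : Set where
      blue   : (∀ v → v ∈ˢ B ⇔ colour π H v ≡ nothing) → Kind B
      ofHook : ∀ {h} → h ∈ hs → (∀ v → v ∈ˢ B ⇔ colour π H v ≡ just h) → Kind B

    kind : ∀ {B} → ColourClass π H B → Kind B
    kind {B} (v , h) = go (labelled v) h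
      where
      go : ∀ {v} → Labelled v → (∀ w → w ∈ˢ B ⇔ colour π H w ≡ colour π H v) → Kind B
      go is-∞ h = blue (subst (λ c → ∀ w → w ∈ˢ B ⇔ colour π H w ≡ c) colour-∞ h)
      go (is-label i) h with colour π H (label i) | coloured-label i
      ... | nothing | _ = blue h
      ... | just _  | c = ofHook (proj₁ (coloured-range c)) h

    blue-min : ∀ {B} → (∀ v → v ∈ˢ B ⇔ colour π H v ≡ nothing) → IsMin zero (Hat π B)
    blue-min h = from (h _) colour-zero , λ _ _ → z≤n

    hooked-min : ∀ {B h} (h∈ : h ∈ hs) → (∀ v → v ∈ˢ B ⇔ colour π H v ≡ just h) → IsMin (bottom h∈) (Hat π B)
    hooked-min h∈ cl = from (cl _) (colour-bottom h∈) , λ j j∈ →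
      bottom-≤ h∈ (proj₁ (proj₂ (coloured-range (subst (Coloured j) (to (cl _) j∈) (coloured-label j)))))

    class-min : ∀ {B} → ColourClass π H B → ∃ λ i → IsMin i (Hat π B)
    class-min cB with kind cB
    ... | blue cl      = zero , blue-min cl
    ... | ofHook h∈ cl = bottom h∈ , hooked-min h∈ cl

    min-unique : ∀ {P : Fin N → Set} {i j} → IsMin i P → IsMin j P → i ≡ j
    min-unique (p , m) (q , m′) = toℕ-injective (ℕ.≤-antisym (m _ q) (m′ _ p))

    -- Data for a crossing with an earlier block: the label at `position` lies between the labels of
    -- the descent bottom and the northeast end of `h`, while `far` is a label of the same colour
    -- outside that interval.
    record Witness {h} (h∈ : h ∈ hs) : Set where
      constructor witness
      field
        position : Fin N
        early    : position ≤ sw h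
        above    : height (bottom h∈) ℕ.< height position
        under    : height position ℕ.< height (ne h)
        other    : colour π H (label position) ≢ just h
        far      : Fin (suc N)
        same     : colour π H far ≡ colour π H (label position)
        outside  : label (ne h) < far ⊎ far < label (bottom h∈)

    -- Follow the chain of hooks ending at sw h to the left until it drops below the
    -- descent bottom of h, or until it ends in a point that looks upward.
    crossing : ∀ {h} (h∈ : h ∈ hs) e → Acc ℕ._<_ (toℕ e) → e ≤ sw h → height e ℕ.≤ height (sw h) →
      height (bottom h∈) ℕ.< height e → (∀ {h′} → h′ ∈ hs → sw h′ < e → e < ne h′ → ne h < ne h′) → Witness h∈
    crossing {h} h∈ e (acc rec) e≤ low above out with colour π H (label e) in eq | coloured-label e
    ... | nothing | below _ (sky s) = witness e e≤ above (ℕ.≤-<-trans low (rising h∈))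
          (λ e≡ → case (trans (sym eq) e≡)) ∞ (trans colour-∞ (sym eq)) (inj₁ (label<∞ (ne h)))
      where
      case : nothing ≢ just h
      case ()
    -- A hook seen from `e` also passes over `ne h`, by the invariant `out`, so its northeast end
    -- has a label above the whole interval.
    ... | just h′ | below _ (sees h′∈ p q _) = witness e e≤ above (ℕ.≤-<-trans low (rising h∈))
          (λ e≡ → ℕ.<-irrefl (cong (λ h → toℕ (sw h)) (just-injective (trans (sym eq) e≡))) (ℕ.<-≤-trans p e≤))
          (label (ne h′)) (trans (colour-ne h′∈) (sym eq))
          (inj₁ (label-< (nothingAbove H h′∈ (ne h) (ℕ.<-trans (ℕ.<-≤-trans p e≤) (sw<ne h∈)) (out h′∈ p q))))
    ... | just h′ | top h′∈ refl with ℕ.<-cmp (height (sw h′)) (height (bottom h∈))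
    -- The hook that ends at `e` starts below the descent bottom of `h`; its own descent bottom is
    -- lower still and serves as `far`.
    ... | tri< p _ _ = witness e e≤ above (ℕ.≤-<-trans low (rising h∈))
          (λ e≡ → ℕ.<-irrefl (cong (λ h → toℕ (ne h)) (just-injective (trans (sym eq) e≡))) (ℕ.≤-<-trans e≤ (sw<ne h∈)))
          (label (bottom h′∈)) (trans (colour-bottom h′∈) (sym eq))
          (inj₂ (label-< (ℕ.<-trans (falling h′∈) p)))
    ... | tri≈ _ p _ = contradiction (ℕ.<-≤-trans (sw<ne h′∈) e≤)
          (ℕ.<⇒≯ (subst (λ u → sw h < u) (sym (height-injective p)) (sw<bottom h∈)))
    ... | tri> _ _ p = crossing h∈ (sw h′) (rec (sw<ne h′∈)) (ℕ.≤-trans (ℕ.<⇒≤ (sw<ne h′∈)) e≤)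
          (ℕ.≤-trans (ℕ.<⇒≤ (rising h′∈)) low) p
          λ h″∈ q r → out h″∈ (ℕ.<-trans q (sw<ne h′∈)) (nested h″∈ h′∈ q r)

    crossing-witness : ∀ {h} (h∈ : h ∈ hs) → Witness h∈
    crossing-witness {h} h∈ = crossing h∈ (sw h) (<-wellFounded _) ℕ.≤-refl ℕ.≤-refl (falling h∈)
      λ h′∈ p q → nested h′∈ h∈ p q

    record Predecessor (B : Subset (suc N)) (i : Fin N) : Set where
      field
        {pred}   : Subset (suc N)
        {min}    : Fin N
        class    : ColourClass π H pred
        distinct : pred ≢ B
        crosses  : Crossing pred B
        isMin    : IsMin min (Hat π pred)
        earlier  : min < i

    predecessor : ∀ {B h} (h∈ : h ∈ hs) → (∀ v → v ∈ˢ B ⇔ colour π H v ≡ just h) → Predecessor B (bottom h∈)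
    predecessor {B} {h} h∈ cl = record
      { class = block-class (label position)
      ; distinct = λ e → other (to (cl _) (subst (label position ∈ˢ_) e (from (∈-block (label position) (label position)) refl)))
      ; crosses = crosses′ outside
      ; isMin = isMin′
      ; earlier = ℕ.≤-<-trans (ℕ.≤-trans (proj₂ isMin′ position (from (∈-block (label position) (label position)) refl)) early) (sw<bottom h∈) }
      where
      open Witness (crossing-witness h∈)
      isMin′ = proj₂ (class-min (block-class (label position)))
      crosses′ : label (ne h) < far ⊎ far < label (bottom h∈) → Crossing (block (label position)) B
      crosses′ (inj₁ p) = far , label position , label (ne h) , label (bottom h∈) ,
        from (∈-block (label position) far) same , from (∈-block (label position) (label position)) refl , from (cl _) (colour-ne h∈) , from (cl _) (colour-bottom h∈) ,
        inj₂ (label-< above , label-< under , p)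
      crosses′ (inj₂ p) = far , label position , label (bottom h∈) , label (ne h) ,
        from (∈-block (label position) far) same , from (∈-block (label position) (label position)) refl , from (cl _) (colour-bottom h∈) , from (cl _) (colour-ne h∈) ,
        inj₁ (p , label-< above , label-< under)

    ρ′ : Subset (suc N) → Set
    ρ′ = ColourClass π H

    α′ : Subset (suc N) → Subset (suc N) → Set
    α′ B C = Adjacent ρ′ B C × MinHat< π B C

    crossing-sym : ∀ {B C : Subset (suc N)} → Crossing B C → Crossing C B
    crossing-sym (i , k , j , l , i∈ , k∈ , j∈ , l∈ , inj₁ (p , q , r)) =
      l , j , k , i , l∈ , j∈ , k∈ , i∈ , inj₂ (p , q , r)
    crossing-sym (i , k , j , l , i∈ , k∈ , j∈ , l∈ , inj₂ (p , q , r)) =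
      l , j , k , i , l∈ , j∈ , k∈ , i∈ , inj₁ (p , q , r)

    adjacent-sym : ∀ {B C} → Adjacent ρ′ B C → Adjacent ρ′ C B
    adjacent-sym (b , c , b≢c , x) = c , b , (λ e → b≢c (sym e)) , crossing-sym x

    -- Each hook block is adjacent to a block with an earlier first position, so the walk can stop
    -- only at the blue block.
    to-blue : ∀ {B i} → Acc ℕ._<_ (toℕ i) → ρ′ B → IsMin i (Hat π B) → Star (Adjacent ρ′) B (block ∞)
    to-blue (acc rec) cB m with kind cB
    ... | blue cl = subst (Star (Adjacent ρ′) _) (class-≡ cB (from (cl ∞) colour-∞)) ε
    ... | ofHook h∈ cl with predecessor h∈ cl
    ... | P = (cB , P.class , (λ e → P.distinct (sym e)) , crossing-sym P.crosses) ◅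
        to-blue (rec (subst (P.min <_) (min-unique (hooked-min h∈ cl) m) P.earlier)) P.class P.isMin
      where module P = Predecessor P

    connected′ : Connected ρ′
    connected′ cB cC = to-blue (<-wellFounded _) cB (proj₂ (class-min cB)) ◅◅
      reverse adjacent-sym (to-blue (<-wellFounded _) cC (proj₂ (class-min cC)))

    -- Edges move the first position to the right; with `irreflexive` this gives acyclicity and
    -- excludes edges in both directions.
    closure-< : ∀ {B C} → TransClosure α′ B C → MinHat< π B C
    closure-< [ _ , m ] = m
    closure-< ((_ , i , i′ , m , m′ , i<i′) ∷ p) with closure-< p
    ... | j , j′ , m₁ , m₁′ , j<j′ with min-unique m′ m₁
    ... | refl = i , j′ , m , m₁′ , ℕ.<-trans i<i′ j<j′

    irreflexive : ∀ {B} → ¬ MinHat< π B B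
    irreflexive (i , i′ , m , m′ , i<i′) with min-unique m m′
    ... | refl = ℕ.<-irrefl refl i<i′

    Φ-isP̃ᶜ : IsP̃ᶜ (Φ (π , H))
    Φ-isP̃ᶜ = record
      { isPartition = record
        { nonempty = λ { (v , cl) → v , from (cl v) refl }
        ; covered = λ v → block v , (block-class v , from (∈-block v v) refl) , λ (cB , v∈) → sym (class-≡ cB v∈) }
      ; connected = connected′
      ; isOrientation = record
        { edge = proj₁
        ; oriented = oriented′
        ; oneWay = λ p q → irreflexive (closure-< (p ∷ [ q ])) }
      ; acyclic = λ B p → irreflexive (closure-< p)
      ; onlySource = λ cB → mk⇔ (source⇒ cB) (λ ∞∈ → ⇒source cB ∞∈) }
      where
      oriented′ : ∀ {B C} → Adjacent ρ′ B C → α′ B C ⊎ α′ C B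
      oriented′ adj@(cB , cC , B≢C , _) with class-min cB | class-min cC
      ... | i , m | j , m′ with ℕ.<-cmp (toℕ i) (toℕ j)
      ... | tri< p _ _ = inj₁ (adj , i , j , m , m′ , p)
      ... | tri> _ _ p = inj₂ (adjacent-sym adj , j , i , m′ , m , p)
      ... | tri≈ _ p _ with toℕ-injective p
      ... | refl = contradiction (class-≡-class cB cC (proj₁ m) (proj₁ m′)) B≢C
      source⇒ : ∀ {B} → ρ′ B → IsSource α′ B → ∞ ∈ˢ B
      source⇒ {B} cB src = go (kind cB)
        where
        go : Kind B → ∞ ∈ˢ B
        go (blue cl)      = from (cl ∞) colour-∞
        go (ofHook h∈ cl) = contradiction ((P.class , cB , P.distinct , P.crosses) , _ , _ , P.isMin , hooked-min h∈ cl , P.earlier) (src P.pred)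
          where module P = Predecessor (predecessor h∈ cl)
      ⇒source : ∀ {B} → ρ′ B → ∞ ∈ˢ B → IsSource α′ B
      ⇒source {B} cB ∞∈ C (_ , i , j , m , m′ , i<j) = go (kind cB)
        where
        go : ¬ Kind B
        go (blue cl) = ℕ.n≮0 (subst (i <_) (min-unique m′ (blue-min cl)) i<j)
        go (ofHook h∈ cl) with trans (sym colour-∞) (to (cl ∞) ∞∈)
        ... | ()

-- Positions in the word of a tree, and parsing hooks into trees

module Spans where
  open Before
  open Trees
  open import Data.Nat.Tactic.RingSolver using (solve-∀)
  open import Data.Unit.Base using (⊤; tt)

  Apart : ℕ × ℕ → ℕ × ℕ → Set
  Apart (d , j) (d′ , j′) = d ℕ.< d′ × (j ℕ.≤ d′ ⊎ j′ ℕ.< j)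

  node-count : ∀ s a b → ℕ.suc (suc (suc (s ℕ.+ 2 ℕ.* a) ℕ.+ 2 ℕ.* b)) ≡ ℕ.suc (s ℕ.+ 2 ℕ.* (a ℕ.+ suc b))
  node-count = solve-∀

  module _ {n : ℕ} where

    -- Spans v s t e: the word of t is v s, v (s+1), …, v (e-1).
    data Spans (v : ℕ → Fin n) : ℕ → Tree {n} → ℕ → Set where
      leaf : ∀ {p} → Spans v p (leaf (v p)) (suc p)
      node : ∀ {s m j P U} → Spans v s P (suc m) → Spans v (suc m) U j → Spans v s (node P U (v j)) (suc j)

    Listed : (ℕ → Fin n) → ℕ → List (Fin n) → Set
    Listed v s []       = ⊤
    Listed v s (x ∷ xs) = v s ≡ x × Listed v (suc s) xs

    listed : ∀ {v} s xs → (∀ i → v (s ℕ.+ toℕ i) ≡ lookup xs i) → Listed v s xs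
    listed s [] h = tt
    listed {v} s (x ∷ xs) h = trans (cong v (sym (ℕ.+-identityʳ s))) (h Fin.zero) ,
      listed (suc s) xs λ i → trans (cong v (sym (ℕ.+-suc s (toℕ i)))) (h (Fin.suc i))

    spans-< : ∀ {v s t e} → Spans v s t e → s ℕ.< e
    spans-< leaf       = ℕ.≤-refl
    spans-< (node p q) = ℕ.<-trans (ℕ.<-trans (spans-< p) (spans-< q)) (ℕ.n<1+n _)

    listed⇒spans : ∀ {v s} t {rest} → Listed v s (word t ++ rest) →
      ∃ λ e → Spans v s t e × Listed v e rest × e ≡ s ℕ.+ length (word t)
    listed⇒spans {v} {s} (leaf c) (refl , r) = suc s , leaf , r , ℕ.+-comm 1 s
    listed⇒spans {v} {s} (node P U b) {rest} l
      with listed⇒spans P (subst (Listed v s) (trans (++-assoc (word P) _ rest) (cong (word P ++_) (++-assoc (word U) (b ∷ []) rest))) l)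
    ... | zero , p , _ , _ = contradiction (spans-< p) ℕ.n≮0
    ... | suc m , p , l₁ , e₁ with listed⇒spans U l₁
    ... | j , q , (refl , l₂) , e₂ = suc j , node p q , l₂ ,
      trans (cong suc (trans e₂ (cong (ℕ._+ length (word U)) e₁))) (trans (arrange s (length (word P)) (length (word U)))
        (cong (s ℕ.+_) (sym (trans (length-++ (word P)) (cong (length (word P) ℕ.+_) (length-++ (word U)))))))
      where
      arrange : ∀ s p u → ℕ.suc (s ℕ.+ p ℕ.+ u) ≡ s ℕ.+ (p ℕ.+ (u ℕ.+ 1))
      arrange = solve-∀

    spans-root : ∀ {v s t e} → Spans v s t e → root t ≡ v s
    spans-root leaf       = refl
    spans-root (node p q) = spans-root p

    spans-last : ∀ {v s t e} → Spans v s t (suc e) → last t ≡ v e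
    spans-last leaf       = refl
    spans-last (node p q) = refl

    spans-∈⁻ : ∀ {v s t e} → Spans v s t e → ∀ {z} → z ∈ word t → ∃ λ p → s ℕ.≤ p × p ℕ.< e × z ≡ v p
    spans-∈⁻ {s = s} leaf (here refl) = s , ℕ.≤-refl , ℕ.≤-refl , refl
    spans-∈⁻ (node {P = P} {U} p q) z∈ with ∈-word⁻ P U z∈
    ... | inj₂ (inj₂ refl) = _ , ℕ.<⇒≤ (ℕ.<-trans (spans-< p) (spans-< q)) , ℕ.≤-refl , refl
    ... | inj₁ z∈P with spans-∈⁻ p z∈P
    ... | i , s≤i , i<m , e = i , s≤i , ℕ.<-trans i<m (ℕ.<-trans (spans-< q) (ℕ.n<1+n _)) , e
    spans-∈⁻ (node {P = P} {U} p q) z∈ | inj₂ (inj₁ z∈U) with spans-∈⁻ q z∈U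
    ... | i , m≤i , i<j , e = i , ℕ.≤-trans (ℕ.<⇒≤ (spans-< p)) m≤i , ℕ.<-trans i<j (ℕ.n<1+n _) , e

    spans-∈⁺ : ∀ {v s t e} → Spans v s t e → ∀ {i} → s ℕ.≤ i → i ℕ.< e → v i ∈ word t
    spans-∈⁺ {v} leaf s≤i i<e = subst (λ i → v i ∈ _) (ℕ.≤-antisym s≤i (ℕ.≤-pred i<e)) (here refl)
    spans-∈⁺ {v} (node {m = m} {j} {P} {U} p q) {i} s≤i i<e with ℕ.m≤n⇒m<n∨m≡n (ℕ.≤-pred i<e)
    ... | inj₂ refl = ∈-wordʳ P U
    ... | inj₁ i<j with ℕ.<-≤-connex i (suc m)
    ... | inj₁ i<m = ∈-wordˡ P U (spans-∈⁺ p s≤i i<m)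
    ... | inj₂ m≤i = ∈-wordᵐ P U (spans-∈⁺ q m≤i i<j)

    spans-determined : ∀ {v v′ s t e e′} → Spans v s t e → Spans v′ s t e′ →
      e ≡ e′ × (∀ {i} → s ℕ.≤ i → i ℕ.< e → v i ≡ v′ i)
    -- The trees are related by an equation, because labels such as `v s` and `v′ s` are not
    -- patterns and two derivations for the same tree would not unify.
    spans-determined p q = go p q refl
      where
      go : ∀ {v v′ s t t′ e e′} → Spans v s t e → Spans v′ s t′ e′ → t ≡ t′ →
        e ≡ e′ × (∀ {i} → s ℕ.≤ i → i ℕ.< e → v i ≡ v′ i)
      go {v} {v′} {s} leaf leaf e = refl , λ s≤i i<e → subst (λ i → v i ≡ v′ i) (ℕ.≤-antisym s≤i (ℕ.≤-pred i<e)) (leaf-injective e)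
      go (node {m = m} {j} p q) (node p′ q′) e with node-injective e
      ... | eP , eU , eb with go p p′ eP
      ... | refl , hP with go q q′ eU
      ... | refl , hU = refl , h
        where
        h : ∀ {i} → _ ℕ.≤ i → i ℕ.< suc j → _
        h {i} s≤i i<e with ℕ.m≤n⇒m<n∨m≡n (ℕ.≤-pred i<e)
        ... | inj₂ refl = eb
        ... | inj₁ i<j with ℕ.<-≤-connex i (suc m)
        ... | inj₁ i<m = hP s≤i i<m
        ... | inj₂ m≤i = hU m≤i i<j

    spans-inner : ∀ {v s t e} → Spans v s t e → ∀ {a b} → (a , b) ∈ inner t → ∃ λ p → s ℕ.< p × p ℕ.< e × a ≡ v p
    spans-inner (node {P = P} p q) x∈ with ∈-++⁻ (inner P) x∈
    ... | inj₂ (here refl) = _ , spans-< p , ℕ.<-trans (spans-< q) (ℕ.n<1+n _) , spans-root q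
    ... | inj₁ x∈P with spans-inner p x∈P
    ... | i , s<i , i<m , e = i , s<i , ℕ.<-trans i<m (ℕ.<-trans (spans-< q) (ℕ.n<1+n _)) , e
    spans-inner (node {P = P} p q) x∈ | inj₂ (there x∈U) with spans-inner q x∈U
    ... | i , m<i , i<j , e = i , ℕ.<-trans (spans-< p) m<i , ℕ.<-trans i<j (ℕ.n<1+n _) , e

    spans-before : ∀ {v s t e} → Spans v s t e → ∀ {a b a′ b′} → Before (a , b) (a′ , b′) (inner t) →
      ∃₂ λ i j → i ℕ.< j × i ℕ.< e × j ℕ.< e × a ≡ v i × a′ ≡ v j
    spans-before (node {P = P} p q) b with before-++⁻ (inner P) b
    ... | inj₁ bP with spans-before p bP
    ... | i , j , i<j , i<m , j<m , e , e′ = i , j , i<j , up i<m , up j<m , e , e′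
      where
      up : ∀ {i} → i ℕ.< suc _ → i ℕ.< suc _
      up i<m = ℕ.<-trans i<m (ℕ.<-trans (spans-< q) (ℕ.n<1+n _))
    spans-before (node {P = P} p q) b | inj₂ (inj₁ (x∈ , here refl)) with spans-inner p x∈
    ... | i , _ , i<m , e = i , _ , i<m , ℕ.<-trans i<m j< , j< , e , spans-root q
      where j< = ℕ.<-trans (spans-< q) (ℕ.n<1+n _)
    spans-before (node {P = P} p q) b | inj₂ (inj₁ (x∈ , there y∈)) with spans-inner p x∈ | spans-inner q y∈
    ... | i , _ , i<m , e | j , m<j , j< , e′ = i , j , i<j , ℕ.<-trans i<j j<′ , j<′ , e , e′
      where
      i<j = ℕ.<-trans i<m m<j
      j<′ = ℕ.<-trans j< (ℕ.n<1+n _)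
    spans-before (node {P = P} p q) b | inj₂ (inj₂ (here y∈)) with spans-inner q y∈
    ... | j , m<j , j< , e′ = _ , j , m<j , ℕ.<-trans m<j j<′ , j<′ , spans-root q , e′
      where j<′ = ℕ.<-trans j< (ℕ.n<1+n _)
    spans-before (node {P = P} p q) b | inj₂ (inj₂ (there bU)) with spans-before q bU
    ... | i , j , i<j , i<m , j<m , e , e′ = i , j , i<j , ℕ.<-trans i<m (ℕ.n<1+n _) , ℕ.<-trans j<m (ℕ.n<1+n _) , e , e′

    endpoint : ∀ t {z : Fin n} → z ∈ word t → z ≡ root t ⊎ (∃₂ λ a b → (a , b) ∈ inner t × (z ≡ a ⊎ z ≡ b))
    endpoint (leaf c) (here refl) = inj₁ refl
    endpoint (node P U b) z∈ with ∈-word⁻ P U z∈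
    ... | inj₂ (inj₂ refl) = inj₂ (_ , _ , ∈-++⁺ʳ (inner P) (here refl) , inj₂ refl)
    ... | inj₁ z∈P with endpoint P z∈P
    ... | inj₁ e                = inj₁ e
    ... | inj₂ (_ , _ , x∈ , e) = inj₂ (_ , _ , ∈-++⁺ˡ x∈ , e)
    endpoint (node P U b) z∈ | inj₂ (inj₁ z∈U) with endpoint U z∈U
    ... | inj₁ e                = inj₂ (_ , _ , ∈-++⁺ʳ (inner P) (here refl) , inj₁ e)
    ... | inj₂ (_ , _ , x∈ , e) = inj₂ (_ , _ , ∈-++⁺ʳ (inner P) (there x∈) , e)

    -- The hooks of a configuration on the points (p , v p), p < N, in which every point
    -- but the first is a descent bottom or the northeast end of a hook.
    record System (v : ℕ → Fin n) (N : ℕ) (Hk : ℕ → ℕ → Set) : Set where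
      field
        distinct : ∀ {i j} → i ℕ.< N → j ℕ.< N → v i ≡ v j → i ≡ j
        long     : ∀ {d j} → Hk d j → suc d ℕ.< j
        bounded  : ∀ {d j} → Hk d j → j ℕ.< N
        fall     : ∀ {d j} → Hk d j → v (suc d) < v d
        rise     : ∀ {d j} → Hk d j → v d < v j
        clear    : ∀ {d j l} → Hk d j → d ℕ.< l → l ℕ.< j → v l < v j
        nest     : ∀ {d j d′ j′} → Hk d j → Hk d′ j′ → d ℕ.< d′ → d′ ℕ.< j → j′ ℕ.< j
        ne-det   : ∀ {d j j′} → Hk d j → Hk d j′ → j ≡ j′
        cover    : ∀ {i} → i ℕ.< N → i ≡ 0 ⊎ (∃₂ λ d j → Hk d j × i ≡ suc d) ⊎ (∃ λ d → Hk d i)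

      -- The stack invariant at position i, with `tree` on top of the stack. By `inside`, the hooks
      -- that pass over i start before this tree; by `opened`, the tree begins at the first position
      -- or at the descent bottom of a hook that is still open.
      record Parsed (i : ℕ) : Set where
        field
          {tree}  : Tree
          {start} : ℕ
          spans   : Spans v start tree (suc i)
          valid   : Valid tree
          hooked  : ∀ {a b} → (a , b) ∈ inner tree → ∃₂ λ d j → Hk d j × a ≡ v (suc d) × b ≡ v j
          inside  : ∀ {d j} → Hk d j → d ℕ.< i → i ℕ.< j → suc d ℕ.≤ start
          opened  : start ≡ 0 ⊎ (∃₂ λ d j → Hk d j × start ≡ suc d × i ℕ.< j)

      parse-node : ∀ {d i} → Hk d (suc i) → suc i ℕ.< N → Parsed d → Parsed i → Parsed (suc i)
      parse-node {d} {i} hk i<N D I = join meet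
        where
        module D = Parsed D
        module I = Parsed I
        d<i : d ℕ.< i
        d<i = ℕ.≤-pred (long hk)
        -- The tree before the pop begins exactly at the push of this hook. It cannot begin earlier,
        -- by `inside`; if it began later, its own hook would be nested under this one and would
        -- have to end before `suc i`, although it is open after i.
        meet : I.start ≡ suc d
        meet with I.opened
        ... | inj₁ e = contradiction (I.inside hk d<i (ℕ.n<1+n i)) (λ p → ℕ.n≮0 (subst (suc d ℕ.≤_) e p))
        ... | inj₂ (d′ , j′ , hk′ , e , i<j′) with ℕ.m≤n⇒m<n∨m≡n (subst (suc d ℕ.≤_) e (I.inside hk d<i (ℕ.n<1+n i)))
        ... | inj₂ p = trans e (sym p)
        ... | inj₁ (s≤s p) = contradiction (nest hk hk′ p (ℕ.≤-trans (ℕ.≤-reflexive (sym e)) (ℕ.<⇒≤ (spans-< I.spans))))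
                               (ℕ.≤⇒≯ i<j′)
        start<d : D.start ℕ.≤ d
        start<d = ℕ.≤-pred (spans-< D.spans)
        join : I.start ≡ suc d → Parsed (suc i)
        join e = record
          { spans = node D.spans spansI
          ; valid = node D.valid I.valid dis
              (subst₂ _<_ (sym (spans-root spansI)) (sym (spans-last D.spans)) (fall hk))
              (subst (_< v (suc i)) (sym (spans-last D.spans)) (rise hk))
              (subst (_< v (suc i)) (sym (spans-last I.spans)) (clear hk d<i (ℕ.n<1+n i)))
          ; hooked = hooked′
          ; inside = inside′
          ; opened = opened′ D.opened }
          where
          spansI : Spans v (suc d) I.tree (suc i)
          spansI = subst (λ s → Spans v s I.tree (suc i)) e I.spans
          dis : ∀ {z} → z ∈ word D.tree → z ∉ word I.tree
          dis z∈ z∈′ with spans-∈⁻ D.spans z∈ | spans-∈⁻ spansI z∈′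
          ... | p , _ , p≤d , e₁ | q , d<q , q≤i , e₂ = ℕ.<-irrefl
            (distinct (ℕ.<-trans p≤d (ℕ.<-trans (s≤s d<i) i<N)) (ℕ.<-trans q≤i i<N) (trans (sym e₁) e₂))
            (ℕ.<-≤-trans p≤d d<q)
          hooked′ : ∀ {a b} → (a , b) ∈ inner (node D.tree I.tree (v (suc i))) → ∃₂ λ d j → Hk d j × a ≡ v (suc d) × b ≡ v j
          hooked′ x∈ with ∈-++⁻ (inner D.tree) x∈
          ... | inj₁ p           = D.hooked p
          ... | inj₂ (here refl) = d , suc i , hk , spans-root spansI , refl
          ... | inj₂ (there p)   = I.hooked p
          inside′ : ∀ {d′ j′} → Hk d′ j′ → d′ ℕ.< suc i → suc i ℕ.< j′ → suc d′ ℕ.≤ D.start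
          inside′ {d′} hk′ p q with ℕ.<-cmp d′ d
          ... | tri< r _ _ = D.inside hk′ r (ℕ.<-trans (s≤s (ℕ.<⇒≤ d<i)) q)
          ... | tri≈ _ refl _ = contradiction q (ℕ.<-irrefl (ne-det hk hk′))
          ... | tri> _ _ r = contradiction (nest hk hk′ r p) (ℕ.<-asym q)
          opened′ : D.start ≡ 0 ⊎ (∃₂ λ d′ j′ → Hk d′ j′ × D.start ≡ suc d′ × d ℕ.< j′) →
            D.start ≡ 0 ⊎ (∃₂ λ d′ j′ → Hk d′ j′ × D.start ≡ suc d′ × suc i ℕ.< j′)
          opened′ (inj₁ e) = inj₁ e
          opened′ (inj₂ (d′ , j′ , hk′ , e , d<j′)) =
            inj₂ (d′ , j′ , hk′ , e , nest hk′ hk (ℕ.≤-trans (ℕ.≤-reflexive (sym e)) start<d) d<j′)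

      -- The tree ending at a descent bottom is a leaf; at the northeast end of a hook from d it
      -- joins the trees ending at d and just before i.
      parse : ∀ i → Acc ℕ._<_ i → i ℕ.< N → Parsed i
      parse i (acc rec) i<N with cover i<N
      ... | inj₁ refl = record
        { spans = leaf ; valid = leaf ; hooked = λ () ; inside = λ _ () ; opened = inj₁ refl }
      ... | inj₂ (inj₁ (d , j , hk , refl)) = record
        { spans = leaf ; valid = leaf ; hooked = λ () ; inside = λ _ p _ → p ; opened = inj₂ (d , j , hk , refl , long hk) }
      ... | inj₂ (inj₂ (d , hk)) = step i rec hk i<N
        where
        step : ∀ i → (∀ {j} → j ℕ.< i → Acc ℕ._<_ j) → Hk d i → i ℕ.< N → Parsed i
        step zero    rec hk i<N = contradiction (long hk) ℕ.n≮0
        step (suc i) rec hk i<N = parse-node hk i<N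
          (parse d (rec d<) (ℕ.<-trans d< i<N)) (parse i (rec (ℕ.n<1+n i)) (ℕ.<-trans (ℕ.n<1+n i) i<N))
          where d< = ℕ.<-trans (ℕ.n<1+n d) (long hk)

      ParsedBy : Tree → Set
      ParsedBy t = Spans v 0 t N × Valid t × (∀ {a b} → (a , b) ∈ inner t → ∃₂ λ d j → Hk d j × a ≡ v (suc d) × b ≡ v j)

      parse-all : ∀ {M} → N ≡ suc M → ∃ ParsedBy
      parse-all {M} refl = close (parse M (<-wellFounded M) ℕ.≤-refl)
        where
        close : Parsed M → ∃ ParsedBy
        close P with Parsed.opened P
        ... | inj₁ e = Parsed.tree P , subst (λ s → Spans v s (Parsed.tree P) N) e (Parsed.spans P) , Parsed.valid P , Parsed.hooked P
        ... | inj₂ (d , j , hk , _ , M<j) = contradiction (bounded hk) (ℕ.≤⇒≯ M<j)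

    hookList : ∀ {v s t e} → Spans v s t e → List (ℕ × ℕ)
    hookList leaf = []
    hookList (node {m = m} {j} p q) = hookList p ++ (m , j) ∷ hookList q

    record HookData (v : ℕ → Fin n) (s e : ℕ) (h : ℕ × ℕ) : Set where
      constructor hookData
      private
        d = proj₁ h
        j = proj₂ h
      field
        from-start : s ℕ.≤ d
        long       : suc d ℕ.< j
        to-end     : j ℕ.< e
        fall       : v (suc d) < v d
        rise       : v d < v j
        clear      : ∀ {l} → d ℕ.< l → l ℕ.< j → v l < v j

    hookList-data : ∀ {v s t e} (sp : Spans v s t e) → Valid t → All (HookData v s e) (hookList sp)
    hookList-data leaf leaf = []
    hookList-data {v} (node {s} {m} {j} {P} {U} p q) (node vP vU dis U<P P<b U<b) = All.++⁺
      (All.map (λ (hookData a b c f r cl) → hookData a b (ℕ.<-trans c (ℕ.<-trans (spans-< q) (ℕ.n<1+n j))) f r cl) (hookList-data p vP))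
      (hookData (ℕ.≤-pred (spans-< p)) (spans-< q) (ℕ.n<1+n j)
        (subst₂ _<_ (spans-root q) (spans-last p) U<P) (subst (_< v j) (spans-last p) P<b)
        (λ m<l l<j → ℕ.≤-<-trans (≤-last vU (spans-∈⁺ q m<l l<j)) U<b)
      ∷ All.map (λ (hookData a b c f r cl) → hookData (ℕ.≤-trans (ℕ.<⇒≤ (spans-< p)) a) b (ℕ.<-trans c (ℕ.n<1+n j)) f r cl) (hookList-data q vU))
      where import Data.List.Relation.Unary.All.Properties as All

    -- A hook from P ends no later than the last position of P, where the hook of the node starts;
    -- the hooks from U lie under the hook of the node.
    hookList-apart : ∀ {v s t e} (sp : Spans v s t e) → Valid t → AllPairs Apart (hookList sp)
    hookList-apart leaf leaf = []
    hookList-apart (node {s} {m} {j} {P} {U} p q) (node vP vU _ _ _ _) = AllPairs.++⁺ (hookList-apart p vP)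
      (All.map (λ (hookData a b c _ _ _) → a , inj₂ c) (hookList-data q vU) ∷ hookList-apart q vU)
      (All.map (λ (hookData a b c _ _ _) →
          (ℕ.≤-pred (ℕ.<-trans b c) , inj₁ (ℕ.≤-pred c)) ∷
          All.map (λ (hookData a′ _ _ _ _ _) → ℕ.<-≤-trans (ℕ.<-trans (ℕ.n<1+n _) (ℕ.<-trans b c)) a′ , inj₁ (ℕ.≤-trans (ℕ.<⇒≤ c) a′))
            (hookList-data q vU)) (hookList-data p vP))

    -- Descents occur at pushes only: a descent lies in P, in U or between them, because the final
    -- pop exceeds the letter before it.
    hookList-descent : ∀ {v s t e} (sp : Spans v s t e) → Valid t → ∀ {i} → s ℕ.≤ i → suc i ℕ.< e → v (suc i) < v i →
      ∃ λ j → (i , j) ∈ hookList sp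
    hookList-descent leaf leaf s≤i i<e _ = contradiction (ℕ.≤-pred i<e) (ℕ.≤⇒≯ s≤i)
    hookList-descent (node {s} {m} {j} {P} {U} p q) (node vP vU _ _ _ U<b) {i} s≤i i<e des with ℕ.<-cmp i m
    ... | tri< i<m _ _ with hookList-descent p vP s≤i (s≤s i<m) des
    ... | j′ , h∈ = j′ , ∈-++⁺ˡ h∈
    hookList-descent (node {s} {m} {j} p q) (node vP vU _ _ _ U<b) s≤i i<e des | tri≈ _ refl _ =
      j , ∈-++⁺ʳ (hookList p) (here refl)
    hookList-descent (node {s} {m} {j} p q) (node vP vU _ _ _ U<b) {i} s≤i i<e des | tri> _ _ m<i
      with ℕ.m≤n⇒m<n∨m≡n (ℕ.≤-pred i<e)
    ... | inj₂ refl = contradiction des (ℕ.<-asym (ℕ.≤-<-trans (≤-last vU (spans-∈⁺ q m<i (ℕ.n<1+n i))) U<b))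
    ... | inj₁ i<j with hookList-descent q vU m<i i<j des
    ... | j′ , h∈ = j′ , ∈-++⁺ʳ (hookList p) (there h∈)

    hookList-inner : ∀ {v s t e} (sp : Spans v s t e) → ∀ {a b} → (a , b) ∈ inner t →
      ∃₂ λ d j → (d , j) ∈ hookList sp × a ≡ v (suc d) × b ≡ v j
    hookList-inner (node {s} {m} {j} {P} p q) x∈ with ∈-++⁻ (inner P) x∈
    ... | inj₂ (here refl) = m , j , ∈-++⁺ʳ (hookList p) (here refl) , spans-root q , refl
    ... | inj₁ x∈P with hookList-inner p x∈P
    ... | d , j′ , h∈ , e = d , j′ , ∈-++⁺ˡ h∈ , e
    hookList-inner (node {s} {m} {j} {P} p q) x∈ | inj₂ (there x∈U) with hookList-inner q x∈U
    ... | d , j′ , h∈ , e = d , j′ , ∈-++⁺ʳ (hookList p) (there h∈) , e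

    hookList-length : ∀ {v s t e} (sp : Spans v s t e) → e ≡ suc (s ℕ.+ 2 ℕ.* length (hookList sp))
    hookList-length {s = s} leaf = cong suc (sym (ℕ.+-identityʳ s))
    hookList-length {s = s} (node {m = m} {j} p q) = trans (cong suc (trans (hookList-length q)
        (cong (λ u → suc (u ℕ.+ 2 ℕ.* length (hookList q))) (hookList-length p))))
      (trans (node-count s (length (hookList p)) (length (hookList q)))
        (cong (λ u → suc (s ℕ.+ 2 ℕ.* u)) (sym (length-++ (hookList p)))))

-- Finite sets, sorted lists and topological sorting

module Finite where
  open Before

  -- Positions in `Spans` are natural numbers. Those beyond `M` are sent to `M`, so that words
  -- become total functions; `toℕ-clamp` carries the bound.
  clamp : ∀ {M} → ℕ → Fin (suc M)
  clamp {M} p = fromℕ< (s≤s (ℕ.m⊓n≤n p M))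

  toℕ-clamp : ∀ {M p} → p ℕ.< suc M → toℕ (clamp {M} p) ≡ p
  toℕ-clamp {M} {p} (s≤s p≤M) = trans (toℕ-fromℕ< _) (ℕ.m≤n⇒m⊓n≡m p≤M)

  clamp-toℕ : ∀ {M} (i : Fin (suc M)) → clamp (toℕ i) ≡ i
  clamp-toℕ i = toℕ-injective (toℕ-clamp (s≤s (toℕ≤pred[n] i)))

  module _ {A : Set} where

    unique-length-≤ : ∀ {xs ys : List A} → Unique xs → (∀ {x} → x ∈ xs → x ∈ ys) → length xs ℕ.≤ length ys
    unique-length-≤ [] ⊆ = z≤n
    unique-length-≤ {x ∷ xs} (x∉ ∷ u) ⊆ with ∈-∃++ (⊆ (here refl))
    ... | l , r , refl = ℕ.≤-trans
      (s≤s (unique-length-≤ u λ z∈ → ∈-delete l (λ z≡x → All.lookup x∉ z∈ (sym z≡x)) (⊆ (there z∈))))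
      (ℕ.≤-reflexive (sym (length-++-sucʳ l x r)))

    lookup-injective : ∀ {xs : List A} → Unique xs → ∀ {i j} → lookup xs i ≡ lookup xs j → i ≡ j
    lookup-injective (x∉ ∷ u) {zero}  {zero}  e = refl
    lookup-injective (x∉ ∷ u) {zero}  {suc j} e = contradiction e (All.lookup x∉ (∈-lookup j))
    lookup-injective (x∉ ∷ u) {suc i} {zero}  e = contradiction (sym e) (All.lookup x∉ (∈-lookup i))
    lookup-injective (x∉ ∷ u) {suc i} {suc j} e = cong suc (lookup-injective u e)

    allPairs-before : ∀ {R : A → A → Set} {xs x y} → AllPairs R xs → Before x y xs → R x y
    allPairs-before (r ∷ rs) (here y∈) = All.lookup r y∈
    allPairs-before (r ∷ rs) (there b) = allPairs-before rs b

  allPairs-map-∈ : ∀ {A : Set} {R S : A → A → Set} {xs} → (∀ {x y} → x ∈ xs → y ∈ xs → R x y → S x y) → AllPairs R xs → AllPairs S xs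
  allPairs-map-∈ h [] = []
  allPairs-map-∈ h (r ∷ rs) = All.tabulate (λ y∈ → h (here refl) (there y∈) (All.lookup r y∈)) ∷
    allPairs-map-∈ (λ p q → h (there p) (there q)) rs

  map-unique-on : ∀ {A B : Set} {f : A → B} {xs} → Unique xs → (∀ {x y} → x ∈ xs → y ∈ xs → f x ≡ f y → x ≡ y) → Unique (map f xs)
  map-unique-on [] inj = []
  map-unique-on {f = f} {x ∷ xs} (x∉ ∷ u) inj = All.tabulate (λ z∈ e → clash (∈-map⁻ f z∈) e) ∷
    map-unique-on u λ p q → inj (there p) (there q)
    where
    clash : ∀ {z} → (∃ λ y → y ∈ xs × z ≡ f y) → f x ≢ z
    clash (y , y∈ , refl) e = All.lookup x∉ y∈ (inj (here refl) (there y∈) e)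

  unique-full : ∀ {N} {xs : List (Fin N)} → Unique xs → N ℕ.≤ length xs → ∀ i → i ∈ xs
  unique-full {N} {xs} u N≤ i with i ∈? xs
    where open DecMembership (_≟_ {N})
  ... | yes i∈ = i∈
  ... | no  i∉ = contradiction
    (ℕ.≤-trans (unique-length-≤ (All.tabulate (λ z∈ i≡z → i∉ (subst (_∈ xs) (sym i≡z) z∈)) ∷ u) (λ {z} _ → ∈-allFin z))
               (ℕ.≤-reflexive (length-tabulate {n = N} (λ j → j))))
    (ℕ.≤⇒≯ N≤)

  sorted-≡ : ∀ {n} {xs ys : List (Fin n)} → AllPairs _<_ xs → AllPairs _<_ ys →
    (∀ {x} → x ∈ xs → x ∈ ys) → (∀ {x} → x ∈ ys → x ∈ xs) → xs ≡ ys
  sorted-≡ [] [] to from = refl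
  sorted-≡ [] (_ ∷ _) to from with from (here refl)
  ... | ()
  sorted-≡ (_ ∷ _) [] to from with to (here refl)
  ... | ()
  sorted-≡ {xs = x ∷ xs} {y ∷ ys} (p ∷ ps) (q ∷ qs) to from = cong₂ _∷_ x≡y (sorted-≡ ps qs to′ from′)
    where
    x≡y : x ≡ y
    x≡y with to (here refl) | from (here refl)
    ... | here e   | _        = e
    ... | there _  | here e   = sym e
    ... | there x∈ | there y∈ = contradiction (All.lookup p y∈) (ℕ.<-asym (All.lookup q x∈))
    to′ : ∀ {z} → z ∈ xs → z ∈ ys
    to′ z∈ with to (there z∈)
    ... | there q    = q
    ... | here refl  = contradiction (All.lookup p z∈) (ℕ.<-irrefl (cong toℕ x≡y))
    from′ : ∀ {z} → z ∈ ys → z ∈ xs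
    from′ z∈ with from (there z∈)
    ... | there q    = q
    ... | here refl  = contradiction (All.lookup q z∈) (ℕ.<-irrefl (cong toℕ (sym x≡y)))

  -- Sorting along an acyclic relation: remove x, short-circuit the paths through x,
  -- sort the rest, and put x in front of its first successor.
  toposort : ∀ {A : Set} (xs : List A) {R : A → A → Set} → (∀ x y → Dec (R x y)) → (∀ x → ¬ TransClosure R x x) →
    Unique xs → ∃ λ ys → Unique ys × (∀ {x} → x ∈ ys → x ∈ xs) × (∀ {x} → x ∈ xs → x ∈ ys) × AllPairs (λ x y → ¬ R y x) ys
  toposort [] R? acyclic [] = [] , [] , (λ p → p) , (λ p → p) , []
  toposort {A} (x ∷ xs) {R} R? acyclic (x∉ ∷ u)
    with toposort xs {λ y z → R y z ⊎ (R y x × R x z)} (λ y z → R? y z ⊎-dec (R? y x ×-dec R? x z))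
           (λ y p → acyclic y (expand p)) u
    where
    expand₁ : ∀ {y z} → R y z ⊎ (R y x × R x z) → TransClosure R y z
    expand₁ (inj₁ r)        = [ r ]
    expand₁ (inj₂ (r , r′)) = r ∷ [ r′ ]
    expand : ∀ {y z} → TransClosure (λ y z → R y z ⊎ (R y x × R x z)) y z → TransClosure R y z
    expand [ r ]   = expand₁ r
    expand (r ∷ p) = expand₁ r Transitive.++ expand p
  ... | ys , uys , from , to , sorted =
    place ys , place-unique ys uys (λ p e → All.lookup x∉ (from p) e) ,
    (λ p → from′ (place⁻ ys p)) , to′ , place-sorted ys sorted
    where
    place : List A → List A
    place [] = x ∷ []
    place (y ∷ ys) with R? x y
    ... | yes _ = x ∷ y ∷ ys
    ... | no  _ = y ∷ place ys
    place⁻ : ∀ ys {z} → z ∈ place ys → z ≡ x ⊎ z ∈ ys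
    place⁻ [] (here e) = inj₁ e
    place⁻ (y ∷ ys) p with R? x y
    place⁻ (y ∷ ys) (here e)  | yes _ = inj₁ e
    place⁻ (y ∷ ys) (there p) | yes _ = inj₂ p
    place⁻ (y ∷ ys) (here e)  | no _ = inj₂ (here e)
    place⁻ (y ∷ ys) (there p) | no _ with place⁻ ys p
    ... | inj₁ e = inj₁ e
    ... | inj₂ q = inj₂ (there q)
    place⁺ : ∀ ys {z} → z ≡ x ⊎ z ∈ ys → z ∈ place ys
    place⁺ [] (inj₁ e) = here e
    place⁺ (y ∷ ys) p with R? x y
    place⁺ (y ∷ ys) (inj₁ e) | yes _ = here e
    place⁺ (y ∷ ys) (inj₂ q) | yes _ = there q
    place⁺ (y ∷ ys) (inj₁ e)         | no _ = there (place⁺ ys (inj₁ e))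
    place⁺ (y ∷ ys) (inj₂ (here e))  | no _ = here e
    place⁺ (y ∷ ys) (inj₂ (there q)) | no _ = there (place⁺ ys (inj₂ q))
    from′ : ∀ {z} → z ≡ x ⊎ z ∈ ys → z ∈ x ∷ xs
    from′ (inj₁ e) = here e
    from′ (inj₂ p) = there (from p)
    to′ : ∀ {z} → z ∈ x ∷ xs → z ∈ place ys
    to′ (here e)  = place⁺ ys (inj₁ e)
    to′ (there p) = place⁺ ys (inj₂ (to p))
    place-unique : ∀ ys → Unique ys → (∀ {z} → z ∈ ys → x ≢ z) → Unique (place ys)
    place-unique [] [] new = [] ∷ []
    place-unique (y ∷ ys) (y∉ ∷ u) new with R? x y
    ... | yes _ = All.tabulate new ∷ y∉ ∷ u
    ... | no  _ = All.tabulate (λ p → apart (place⁻ ys p)) ∷ place-unique ys u (λ p → new (there p))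
      where
      apart : ∀ {z} → z ≡ x ⊎ z ∈ ys → y ≢ z
      apart (inj₁ e) y≡z = new (here refl) (sym (trans y≡z e))
      apart (inj₂ p)     = All.lookup y∉ p
    place-sorted : ∀ ys → AllPairs (λ y z → ¬ (R z y ⊎ (R z x × R x y))) ys → AllPairs (λ y z → ¬ R z y) (place ys)
    place-sorted [] [] = [] ∷ []
    place-sorted (y ∷ ys) (p ∷ ps) with R? x y
    ... | yes r = (All.tabulate before) ∷ All.map (λ h r′ → h (inj₁ r′)) p ∷ rest ps
      where
      before : ∀ {z} → z ∈ y ∷ ys → ¬ R z x
      before (here refl) r′ = acyclic x (r ∷ [ r′ ])
      -- An edge from a later z to x, followed by the edge from x to y, is a short cut from z to y,
      -- which the sorting of the rest excludes.
      before (there z∈)  r′ = All.lookup p z∈ (inj₂ (r′ , r))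
      rest : ∀ {ys} → AllPairs (λ y z → ¬ (R z y ⊎ (R z x × R x y))) ys → AllPairs (λ y z → ¬ R z y) ys
      rest []       = []
      rest (q ∷ qs) = All.map (λ h r′ → h (inj₁ r′)) q ∷ rest qs
    ... | no ¬r = All.tabulate (λ p′ → after (place⁻ ys p′)) ∷ place-sorted ys ps
      where
      after : ∀ {z} → z ≡ x ⊎ z ∈ ys → ¬ R z y
      after (inj₁ refl) = ¬r
      after (inj₂ z∈) r = All.lookup p z∈ (inj₁ r)

-- From configurations to trees

module Represent where
  open Before
  open Trees
  open Hooks
  open Spans
  open Finite
  open import Data.Fin.Subset.Properties using (x∈⁅x⁆; x∈⁅y⁆⇒x≡y; x∈p∪q⁻; x∈p∪q⁺)

  open Equivalence using (to; from)

  module _ {n : ℕ} where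

    pair : Arc {n} → Subset n
    pair (a , b) = ⁅ a ⁆ ∪ ⁅ b ⁆

    ∈-pair⁻ : ∀ {a b z : Fin n} → z ∈ˢ pair (a , b) → z ≡ a ⊎ z ≡ b
    ∈-pair⁻ {a} {b} z∈ with x∈p∪q⁻ ⁅ a ⁆ ⁅ b ⁆ z∈
    ... | inj₁ p = inj₁ (x∈⁅y⁆⇒x≡y a p)
    ... | inj₂ p = inj₂ (x∈⁅y⁆⇒x≡y b p)

    ∈-pair⁺ : ∀ {a b z : Fin n} → z ≡ a ⊎ z ≡ b → z ∈ˢ pair (a , b)
    ∈-pair⁺ {a} {b} (inj₁ refl) = x∈p∪q⁺ (inj₁ (x∈⁅x⁆ a))
    ∈-pair⁺ {a} {b} (inj₂ refl) = x∈p∪q⁺ (inj₂ (x∈⁅x⁆ b))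

    pair-injective : ∀ {a b a′ b′ : Fin n} → a < b → a′ < b′ → pair (a , b) ≡ pair (a′ , b′) → (a , b) ≡ (a′ , b′)
    pair-injective {a} {b} {a′} {b′} a<b a′<b′ e
      with ∈-pair⁻ (subst (a ∈ˢ_) e (∈-pair⁺ (inj₁ refl))) | ∈-pair⁻ (subst (b ∈ˢ_) e (∈-pair⁺ (inj₂ refl)))
    ... | inj₁ refl | inj₂ refl = refl
    ... | inj₁ refl | inj₁ refl = contradiction a<b (ℕ.<-irrefl refl)
    ... | inj₂ refl | inj₂ refl = contradiction a<b (ℕ.<-irrefl refl)
    ... | inj₂ refl | inj₁ refl = contradiction a<b (ℕ.<-asym a′<b′)

    pair-ends : ∀ {a b x y : Fin n} → a < b → x < y → x ∈ˢ pair (a , b) → y ∈ˢ pair (a , b) → x ≡ a × y ≡ b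
    pair-ends a<b x<y x∈ y∈ with ∈-pair⁻ x∈ | ∈-pair⁻ y∈
    ... | inj₁ refl | inj₂ refl = refl , refl
    ... | inj₁ refl | inj₁ refl = contradiction x<y (ℕ.<-irrefl refl)
    ... | inj₂ refl | inj₂ refl = contradiction x<y (ℕ.<-irrefl refl)
    ... | inj₂ refl | inj₁ refl = contradiction x<y (ℕ.<-asym a<b)

    crossing⇒cross : ∀ {a b a′ b′ : Fin n} → a < b → a′ < b′ → Crossing (pair (a , b)) (pair (a′ , b′)) → Cross (a , b) (a′ , b′)
    crossing⇒cross a<b a′<b′ (i , k , j , l , i∈ , k∈ , j∈ , l∈ , inj₁ (p , q , r))
      with pair-ends a<b (ℕ.<-trans p q) i∈ k∈ | pair-ends a′<b′ (ℕ.<-trans q r) j∈ l∈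
    ... | refl , refl | refl , refl = inj₁ (p , q , r)
    crossing⇒cross a<b a′<b′ (i , k , j , l , i∈ , k∈ , j∈ , l∈ , inj₂ (p , q , r))
      with pair-ends a<b (ℕ.<-trans q r) k∈ i∈ | pair-ends a′<b′ (ℕ.<-trans p q) l∈ j∈
    ... | refl , refl | refl , refl = inj₂ (p , q , r)

    cross⇒crossing : ∀ {a b a′ b′ : Fin n} → Cross (a , b) (a′ , b′) → Crossing (pair (a , b)) (pair (a′ , b′))
    cross⇒crossing {a} {b} {a′} {b′} (inj₁ p) = a , b , a′ , b′ ,
      ∈-pair⁺ (inj₁ refl) , ∈-pair⁺ (inj₂ refl) , ∈-pair⁺ (inj₁ refl) , ∈-pair⁺ (inj₂ refl) , inj₁ p
    cross⇒crossing {a} {b} {a′} {b′} (inj₂ p) = b , a , b′ , a′ ,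
      ∈-pair⁺ (inj₂ refl) , ∈-pair⁺ (inj₁ refl) , ∈-pair⁺ (inj₂ refl) , ∈-pair⁺ (inj₁ refl) , inj₂ p

  module Representation {M : ℕ} (π : Permutation′ (suc M)) (H : VHC π) where

    open Configuration π H

    value : ℕ → Fin (suc N)
    value p = label (clamp p)

    value-toℕ : ∀ i → value (toℕ i) ≡ label i
    value-toℕ i = cong label (clamp-toℕ i)

    label-injective : ∀ {i j} → label i ≡ label j → i ≡ j
    label-injective e = height-injective (cong toℕ (inject₁-injective e))

    value-injective : ∀ {p q} → p ℕ.< N → q ℕ.< N → value p ≡ value q → p ≡ q
    value-injective p< q< e = trans (sym (toℕ-clamp p<)) (trans (cong toℕ (label-injective e)) (toℕ-clamp q<))

    -- The word of the tree is the permutation, and its arcs come from hooks. That every hook yields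
    -- an arc follows, see `inner-complete`.
    record Represents (t : Tree {suc N}) : Set where
      field
        spans  : Spans value 0 t N
        valid  : Valid t
        hooked : ∀ {a b} → (a , b) ∈ inner t → ∃ λ h → Σ (h ∈ hs) λ h∈ → a ≡ label (bottom h∈) × b ≡ label (ne h)

    bottom-unique : ∀ {h h′} (h∈ : h ∈ hs) (h′∈ : h′ ∈ hs) → bottom h∈ ≡ bottom h′∈ → h ≡ h′
    bottom-unique h∈ h′∈ e = sw-injective h∈ h′∈ (toℕ-injective (ℕ.suc-injective
      (trans (sym (toℕ-bottom h∈)) (trans (cong toℕ e) (toℕ-bottom h′∈)))))

    bottom-irrelevant : ∀ {h} (h∈ h∈′ : h ∈ hs) → bottom h∈ ≡ bottom h∈′
    bottom-irrelevant h∈ h∈′ = toℕ-injective (trans (toℕ-bottom h∈) (sym (toℕ-bottom h∈′)))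

    -- The descent bottom as a function of the hook alone, without a membership proof, so that it
    -- can be mapped over the list of hooks.
    next : Hook N → Fin N
    next h = clamp (suc (toℕ (sw h)))

    bottom≡next : ∀ {h} (h∈ : h ∈ hs) → bottom h∈ ≡ next h
    bottom≡next h∈ = trans (sym (clamp-toℕ _)) (cong clamp (toℕ-bottom h∈))

    ends : List (Fin N)
    ends = zero ∷ map next hs ++ map ne hs

    ends-unique : Unique ends
    ends-unique = All.tabulate (λ p e → zero∉ (∈-++⁻ (map next hs) p) e) ∷ Unique.++⁺
      (map-unique-on hs-unique λ p q e → bottom-unique p q (trans (bottom≡next p) (trans e (sym (bottom≡next q)))))
      (map-unique-on hs-unique ne-injective)
      λ (p , q) → disjoint (∈-map⁻ next p) (∈-map⁻ ne q)
      where
      hs-unique : Unique hs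
      hs-unique = Unique.map⁻ sw-unique
      zero∉ : ∀ {z} → z ∈ map next hs ⊎ z ∈ map ne hs → zero ≢ z
      zero∉ (inj₁ p) refl with ∈-map⁻ next p
      ... | h , h∈ , e = ℕ.n≮0 (subst (λ u → sw h < u) (trans (bottom≡next h∈) (sym e)) (sw<bottom h∈))
      zero∉ (inj₂ p) refl with ∈-map⁻ ne p
      ... | h , h∈ , e = ℕ.n≮0 (subst (λ u → sw h < u) (sym e) (sw<ne h∈))
      disjoint : ∀ {z} → (∃ λ h → h ∈ hs × z ≡ next h) → ¬ (∃ λ h → h ∈ hs × z ≡ ne h)
      disjoint (h , h∈ , e) (h′ , h′∈ , e′) = bottom≢ne h∈ h′∈ (trans (sym e′) (trans e (sym (bottom≡next h∈))))

    -- There is no room for other points: one, and two for each hook.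
    cover : ∀ {k} → length hs ≡ k → N ≡ 1 ℕ.+ 2 ℕ.* k → ∀ i → i ≡ zero ⊎ (∃ λ h → Σ (h ∈ hs) λ h∈ → i ≡ bottom h∈) ⊎ (∃ λ h → h ∈ hs × i ≡ ne h)
    cover {k} len N≡ i = locate (unique-full ends-unique (ℕ.≤-reflexive (trans N≡ (sym count))) i)
      where
      Located : Set
      Located = i ≡ zero ⊎ (∃ λ h → Σ (h ∈ hs) λ h∈ → i ≡ bottom h∈) ⊎ (∃ λ h → h ∈ hs × i ≡ ne h)
      count : length ends ≡ 1 ℕ.+ 2 ℕ.* k
      count = cong suc (trans (length-++ (map next hs)) (cong₂ ℕ._+_ (trans (length-map next hs) len)
        (trans (length-map ne hs) (trans len (sym (ℕ.+-identityʳ k))))))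
      at-bottom : (∃ λ h → h ∈ hs × i ≡ next h) → Located
      at-bottom (h , h∈ , e) = inj₂ (inj₁ (h , h∈ , trans e (sym (bottom≡next h∈))))
      locate : i ∈ ends → Located
      locate (here e)  = inj₁ e
      locate (there p) with ∈-++⁻ (map next hs) p
      ... | inj₁ q = at-bottom (∈-map⁻ next q)
      ... | inj₂ q = inj₂ (inj₂ (∈-map⁻ ne q))

    HookAt : ℕ → ℕ → Set
    HookAt d j = ∃ λ h → h ∈ hs × toℕ (sw h) ≡ d × toℕ (ne h) ≡ j

    value-< : ∀ i j {p q} → toℕ i ≡ p → toℕ j ≡ q → height i ℕ.< height j → value p < value q
    value-< i j refl refl lt = subst₂ _<_ (sym (value-toℕ i)) (sym (value-toℕ j)) (label-< lt)

    system : ∀ {k} → length hs ≡ k → N ≡ 1 ℕ.+ 2 ℕ.* k → System value N HookAt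
    system len N≡ = record
      { distinct = value-injective
      ; long = λ { (h , h∈ , refl , refl) → subst (ℕ._< toℕ (ne h)) (toℕ-bottom h∈) (bottom<ne h∈) }
      ; bounded = λ { (h , h∈ , refl , refl) → toℕ<n (ne h) }
      ; fall = λ { (h , h∈ , refl , refl) → value-< (bottom h∈) (sw h) (toℕ-bottom h∈) refl (falling h∈) }
      ; rise = λ { (h , h∈ , refl , refl) → value-< (sw h) (ne h) refl refl (rising h∈) }
      ; clear = clear′
      ; nest = λ { (h , h∈ , refl , refl) (h′ , h′∈ , refl , refl) p q → nested h∈ h′∈ p q }
      ; ne-det = λ { (h , h∈ , refl , refl) (h′ , h′∈ , e , refl) → cong (λ h → toℕ (ne h)) (sw-injective h∈ h′∈ (toℕ-injective (sym e))) }
      ; cover = cover′ }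
      where
      clear′ : ∀ {d j l} → HookAt d j → d ℕ.< l → l ℕ.< j → value l < value j
      clear′ {l = l} (h , h∈ , refl , refl) p q = value-< (clamp l) (ne h) l≡ refl
        (nothingAbove H h∈ (clamp l) (subst (toℕ (sw h) ℕ.<_) (sym l≡) p) (subst (ℕ._< toℕ (ne h)) (sym l≡) q))
        where
        l≡ : toℕ (clamp {M} l) ≡ l
        l≡ = toℕ-clamp (ℕ.<-trans q (toℕ<n (ne h)))
      cover′ : ∀ {i} → i ℕ.< N → i ≡ 0 ⊎ (∃₂ λ d j → HookAt d j × i ≡ suc d) ⊎ (∃ λ d → HookAt d i)
      cover′ {i} i<N = convert (cover len N≡ (clamp i))
        where
        at : ∀ {p : Fin N} → clamp i ≡ p → i ≡ toℕ p
        at e = trans (sym (toℕ-clamp i<N)) (cong toℕ e)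
        convert : clamp i ≡ zero ⊎ (∃ λ h → Σ (h ∈ hs) λ h∈ → clamp i ≡ bottom h∈) ⊎ (∃ λ h → h ∈ hs × clamp i ≡ ne h) →
          i ≡ 0 ⊎ (∃₂ λ d j → HookAt d j × i ≡ suc d) ⊎ (∃ λ d → HookAt d i)
        convert (inj₁ e) = inj₁ (at e)
        convert (inj₂ (inj₁ (h , h∈ , e))) = inj₂ (inj₁ (_ , _ , (h , h∈ , refl , refl) , trans (at e) (toℕ-bottom h∈)))
        convert (inj₂ (inj₂ (h , h∈ , e))) = inj₂ (inj₂ (_ , h , h∈ , refl , sym (at e)))

    abstract
      represent : ∀ {k} → length hs ≡ k → N ≡ 1 ℕ.+ 2 ℕ.* k → ∃ Represents
      represent len N≡ = collect (System.parse-all (system len N≡) refl)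
        where
        convert : ∀ {a b} → (∃₂ λ d j → HookAt d j × a ≡ value (suc d) × b ≡ value j) →
          ∃ λ h → Σ (h ∈ hs) λ h∈ → a ≡ label (bottom h∈) × b ≡ label (ne h)
        convert (_ , _ , (h , h∈ , refl , refl) , e , e′) = h , h∈ ,
          trans e (cong label (sym (bottom≡next h∈))) , trans e′ (value-toℕ (ne h))
        collect : ∃ (System.ParsedBy (system len N≡)) → ∃ Represents
        collect (t , sp , v , hk) = t , record { spans = sp ; valid = v ; hooked = λ x∈ → convert (hk x∈) }

    module Represented {t} (R : Represents t) where

      open Represents R public

      root≡ : root t ≡ label zero
      root≡ = spans-root spans

      label∈ : ∀ i → label i ∈ word t
      label∈ i = subst (_∈ word t) (value-toℕ i) (spans-∈⁺ spans z≤n (toℕ<n i))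

      ∈-label : ∀ {z} → z ∈ word t → ∃ λ i → z ≡ label i
      ∈-label z∈ with spans-∈⁻ spans z∈
      ... | p , _ , _ , e = clamp p , e

      last<∞ : last t < ∞
      last<∞ with ∈-label (last∈ t)
      ... | i , e = subst (_< ∞) (sym e) (label<∞ i)

      arc-< : ∀ {a b} → (a , b) ∈ arcs t ∞ → a < b
      arc-< (here refl) = ℕ.≤-<-trans (≤-last valid (root∈ t)) last<∞
      arc-< (there x∈)  = proj₂ (proj₂ (inner-∈ valid x∈))

      -- The label of the northeast end occurs in the word and is not the root, so it is an end of
      -- some arc. By `hooked` that arc comes from a hook, which must be `h` because descent bottoms
      -- are not northeast ends.
      inner-complete : ∀ {h} (h∈ : h ∈ hs) → (label (bottom h∈) , label (ne h)) ∈ inner t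
      inner-complete {h} h∈ = locate (endpoint t (label∈ (ne h)))
        where
        match : ∀ {a b} → (a , b) ∈ inner t → label (ne h) ≡ a ⊎ label (ne h) ≡ b →
          (∃ λ h → Σ (h ∈ hs) λ h∈ → a ≡ label (bottom h∈) × b ≡ label (ne h)) → (label (bottom h∈) , label (ne h)) ∈ inner t
        match x∈ (inj₁ e) (h′ , h′∈ , refl , refl) = contradiction (label-injective e) (bottom≢ne h′∈ h∈)
        match x∈ (inj₂ e) (h′ , h′∈ , refl , refl) with ne-injective h∈ h′∈ (label-injective e)
        ... | refl = subst (λ u → (label u , label (ne h)) ∈ inner t) (bottom-irrelevant h′∈ h∈) x∈
        locate : label (ne h) ≡ root t ⊎ (∃₂ λ a b → (a , b) ∈ inner t × (label (ne h) ≡ a ⊎ label (ne h) ≡ b)) →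
          (label (bottom h∈) , label (ne h)) ∈ inner t
        locate (inj₁ e) = contradiction (sw<ne h∈) (λ p → ℕ.n≮0 (subst (λ u → sw h < u) (label-injective (trans e root≡)) p))
        locate (inj₂ (a , b , x∈ , e)) = match x∈ e (hooked x∈)

      data ArcColour (x : Arc) : Colour N → Set where
        root-arc  : x ≡ (label zero , ∞) → ArcColour x nothing
        inner-arc : ∀ {h} (h∈ : h ∈ hs) → x ≡ (label (bottom h∈) , label (ne h)) → ArcColour x (just h)

      arc-colour : ∀ {x} → x ∈ arcs t ∞ → ∃ λ c → ArcColour x c
      arc-colour (here refl) = nothing , root-arc (cong (_, ∞) root≡)
      arc-colour (there x∈) with hooked x∈
      ... | h , h∈ , refl , refl = just h , inner-arc h∈ refl

      start : ∀ {x c} → ArcColour x c → Fin N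
      start (root-arc _)     = zero
      start (inner-arc h∈ _) = bottom h∈

      start-label : ∀ {x c} (A : ArcColour x c) → proj₁ x ≡ label (start A)
      start-label (root-arc refl)     = refl
      start-label (inner-arc h∈ refl) = refl

      colour-end : ∀ {a b c z} → ArcColour (a , b) c → z ≡ a ⊎ z ≡ b → colour π H z ≡ c
      colour-end (root-arc refl)     (inj₁ refl) = colour-zero
      colour-end (root-arc refl)     (inj₂ refl) = colour-∞
      colour-end (inner-arc h∈ refl) (inj₁ refl) = colour-bottom h∈
      colour-end (inner-arc h∈ refl) (inj₂ refl) = colour-ne h∈

      arc-determined : ∀ {x y c} → ArcColour x c → ArcColour y c → x ≡ y
      arc-determined (root-arc refl)     (root-arc refl)      = refl
      arc-determined (inner-arc h∈ refl) (inner-arc h∈′ refl) = cong (λ u → label u , _) (bottom-irrelevant h∈ h∈′)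

      arc-at : ∀ z → ∃₂ λ a b → (a , b) ∈ arcs t ∞ × (z ≡ a ⊎ z ≡ b)
      arc-at z = go (labelled z)
        where
        go : ∀ {z} → Labelled z → ∃₂ λ a b → (a , b) ∈ arcs t ∞ × (z ≡ a ⊎ z ≡ b)
        go is-∞ = _ , _ , here refl , inj₂ refl
        go (is-label i) with endpoint t (label∈ i)
        ... | inj₁ e                = _ , _ , here refl , inj₁ e
        ... | inj₂ (_ , _ , x∈ , e) = _ , _ , there x∈ , e

      -- Every label lies on some arc and both ends of an arc have its colour. A label of colour `c`
      -- thus lies on an arc of colour `c`, and there is only one such arc.
      pair-colour : ∀ {a b c} → ArcColour (a , b) c → ∀ z → z ∈ˢ pair (a , b) ⇔ colour π H z ≡ c
      pair-colour {a} {b} A z = mk⇔ (λ z∈ → colour-end A (∈-pair⁻ z∈)) back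
        where
        back : colour π H z ≡ _ → z ∈ˢ pair (a , b)
        back e with arc-at z
        ... | a′ , b′ , y∈ , ends with arc-colour y∈
        ... | c′ , A′ with trans (sym (colour-end A′ ends)) e
        ... | refl with arc-determined A′ A
        ... | refl = ∈-pair⁺ ends

      arc⇒class : ∀ {x} → x ∈ arcs t ∞ → ColourClass π H (pair x)
      arc⇒class {a , b} x∈ with arc-colour x∈
      ... | c , A = a , λ z → subst (λ c → z ∈ˢ pair (a , b) ⇔ colour π H z ≡ c) (sym (colour-end A (inj₁ refl))) (pair-colour A z)

      class⇒arc : ∀ {B} → ColourClass π H B → ∃ λ x → x ∈ arcs t ∞ × B ≡ pair x
      class⇒arc {B} (v , cl) with arc-at v
      ... | a , b , x∈ , e = (a , b) , x∈ ,
        class-≡-class (v , cl) (arc⇒class x∈) (from (cl v) refl) (∈-pair⁺ e)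

      pair-min : ∀ {x c} (A : ArcColour x c) → IsMin (start A) (Hat π (pair x))
      pair-min A@(root-arc refl)     = blue-min (pair-colour A)
      pair-min A@(inner-arc h∈ refl) = hooked-min h∈ (pair-colour A)

      before-arcs : ∀ {a b a′ b′} → Before (a , b) (a′ , b′) (arcs t ∞) →
        ∃₂ λ i j → i ℕ.< j × i ℕ.< N × j ℕ.< N × a ≡ value i × a′ ≡ value j
      before-arcs (there b) = spans-before spans b
      before-arcs (here y∈) with spans-inner spans y∈
      ... | j , 0<j , j<N , e = 0 , j , 0<j , s≤s z≤n , j<N , spans-root spans , e

      before⇒min< : ∀ {x y} → Before x y (arcs t ∞) → MinHat< π (pair x) (pair y)
      before⇒min< {a , b} {a′ , b′} p with arc-colour (proj₁ (before-∈ p)) | arc-colour (proj₂ (before-∈ p)) | before-arcs p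
      ... | c , A | c′ , A′ | i , j , i<j , i<N , j<N , e , e′ =
        start A , start A′ , pair-min A , pair-min A′ , subst₂ ℕ._<_ (at A i<N e) (at A′ j<N e′) i<j
        where
        at : ∀ {x c p} (A : ArcColour x c) → p ℕ.< N → proj₁ x ≡ value p → p ≡ toℕ (start A)
        at A p<N e = trans (sym (toℕ-clamp p<N)) (cong toℕ (label-injective (trans (sym e) (start-label A))))

      min<⇒before : ∀ {x y} → x ∈ arcs t ∞ → y ∈ arcs t ∞ → MinHat< π (pair x) (pair y) → Before x y (arcs t ∞)
      min<⇒before {x} {y} x∈ y∈ (i , j , m , m′ , i<j) with before-total x∈ y∈ x≢y
        where
        x≢y : x ≢ y
        x≢y refl = irreflexive (i , j , m , m′ , i<j)
      ... | inj₁ b = b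
      ... | inj₂ b with before⇒min< b
      ... | i′ , j′ , m₁ , m₁′ , i′<j′ with min-unique m m₁′ | min-unique m′ m₁
      ... | refl | refl = contradiction i<j (ℕ.<-asym i′<j′)

      cross-adjacent : ∀ {x y} → x ∈ arcs t ∞ → y ∈ arcs t ∞ → Cross x y → Adjacent ρ′ (pair x) (pair y)
      cross-adjacent x∈ y∈ c = arc⇒class x∈ , arc⇒class y∈ ,
        (λ e → cross-≢ c (pair-injective (arc-< x∈) (arc-< y∈) e)) , cross⇒crossing c

  module _ {M : ℕ} {π π′ : Permutation′ (suc M)} {H : VHC π} {H′ : VHC π′} where

    private
      module C  = Configuration π H
      module C′ = Configuration π′ H′
      module R  = Representation π H
      module R′ = Representation π′ H′

    -- Everything that `heap-injective` compares is visible in the image of the configuration: the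
    -- blocks are the arcs, and first positions of blocks are the positions of pushes, so `α` gives
    -- the order of crossing arcs.
    represents-injective : ∀ {t t′} → R.Represents t → R′.Represents t′ →
      (∀ B → C.ρ′ B ⇔ C′.ρ′ B) → (∀ B C → C.α′ B C ⇔ C′.α′ B C) → t ≡ t′
    represents-injective {t} {t′} T T′ hρ hα = heap-injective {n = suc C.N} _ refl T.valid T′.valid T.last<∞ T′.last<∞
      roots (mk⇔ to-inner from-inner) order
      where
      module T  = R.Represented T
      module T′ = R′.Represented T′
      to-arc : ∀ {x} → x ∈ arcs t C.∞ → x ∈ arcs t′ C.∞
      to-arc {x} x∈ = found (T′.class⇒arc (to (hρ (pair x)) (T.arc⇒class x∈)))
        where
        found : (∃ λ y → y ∈ arcs t′ C.∞ × pair x ≡ pair y) → x ∈ arcs t′ C.∞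
        found (y , y∈ , e) = subst (_∈ arcs t′ C.∞) (sym (pair-injective (T.arc-< x∈) (T′.arc-< y∈) e)) y∈
      from-arc : ∀ {x} → x ∈ arcs t′ C.∞ → x ∈ arcs t C.∞
      from-arc {x} x∈ = found (T.class⇒arc (from (hρ (pair x)) (T′.arc⇒class x∈)))
        where
        found : (∃ λ y → y ∈ arcs t C.∞ × pair x ≡ pair y) → x ∈ arcs t C.∞
        found (y , y∈ , e) = subst (_∈ arcs t C.∞) (sym (pair-injective (T′.arc-< x∈) (T.arc-< y∈) e)) y∈
      ¬∞ : ∀ {a} → (a , C.∞) ∉ inner t
      ¬∞ x∈ = ℕ.<⇒≱ T.last<∞ (≤-last T.valid (proj₁ (proj₂ (inner-∈ T.valid x∈))))
      ¬∞′ : ∀ {a} → (a , C.∞) ∉ inner t′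
      ¬∞′ x∈ = ℕ.<⇒≱ T′.last<∞ (≤-last T′.valid (proj₁ (proj₂ (inner-∈ T′.valid x∈))))
      roots : root t ≡ root t′
      roots = found (to-arc (here refl))
        where
        found : (root t , C.∞) ∈ arcs t′ C.∞ → root t ≡ root t′
        found (here e)   = cong proj₁ e
        found (there x∈) = contradiction x∈ ¬∞′
      to-inner : ∀ {x} → x ∈ inner t → x ∈ inner t′
      to-inner {x} x∈ = found x∈ (to-arc (there x∈))
        where
        found : ∀ {x} → x ∈ inner t → x ∈ arcs t′ C.∞ → x ∈ inner t′
        found x∈ (here refl) = contradiction x∈ ¬∞
        found x∈ (there p)   = p
      from-inner : ∀ {x} → x ∈ inner t′ → x ∈ inner t
      from-inner {x} x∈ = found x∈ (from-arc (there x∈))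
        where
        found : ∀ {x} → x ∈ inner t′ → x ∈ arcs t C.∞ → x ∈ inner t
        found x∈ (here refl) = contradiction x∈ ¬∞′
        found x∈ (there p)   = p
      order : ∀ {x y} → Cross x y → Before x y (inner t) → Before x y (inner t′)
      order {x} {y} c b = tail x∈′ (T′.min<⇒before (there x∈′) (there y∈′)
        (proj₂ (to (hα (pair x) (pair y)) (T.cross-adjacent (there x∈) (there y∈) c , T.before⇒min< (there b)))))
        where
        x∈ = proj₁ (before-∈ b)
        y∈ = proj₂ (before-∈ b)
        x∈′ = to-inner x∈
        y∈′ = to-inner y∈
        tail : x ∈ inner t′ → Before x y (arcs t′ C.∞) → Before x y (inner t′)
        tail x∈ (here _)  = contradiction x∈ ¬∞′
        tail x∈ (there b) = b

-- From trees to configurations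

module Realise where
  open Before
  open Trees
  open Hooks
  open Spans
  open Finite
  open Represent

  open Equivalence using (to; from)

  word-unique : ∀ {n} {t : Tree {n}} → Valid t → Unique (word t)
  word-unique leaf = [] ∷ []
  word-unique (node {P} {U} {b} vP vU dis _ P<b U<b) = Unique.++⁺ (word-unique vP)
    (Unique.++⁺ (word-unique vU) ([] ∷ []) λ { (z∈U , here refl) → ℕ.<⇒≱ U<b (≤-last vU z∈U) })
    λ (z∈P , z∈) → away z∈P (∈-++⁻ (word U) z∈)
    where
    away : ∀ {z} → z ∈ word P → ¬ (z ∈ word U ⊎ z ∈ b ∷ [])
    away z∈P (inj₁ z∈U)         = dis z∈P z∈U
    away z∈P (inj₂ (here refl)) = ℕ.<⇒≱ P<b (≤-last vP z∈P)

  map-sw-injective : ∀ {N} {xs ys : List (Hook N)} → map sw xs ≡ map sw ys →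
    (∀ {x y} → x ∈ xs → y ∈ ys → sw x ≡ sw y → ne x ≡ ne y) → xs ≡ ys
  map-sw-injective {xs = []} {[]} e h = refl
  map-sw-injective {xs = x ∷ xs} {y ∷ ys} e h with ∷-injective e
    where open import Data.List.Properties using (∷-injective)
  ... | e₁ , e₂ = cong₂ _∷_ (cong₂ _,_ e₁ (h (here refl) (here refl) e₁))
                    (map-sw-injective e₂ λ p q → h (there p) (there q))

  module _ {M : ℕ} {π π′ : Permutation′ (suc M)} {H : VHC π} {H′ : VHC π′} where

    private
      module C  = Configuration π H
      module C′ = Configuration π′ H′
      module R  = Representation π H
      module R′ = Representation π′ H′

    -- The word determines the permutation and hence the descents, which are the southwest ends. The
    -- northeast end of a hook is the pop of the arc that starts at its descent bottom.
    same-tree : ∀ {t} → R.Represents t → R′.Represents t → π Perm.≈ π′ × hooks H ≡ hooks H′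
    same-tree {t} T T′ = π≈ , map-sw-injective (trans (southwest H) (trans descents≡ (sym (southwest H′)))) ne≡
      where
      module T  = R.Represented T
      module T′ = R′.Represented T′
      label≡ : ∀ i → C.label i ≡ C′.label i
      label≡ i = trans (sym (R.value-toℕ i)) (trans (proj₂ (spans-determined T.spans T′.spans) z≤n (toℕ<n i)) (R′.value-toℕ i))
      π≈ : π Perm.≈ π′
      π≈ i = inject₁-injective (label≡ i)
      transfer : ∀ {ρ ρ′ : Permutation′ (suc M)} → ρ Perm.≈ ρ′ → ∀ {i} → IsDescent ρ i → IsDescent ρ′ i
      transfer ρ≈ {i} (j , e , lt) = j , e , subst₂ _<_ (ρ≈ j) (ρ≈ i) lt
      descents≡ : descents π ≡ descents π′
      descents≡ = filter-≐ (isDescent? π) (isDescent? π′)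
        (transfer {π} {π′} π≈ , transfer {π′} {π} (λ i → sym (π≈ i))) (allFin (suc M))
      ne≡ : ∀ {h h′} → h ∈ hooks H → h′ ∈ hooks H′ → sw h ≡ sw h′ → ne h ≡ ne h′
      ne≡ {h} {h′} h∈ h′∈ e = compare (T.hooked (T′.inner-complete h′∈))
        where
        bottom≡ : C.bottom h∈ ≡ C′.bottom h′∈
        bottom≡ = toℕ-injective (trans (C.toℕ-bottom h∈) (trans (cong (λ u → suc (toℕ u)) e) (sym (C′.toℕ-bottom h′∈))))
        compare : (∃ λ h₁ → Σ (h₁ ∈ hooks H) λ h₁∈ → C′.label (C′.bottom h′∈) ≡ C.label (C.bottom h₁∈) × C′.label (ne h′) ≡ C.label (ne h₁)) →
          ne h ≡ ne h′
        compare (h₁ , h₁∈ , e₁ , e₂) = trans (cong ne h≡) (R.label-injective (trans (sym e₂) (sym (label≡ (ne h′)))))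
          where
          h≡ : h ≡ h₁
          h≡ = R.bottom-unique h∈ h₁∈ (R.label-injective (trans (label≡ (C.bottom h∈)) (trans (cong C′.label bottom≡) e₁)))

  valueAt : ∀ {M} → Permutation′ (suc M) → ℕ → Fin (suc (suc M))
  valueAt π p = inject₁ (π ⟨$⟩ʳ clamp p)

  module Reading {M : ℕ} (t : Tree {suc (suc M)}) (valid : Valid t)
                     (letters : ∀ {z} → z ∈ word t ⇔ (∃ λ (y : Fin (suc M)) → z ≡ inject₁ y)) where

    private
      N : ℕ
      N = suc M
      w : List (Fin (suc N))
      w = word t

    length-word : length w ≡ N
    length-word = ℕ.≤-antisym
      (ℕ.≤-trans (unique-length-≤ (word-unique valid) (λ z∈ → below (to letters z∈))) (ℕ.≤-reflexive count))
      (ℕ.≤-trans (ℕ.≤-reflexive (sym count)) (unique-length-≤ (Unique.map⁺ inject₁-injective (Unique.allFin⁺ N))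
        λ z∈ → above (∈-map⁻ inject₁ z∈)))
      where
      count : length (map inject₁ (allFin N)) ≡ N
      count = trans (length-map inject₁ (allFin N)) (length-tabulate {n = N} (λ i → i))
      below : ∀ {z} → (∃ λ (y : Fin N) → z ≡ inject₁ y) → z ∈ map inject₁ (allFin N)
      below (y , refl) = ∈-map⁺ inject₁ (∈-allFin y)
      above : ∀ {z} → (∃ λ y → y ∈ allFin N × z ≡ inject₁ y) → z ∈ w
      above (y , _ , e) = from letters (y , e)

    private
      f g : Fin N → Fin N
      f i = proj₁ (to letters (∈-lookup (cast (sym length-word) i)))
      g y = cast length-word (index (from letters (y , refl)))

      f-lookup : ∀ i → inject₁ (f i) ≡ lookup w (cast (sym length-word) i)
      f-lookup i = sym (proj₂ (to letters (∈-lookup (cast (sym length-word) i))))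

      g-lookup : ∀ y → inject₁ y ≡ lookup w (index (from letters (y , refl)))
      g-lookup y = lookup-index (from letters (y , refl))

      fg : ∀ y → f (g y) ≡ y
      fg y = inject₁-injective (trans (f-lookup (g y))
        (trans (cong (lookup w) (cast-involutive (sym length-word) length-word _)) (sym (g-lookup y))))

      gf : ∀ i → g (f i) ≡ i
      gf i = trans (cong (cast length-word) (lookup-injective (word-unique valid) (trans (sym (g-lookup (f i))) (f-lookup i))))
        (cast-involutive length-word (sym length-word) i)

    π : Permutation′ N
    π = permutation f g fg gf

    private
      val : ℕ → Fin (suc N)
      val = valueAt π

    spans : Spans val 0 t N
    spans = convert (listed⇒spans t {[]} (subst (Listed val 0) (sym (++-identityʳ w)) (listed 0 w at)))
      where
      at : ∀ i → val (toℕ i) ≡ lookup w i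
      at i = trans (f-lookup (clamp (toℕ i))) (cong (lookup w) (toℕ-injective
        (trans (toℕ-cast (sym length-word) (clamp (toℕ i))) (toℕ-clamp (subst (toℕ i ℕ.<_) length-word (toℕ<n i))))))
      convert : (∃ λ e → Spans val 0 t e × Listed val e [] × e ≡ length w) → Spans val 0 t N
      convert (e , sp , _ , e≡) = subst (Spans val 0 t) (trans e≡ length-word) sp

  module Realisation {M : ℕ} (π : Permutation′ (suc M)) (t : Tree {suc (suc M)}) (valid : Valid t)
                     (spans : Spans (valueAt π) 0 t (suc M)) where

    private
      N : ℕ
      N = suc M

      val : ℕ → Fin (suc N)
      val = valueAt π

      f : Fin N → Fin N
      f i = π ⟨$⟩ʳ i

    private
      hl : List (ℕ × ℕ)
      hl = hookList spans

      toHook : ℕ × ℕ → Hook N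
      toHook (d , j) = clamp d , clamp j

      hs : List (Hook N)
      hs = map toHook hl

      val⇒height : ∀ {p q} → val p < val q → f (clamp p) < f (clamp q)
      val⇒height {p} {q} = subst₂ ℕ._<_ (toℕ-inject₁ (f (clamp p))) (toℕ-inject₁ (f (clamp q)))

      record Bounds (x : ℕ × ℕ) : Set where
        open HookData
        field
          dat : HookData val 0 N x
        sw≡ : toℕ (clamp {M} (proj₁ x)) ≡ proj₁ x
        sw≡ = toℕ-clamp (ℕ.<-trans (ℕ.<-trans (ℕ.n<1+n _) (long dat)) (to-end dat))
        ne≡ : toℕ (clamp {M} (proj₂ x)) ≡ proj₂ x
        ne≡ = toℕ-clamp (to-end dat)
        next≡ : toℕ (clamp {M} (suc (proj₁ x))) ≡ suc (proj₁ x)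
        next≡ = toℕ-clamp (ℕ.<-trans (long dat) (to-end dat))
        sw<ne : clamp {M} (proj₁ x) < clamp {M} (proj₂ x)
        sw<ne = subst₂ ℕ._<_ (sym sw≡) (sym ne≡) (ℕ.<-trans (ℕ.n<1+n _) (long dat))
        above : ∀ l → clamp {M} (proj₁ x) < l → l < clamp {M} (proj₂ x) → f l < f (clamp (proj₂ x))
        above l p q = subst (λ u → f u < f (clamp (proj₂ x))) (clamp-toℕ l)
          (val⇒height (clear dat (subst (ℕ._< toℕ l) sw≡ p) (subst (toℕ l ℕ.<_) ne≡ q)))

      bounds : ∀ {x} → x ∈ hl → Bounds x
      bounds x∈ = record { dat = All.lookup (hookList-data spans valid) x∈ }

      on-≤ne : ∀ {x p q} → x ∈ hl → OnHook π (toHook x) (p , q) → toℕ p ℕ.≤ proj₂ x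
      on-≤ne x∈ (inj₁ (refl , _))  = ℕ.≤-trans (ℕ.<⇒≤ X.sw<ne) (ℕ.≤-reflexive X.ne≡)
        where module X = Bounds (bounds x∈)
      on-≤ne x∈ (inj₂ (_ , r , _)) = ℕ.≤-trans r (ℕ.≤-reflexive (Bounds.ne≡ (bounds x∈)))

      on-≥sw : ∀ {x p q} → x ∈ hl → OnHook π (toHook x) (p , q) → proj₁ x ℕ.≤ toℕ p
      on-≥sw x∈ (inj₁ (refl , _)) = ℕ.≤-reflexive (sym (Bounds.sw≡ (bounds x∈)))
      on-≥sw x∈ (inj₂ (r , _))    = ℕ.≤-trans (ℕ.≤-reflexive (sym (Bounds.sw≡ (bounds x∈)))) r

      on-horizontal : ∀ {x p q} → x ∈ hl → proj₁ x ℕ.< toℕ p → OnHook π (toHook x) (p , q) → q ≡ f (clamp (proj₂ x))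
      on-horizontal x∈ d<p (inj₁ (e , _))     = contradiction d<p (ℕ.<-irrefl (sym (trans (cong toℕ e) (Bounds.sw≡ (bounds x∈)))))
      on-horizontal x∈ d<p (inj₂ (_ , _ , e)) = e

      on-≤height : ∀ {x p q} → OnHook π (toHook x) (p , q) → q ≤ f (clamp (proj₂ x))
      on-≤height (inj₁ (_ , _ , r))    = r
      on-≤height (inj₂ (_ , _ , refl)) = ℕ.≤-refl

      -- At the abscissae of the later hook y, the earlier hook x consists of its horizontal part.
      -- If x ends no later than y starts, one abscissa can be shared; if y lies under x, this
      -- horizontal part is strictly above all of y.
      meet : ∀ {x y} → x ∈ hl → y ∈ hl → Apart x y → MeetOnlyAtEndpoints π (toHook x) (toHook y)
      meet {x} {y} x∈ y∈ (d<d′ , inj₁ j≤d′) (p , q) on on′ =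
        inj₁ (cong₂ _,_ p≡ q≡ , cong₂ _,_ p≡′ (trans q≡ (cong f (trans (sym p≡) p≡′))))
        where
        p≡ : p ≡ clamp (proj₂ x)
        p≡ = toℕ-injective (trans (ℕ.≤-antisym (on-≤ne x∈ on) (ℕ.≤-trans j≤d′ (on-≥sw y∈ on′))) (sym (Bounds.ne≡ (bounds x∈))))
        p≡′ : p ≡ clamp (proj₁ y)
        p≡′ = toℕ-injective (trans (ℕ.≤-antisym (ℕ.≤-trans (on-≤ne x∈ on) j≤d′) (on-≥sw y∈ on′)) (sym (Bounds.sw≡ (bounds y∈))))
        q≡ : q ≡ f (clamp (proj₂ x))
        q≡ = on-horizontal x∈ (ℕ.<-≤-trans d<d′ (on-≥sw y∈ on′)) on
      meet {x} {y} x∈ y∈ (d<d′ , inj₂ j′<j) (p , q) on on′ =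
        contradiction (subst (λ u → u ≤ f (clamp (proj₂ y))) (on-horizontal x∈ (ℕ.<-≤-trans d<d′ (on-≥sw y∈ on′)) on) (on-≤height {y} on′))
          (ℕ.<⇒≱ (X.above (clamp (proj₂ y)) (subst₂ ℕ._<_ (sym X.sw≡) (sym Y.ne≡) (ℕ.<-trans d<d′ (subst₂ ℕ._<_ Y.sw≡ Y.ne≡ Y.sw<ne)))
            (subst₂ ℕ._<_ (sym Y.ne≡) (sym X.ne≡) j′<j)))
        where
        module X = Bounds (bounds x∈)
        module Y = Bounds (bounds y∈)

      swap : ∀ {h h′} → MeetOnlyAtEndpoints π h h′ → MeetOnlyAtEndpoints π h′ h
      swap m p on on′ with m p on′ on
      ... | inj₁ (e , e′) = inj₂ (e′ , e)
      ... | inj₂ (e , e′) = inj₁ (e′ , e)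

      southwest′ : map sw hs ≡ descents π
      southwest′ = sorted-≡ sorted-sw (AllPairs.filter⁺ (isDescent? π) (AllPairs.tabulate⁺-< λ i<j → i<j)) sw⇒ ⇒sw
        where
        sorted-sw : AllPairs _<_ (map sw hs)
        sorted-sw = AllPairs.map⁺ (AllPairs.map⁺ (allPairs-map-∈
          (λ x∈ y∈ (d<d′ , _) → subst₂ ℕ._<_ (sym (Bounds.sw≡ (bounds x∈))) (sym (Bounds.sw≡ (bounds y∈))) d<d′)
          (hookList-apart spans valid)))
        sw⇒ : ∀ {i} → i ∈ map sw hs → i ∈ descents π
        sw⇒ i∈ with ∈-map⁻ sw i∈
        ... | h , h∈ , refl with ∈-map⁻ toHook h∈
        ... | x , x∈ , refl = ∈-filter⁺ (isDescent? π) (∈-allFin _)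
          (clamp (suc (proj₁ x)) , trans X.next≡ (cong suc (sym X.sw≡)) , val⇒height (HookData.fall X.dat))
          where module X = Bounds (bounds x∈)
        ⇒sw : ∀ {i} → i ∈ descents π → i ∈ map sw hs
        ⇒sw {i} i∈ with ∈-filter⁻ (isDescent? π) {xs = allFin N} i∈
        ... | _ , j , e , lt with hookList-descent spans valid {toℕ i} z≤n (subst (ℕ._< N) e (toℕ<n j))
              (subst₂ ℕ._<_ (trans (sym (toℕ-inject₁ (f j))) (cong (λ u → toℕ (inject₁ (f u))) (trans (sym (clamp-toℕ j)) (cong clamp e))))
                            (trans (sym (toℕ-inject₁ (f i))) (cong (λ u → toℕ (inject₁ (f u))) (sym (clamp-toℕ i)))) lt)
        ... | j′ , x∈ = subst (_∈ map sw hs) (clamp-toℕ i) (∈-map⁺ sw (∈-map⁺ toHook x∈))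

    H : VHC π
    H = record
      { hooks = hs
      ; isHook = λ h∈ → isHook′ (∈-map⁻ toHook h∈)
      ; southwest = southwest′
      ; nothingAbove = λ h∈ → above′ (∈-map⁻ toHook h∈)
      ; nonIntersecting = λ h∈ h′∈ → separate (∈-map⁻ toHook h∈) (∈-map⁻ toHook h′∈) }
      where
      isHook′ : ∀ {h} → (∃ λ x → x ∈ hl × h ≡ toHook x) → IsHook π h
      isHook′ (x , x∈ , refl) = Bounds.sw<ne (bounds x∈) , val⇒height (HookData.rise (Bounds.dat (bounds x∈)))
      above′ : ∀ {h} → (∃ λ x → x ∈ hl × h ≡ toHook x) → NothingAbove π h
      above′ (x , x∈ , refl) = Bounds.above (bounds x∈)
      separate : ∀ {h h′} → (∃ λ x → x ∈ hl × h ≡ toHook x) → (∃ λ x → x ∈ hl × h′ ≡ toHook x) → h ≢ h′ → MeetOnlyAtEndpoints π h h′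
      separate (x , x∈ , refl) (y , y∈ , refl) h≢h′ with before-total x∈ y∈ (λ e → h≢h′ (cong toHook e))
      ... | inj₁ b = meet x∈ y∈ (allPairs-before (hookList-apart spans valid) b)
      ... | inj₂ b = swap (meet y∈ x∈ (allPairs-before (hookList-apart spans valid) b))

    open Configuration π H using (label; bottom)
    open Representation π H using (Represents; bottom≡next)

    represents : Represents t
    represents = record { spans = spans ; valid = valid ; hooked = λ x∈ → convert (hookList-inner spans x∈) }
      where
      convert : ∀ {a b} → (∃₂ λ d j → (d , j) ∈ hl × a ≡ val (suc d) × b ≡ val j) →
        ∃ λ h → Σ (h ∈ hs) λ h∈ → a ≡ label (bottom h∈) × b ≡ label (ne h)
      convert (d , j , x∈ , e , e′) = toHook (d , j) , ∈-map⁺ toHook x∈ ,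
        trans e (cong label (trans (cong (λ u → clamp (suc u)) (sym (Bounds.sw≡ (bounds x∈)))) (sym (bottom≡next (∈-map⁺ toHook x∈))))) , e′

    numHooks≡ : ∀ {k} → N ≡ 1 ℕ.+ 2 ℕ.* k → length (hooks H) ≡ k
    numHooks≡ e = trans (length-map toHook hl) (ℕ.*-cancelˡ-≡ _ _ 2 (ℕ.suc-injective (trans (sym (hookList-length spans)) e)))

  abstract
    realise : ∀ {M} {t : Tree {suc (suc M)}} → Valid t → (∀ {z} → z ∈ word t ⇔ (∃ λ (y : Fin (suc M)) → z ≡ inject₁ y)) →
      ∃ λ (V : VHC[S suc M ]) → Representation.Represents (proj₁ V) (proj₂ V) t × (∀ {k} → suc M ≡ 1 ℕ.+ 2 ℕ.* k → numHooks V ≡ k)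
    realise {t = t} valid letters = (R.π , K.H) , K.represents , K.numHooks≡
      where
      module R = Reading t valid letters
      module K = Realisation R.π t valid R.spans

-- From oriented matchings to trees

module Heap where
  open import Data.Fin.Properties using (any?)
  open import Data.Fin.Subset using (inside; outside)
  open import Data.Vec.Base using ([]; _∷_)

  open Before
  open Trees
  open Finite
  open Represent
  import Data.Bool.Properties as Bool
  open import Data.Fin.Subset.Properties using (∪-identityˡ; ∣⁅x⁆∣≡1) renaming (_∈?_ to _∈ˢ?_)
  open import Data.Vec.Properties using (≡-dec)
  import Relation.Nullary.Decidable as Dec

  open Equivalence using (to; from)

  ∣B∣≡0 : ∀ {n} (B : Subset n) → ∣ B ∣ ≡ 0 → B ≡ ⊥
  ∣B∣≡0 [] e = refl
  ∣B∣≡0 (outside ∷ B) e = cong (outside ∷_) (∣B∣≡0 B e)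

  ∣B∣≡1 : ∀ {n} (B : Subset n) → ∣ B ∣ ≡ 1 → ∃ λ a → B ≡ ⁅ a ⁆
  ∣B∣≡1 (inside ∷ B) e = zero , cong (inside ∷_) (∣B∣≡0 B (ℕ.suc-injective e))
  ∣B∣≡1 (outside ∷ B) e with ∣B∣≡1 B e
  ... | a , refl = suc a , refl

  ∣B∣≡2 : ∀ {n} (B : Subset n) → ∣ B ∣ ≡ 2 → ∃₂ λ a b → a < b × B ≡ pair (a , b)
  ∣B∣≡2 (inside ∷ B) e with ∣B∣≡1 B (ℕ.suc-injective e)
  ... | b , refl = zero , suc b , s≤s z≤n , cong (inside ∷_) (sym (∪-identityˡ ⁅ b ⁆))
  ∣B∣≡2 (outside ∷ B) e with ∣B∣≡2 B e
  ... | a , b , a<b , refl = suc a , suc b , s≤s a<b , refl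

  ∣pair∣ : ∀ {n} {a b : Fin n} → a < b → ∣ pair (a , b) ∣ ≡ 2
  ∣pair∣ {a = zero}  {suc b} _         = cong suc (trans (cong ∣_∣ (∪-identityˡ ⁅ b ⁆)) (∣⁅x⁆∣≡1 b))
  ∣pair∣ {a = suc a} {suc b} (s≤s a<b) = ∣pair∣ a<b

  crossing? : ∀ {n} (B C : Subset n) → Dec (Crossing B C)
  crossing? B C = any? λ i → any? λ k → any? λ j → any? λ l →
    (i ∈ˢ? B) ×-dec (k ∈ˢ? B) ×-dec (j ∈ˢ? C) ×-dec (l ∈ˢ? C) ×-dec
    (((i <? j) ×-dec (j <? k) ×-dec (k <? l)) ⊎-dec ((l <? k) ×-dec (k <? j) ×-dec (j <? i)))

  below-∞ : ∀ {n} (z : Fin (suc n)) → z < fromℕ n → ∃ λ y → z ≡ inject₁ y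
  below-∞ z z<∞ with view z
  ... | ‵fromℕ     = contradiction z<∞ (ℕ.<-irrefl refl)
  ... | ‵inject₁ y = y , refl

  module FromHeap {N : ℕ} (P : OrientedPartition (suc N)) (isP : IsP̃ᶜ P) (matching : IsMatching (ρ P)) where

    open IsP̃ᶜ isP
    open IsPartition isPartition
    open IsOrientation isOrientation

    private
      ∞ : Fin (suc N)
      ∞ = fromℕ N

      L : Set
      L = Fin (suc N)

    same-block : ∀ {B C v} → ρ P B → ρ P C → v ∈ˢ B → v ∈ˢ C → B ≡ C
    same-block {v = v} b c v∈B v∈C = trans (sym (proj₂ (proj₂ (covered v)) (b , v∈B))) (proj₂ (proj₂ (covered v)) (c , v∈C))

    arcOf : ∀ v → ∃₂ λ a b → a < b × proj₁ (covered v) ≡ pair (a , b)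
    arcOf v = ∣B∣≡2 _ (matching (proj₁ (proj₁ (proj₂ (covered v)))))

    arc : L → Arc
    arc v = proj₁ (arcOf v) , proj₁ (proj₂ (arcOf v))

    IsArc : Arc → Set
    IsArc x = proj₁ x < proj₂ x × ρ P (pair x)

    arc-isArc : ∀ v → IsArc (arc v)
    arc-isArc v = proj₁ (proj₂ (proj₂ (arcOf v))) ,
      subst (ρ P) (proj₂ (proj₂ (proj₂ (arcOf v)))) (proj₁ (proj₁ (proj₂ (covered v))))

    ∈-arc : ∀ v → v ∈ˢ pair (arc v)
    ∈-arc v = subst (v ∈ˢ_) (proj₂ (proj₂ (proj₂ (arcOf v)))) (proj₂ (proj₁ (proj₂ (covered v))))

    arc-disjoint : ∀ {x y z} → IsArc x → IsArc y → z ∈ˢ pair x → z ∈ˢ pair y → x ≡ y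
    arc-disjoint (x< , ρx) (y< , ρy) z∈x z∈y = pair-injective x< y< (same-block ρx ρy z∈x z∈y)

    block-arc : ∀ {B} → ρ P B → ∃ λ x → IsArc x × B ≡ pair x
    block-arc {B} b with ∣B∣≡2 B (matching b)
    ... | x , y , x<y , refl = (x , y) , (x<y , b) , refl

    lower? : ∀ v → Dec (proj₁ (arc v) ≡ v)
    lower? v = proj₁ (arc v) ≟ v

    -- Indexing the blocks by their smaller elements lists each of them once.
    allArcs : List Arc
    allArcs = map arc (filter lower? (allFin (suc N)))

    ∈-allArcs⁻ : ∀ {x} → x ∈ allArcs → IsArc x
    ∈-allArcs⁻ x∈ with ∈-map⁻ arc x∈
    ... | v , _ , refl = arc-isArc v

    ∈-allArcs⁺ : ∀ {x} → IsArc x → x ∈ allArcs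
    ∈-allArcs⁺ {x} ax = subst (_∈ allArcs) (sym x≡)
      (∈-map⁺ arc (∈-filter⁺ lower? (∈-allFin (proj₁ x)) (cong proj₁ (sym x≡))))
      where
      x≡ : x ≡ arc (proj₁ x)
      x≡ = arc-disjoint ax (arc-isArc (proj₁ x)) (∈-pair⁺ (inj₁ refl)) (∈-arc (proj₁ x))

    allArcs-unique : Unique allArcs
    allArcs-unique = map-unique-on (Unique.filter⁺ lower? (Unique.allFin⁺ (suc N)))
      λ u∈ v∈ e → trans (sym (proj₂ (∈-filter⁻ lower? {xs = allFin (suc N)} u∈)))
        (trans (cong proj₁ e) (proj₂ (∈-filter⁻ lower? {xs = allFin (suc N)} v∈)))

    R : Arc → Arc → Set
    R x y = α P (pair x) (pair y)

    -- `ρ` and `α` are bare relations, but `covered` names the block of a point. Comparison with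
    -- that block decides `ρ` on sets with a known element, and then `oriented` decides `α` on
    -- adjacent blocks.
    R? : ∀ x y → Dec (R x y)
    R? x y with adjacent?
      where
      ρ? : ∀ B v → v ∈ˢ B → Dec (ρ P B)
      ρ? B v v∈ = Dec.map′ (λ e → subst (ρ P) e (proj₁ (proj₁ (proj₂ (covered v)))))
        (λ b → proj₂ (proj₂ (covered v)) (b , v∈)) (≡-dec Bool._≟_ (proj₁ (covered v)) B)
      adjacent? : Dec (Adjacent (ρ P) (pair x) (pair y))
      adjacent? = ρ? (pair x) (proj₁ x) (∈-pair⁺ (inj₁ refl)) ×-dec ρ? (pair y) (proj₁ y) (∈-pair⁺ (inj₁ refl)) ×-dec
        ¬? (≡-dec Bool._≟_ (pair x) (pair y)) ×-dec crossing? (pair x) (pair y)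
    ... | no ¬adj = no λ a → ¬adj (edge a)
    ... | yes adj with oriented adj
    ... | inj₁ a = yes a
    ... | inj₂ a = no (oneWay a)

    R-acyclic : ∀ x → ¬ TransClosure R x x
    R-acyclic x p = acyclic (pair x) (image p)
      where
      image : ∀ {x y} → TransClosure R x y → TransClosure (α P) (pair x) (pair y)
      image [ r ]   = [ r ]
      image (r ∷ p) = r ∷ image p

    R-cross : ∀ {x y} → IsArc x → IsArc y → R x y → Cross x y
    R-cross (x< , _) (y< , _) r = crossing⇒cross x< y< (proj₂ (proj₂ (proj₂ (edge r))))

    ∞-arc : ∀ {x} → IsArc x → ∞ ∈ˢ pair x → proj₂ x ≡ ∞
    ∞-arc {x} (x< , _) ∞∈ with ∈-pair⁻ ∞∈
    ... | inj₂ e    = sym e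
    ... | inj₁ refl = contradiction x< (ℕ.≤⇒≯ (≤fromℕ (proj₂ x)))

    Linear : List Arc → Set
    Linear = AllPairs (λ x y → ¬ R y x)

    record Heap : Set where
      field
        {tree} : Tree {suc N}
        valid  : Valid tree
        bound  : last tree < ∞
        arcs⁺  : ∀ {x} → IsArc x → x ∈ arcs tree ∞
        arcs⁻  : ∀ {x} → x ∈ arcs tree ∞ → IsArc x
        order  : ∀ {x y} → IsArc x → IsArc y → R x y → Before x y (arcs tree ∞)

    -- In a linear extension the first arc has no predecessor, so it is the source and contains the
    -- largest label; its other end becomes the root. Every later arc is not a source, so it has a
    -- predecessor; that predecessor stands earlier in the list and crosses it, which is what
    -- `Linked` demands.
    build : ∀ ys → Unique ys → (∀ {x} → x ∈ ys → IsArc x) → (∀ {x} → IsArc x → x ∈ ys) → Linear ys → Heap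
    build [] u isArc listed linear with listed (arc-isArc ∞)
    ... | ()
    build (x₀@(c , b₀) ∷ xs) (x₀∉ ∷ u) isArc listed (first ∷ linear) = plant b₀≡∞
      where
      predecessor-free : ∀ {x} → IsArc x → (∀ {y} → y ∈ x₀ ∷ xs → ¬ R y x) → ∞ ∈ˢ pair x
      predecessor-free {x} ax none = to (onlySource (proj₂ ax)) source
        where
        source : IsSource (α P) (pair x)
        source B a with block-arc (proj₁ (edge a))
        ... | y , ay , refl = none (listed ay) a

      b₀≡∞ : b₀ ≡ ∞
      b₀≡∞ = ∞-arc (isArc (here refl)) (predecessor-free (isArc (here refl)) none)
        where
        none : ∀ {y} → y ∈ x₀ ∷ xs → ¬ R y x₀
        none (here refl) r = R-acyclic x₀ [ r ]
        none (there y∈)  r = All.lookup first y∈ r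

      x₀≢ : ∀ {x} → x ∈ xs → x₀ ≢ x
      x₀≢ x∈ = All.lookup x₀∉ x∈

      predecessor : ∀ {x} → x ∈ xs → Any (λ y → R y x) (x₀ ∷ xs)
      predecessor {x} x∈ with Any.any? (λ y → R? y x) (x₀ ∷ xs)
      ... | yes p = p
      ... | no ¬p = contradiction
        (arc-disjoint (isArc (here refl)) (isArc (there x∈)) (∈-pair⁺ (inj₂ (sym b₀≡∞)))
          (predecessor-free (isArc (there x∈)) λ y∈ r → ¬p (lose y∈ r)))
        (x₀≢ x∈)

      linked : ∀ done rest → (∀ {z} → z ∈ x₀ ∷ xs → z ∈ done ⊎ z ∈ rest) → (∀ {z} → z ∈ rest → z ∈ xs) → Linear rest → Linked done rest
      linked done [] cover ⊆ lin = []
      linked done (x ∷ rest) cover ⊆ (later ∷ lin) = located (find (predecessor (⊆ (here refl)))) ∷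
        linked (x ∷ done) rest (λ z∈ → shift (cover z∈)) (λ z∈ → ⊆ (there z∈)) lin
        where
        shift : ∀ {z} → z ∈ done ⊎ z ∈ x ∷ rest → z ∈ x ∷ done ⊎ z ∈ rest
        shift (inj₁ p)           = inj₁ (there p)
        shift (inj₂ (here refl)) = inj₁ (here refl)
        shift (inj₂ (there p))   = inj₂ p
        place : ∀ {y} → y ∈ x₀ ∷ xs → R y x → y ∈ done ⊎ y ∈ x ∷ rest → Any (Cross x) done
        place y∈ r (inj₁ p) = lose p (cross-sym (R-cross (isArc y∈) (isArc (there (⊆ (here refl)))) r))
        place y∈ r (inj₂ (here refl)) = contradiction [ r ] (R-acyclic x)
        place y∈ r (inj₂ (there p))   = contradiction r (All.lookup later p)
        located : (∃ λ y → y ∈ x₀ ∷ xs × R y x) → Any (Cross x) done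
        located (y , y∈ , r) = place y∈ r (cover y∈)

      plant : b₀ ≡ ∞ → Heap
      plant refl = grow (heap-surjective {done = x₀ ∷ []} (leaf c) xs leaf (proj₁ (isArc (here refl)))
          (λ { (here refl) → here refl })
          (linked (x₀ ∷ []) xs (λ { (here refl) → inj₁ (here refl) ; (there p) → inj₂ p }) (λ p → p) linear)
          (All.tabulate λ x∈ → proj₁ (isArc (there x∈)) , bound′ x∈)
          (All.tabulate fresh) (allPairs-map-unique u))
        where
        apart : ∀ {x y} → x ∈ x₀ ∷ xs → y ∈ x₀ ∷ xs → x ≢ y → ∀ {z} → z ∈ˢ pair x → ¬ z ∈ˢ pair y
        apart x∈ y∈ x≢y p q = x≢y (arc-disjoint (isArc x∈) (isArc y∈) p q)
        bound′ : ∀ {x} → x ∈ xs → proj₂ x < ∞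
        bound′ {x} x∈ = ℕ.≤∧≢⇒< (≤fromℕ (proj₂ x)) λ e → apart (here refl) (there x∈) (x₀≢ x∈) (∈-pair⁺ (inj₂ refl))
          (subst (_∈ˢ pair x) (toℕ-injective e) (∈-pair⁺ (inj₂ refl)))
        fresh : ∀ {x} → x ∈ xs → Fresh x (leaf c)
        fresh {x} x∈ (here refl) =
          (λ e → apart (here refl) (there x∈) (x₀≢ x∈) (∈-pair⁺ (inj₁ refl)) (∈-pair⁺ (inj₁ e))) ,
          (λ e → apart (here refl) (there x∈) (x₀≢ x∈) (∈-pair⁺ (inj₁ refl)) (∈-pair⁺ (inj₂ e)))
        separate : ∀ {x y} → x ∈ xs → y ∈ xs → x ≢ y → Separate x y
        separate x∈ y∈ x≢y =
          (λ e → clash (∈-pair⁺ (inj₁ e)) (∈-pair⁺ (inj₁ refl))) , (λ e → clash (∈-pair⁺ (inj₂ e)) (∈-pair⁺ (inj₁ refl))) ,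
          (λ e → clash (∈-pair⁺ (inj₁ e)) (∈-pair⁺ (inj₂ refl))) , (λ e → clash (∈-pair⁺ (inj₂ e)) (∈-pair⁺ (inj₂ refl)))
          where
          clash : ∀ {z} → z ∈ˢ pair _ → ¬ z ∈ˢ pair _
          clash = apart (there x∈) (there y∈) x≢y
        allPairs-map-unique : Unique xs → AllPairs Separate xs
        allPairs-map-unique = allPairs-map-∈ separate
        grow : (∃ λ t → Realises (leaf c) ∞ xs t) → Heap
        grow (t , T) = record
          { valid = T.valid ; bound = T.bound
          ; arcs⁺ = λ ax → arcs⁺′ (listed ax)
          ; arcs⁻ = arcs⁻′
          ; order = λ ax ay r → order′ ax ay r (before-total (listed ax) (listed ay) λ { refl → R-acyclic _ [ r ] }) }
          where
          module T = Realises T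
          arcs⁺′ : ∀ {x} → x ∈ x₀ ∷ xs → x ∈ arcs t ∞
          arcs⁺′ (here refl) = here (cong (_, ∞) (sym T.roots))
          arcs⁺′ (there x∈)  = there (T.to x∈)
          arcs⁻′ : ∀ {x} → x ∈ arcs t ∞ → IsArc x
          arcs⁻′ (here refl) = subst (λ u → IsArc (u , ∞)) (sym T.roots) (isArc (here refl))
          arcs⁻′ (there x∈)  = isArc (there (T.from x∈))
          before : ∀ {x y} → Cross x y → Before x y (x₀ ∷ xs) → Before x y (arcs t ∞)
          before c (here y∈) = subst (λ u → Before (u , ∞) _ (arcs t ∞)) T.roots (here (T.to y∈))
          before c (there b) = there (T.order c b)
          order′ : ∀ {x y} → IsArc x → IsArc y → R x y → Before x y (x₀ ∷ xs) ⊎ Before y x (x₀ ∷ xs) → Before x y (arcs t ∞)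
          order′ ax ay r (inj₁ b) = before (R-cross ax ay r) b
          order′ ax ay r (inj₂ b) = contradiction r (allPairs-before (first ∷ linear) b)

    abstract
      heap : Heap
      heap = sort (toposort allArcs R? R-acyclic allArcs-unique)
        where
        sort : (∃ λ ys → Unique ys × (∀ {x} → x ∈ ys → x ∈ allArcs) × (∀ {x} → x ∈ allArcs → x ∈ ys) × Linear ys) → Heap
        sort (ys , u , ⊆ , ⊇ , linear) = build ys u (λ x∈ → ∈-allArcs⁻ (⊆ x∈)) (λ ax → ⊇ (∈-allArcs⁺ ax)) linear

    module Planted (G : Heap) where

      open Heap G public

      letters : ∀ {z} → z ∈ word tree ⇔ (∃ λ (y : Fin N) → z ≡ inject₁ y)
      letters {z} = mk⇔ (λ z∈ → below-∞ z (ℕ.≤-<-trans (≤-last valid z∈) bound)) λ (y , e) → in-word y e (arcs⁺ (arc-isArc z)) (∈-pair⁻ (∈-arc z))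
        where
        in-word : ∀ y → z ≡ inject₁ y → arc z ∈ arcs tree ∞ → z ≡ proj₁ (arc z) ⊎ z ≡ proj₂ (arc z) → z ∈ word tree
        in-word y e (here e′) (inj₁ e₁) = subst (_∈ word tree) (sym (trans e₁ (cong proj₁ e′))) (root∈ tree)
        in-word y e (here e′) (inj₂ e₂) = contradiction (trans (sym (trans e₂ (cong proj₂ e′))) e) fromℕ≢inject₁
        in-word y e (there x∈) (inj₁ e₁) = subst (_∈ word tree) (sym e₁) (proj₁ (inner-∈ valid x∈))
        in-word y e (there x∈) (inj₂ e₂) = subst (_∈ word tree) (sym e₂) (proj₁ (proj₂ (inner-∈ valid x∈)))

-- The bijection and the number of configurations

open import Data.Nat.Base using (_+_; _*_)

open import Data.Integer.Base using (+_)

open Sums using (sumC; g)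
open Catalan using (moment; moment-suc; dbl; dbl≡2*; lassalle≡total)
open Before using (before-asym)
open Trees
open Enum using (allTrees; length-allTrees; allTrees-unique; ∈-allTrees⁺; ∈-allTrees⁻; Sorted)
open Hooks
open Finite
open Represent
open Realise
open Heap
import Function.Construct.Composition as Compose
import Function.Construct.Symmetry as Symmetry

open Equivalence using (to; from)

module _ {M : ℕ} {π π′ : Permutation′ (suc M)} {H : VHC π} {H′ : VHC π′} (π≈ : π Perm.≈ π′) (hooks≡ : hooks H ≡ hooks H′) where

  private
    module C  = Configuration π H
    module C′ = Configuration π′ H′

    height≡ : ∀ i → C.height i ≡ C′.height i
    height≡ i = cong toℕ (π≈ i)

    to-hs : ∀ {h} → h ∈ hooks H → h ∈ hooks H′
    to-hs = subst (_ ∈_) hooks≡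

    from-hs : ∀ {h} → h ∈ hooks H′ → h ∈ hooks H
    from-hs = subst (_ ∈_) (sym hooks≡)

    seen-transfer : ∀ {l c} → C.Seen l c → C′.Seen l c
    seen-transfer (C.sees h∈ p q m) = C′.sees (to-hs h∈) p q
      λ {h′} h′∈ p′ q′ → subst₂ ℕ._≤_ (height≡ _) (height≡ _) (m (from-hs h′∈) p′ q′)
    seen-transfer (C.sky s) = C′.sky λ h∈ → s (from-hs h∈)

    coloured-transfer : ∀ {l c} → C.Coloured l c → C′.Coloured l c
    coloured-transfer (C.top h∈ e)   = C′.top (to-hs h∈) e
    coloured-transfer (C.below s v) = C′.below (λ h∈ → s (from-hs h∈)) (seen-transfer v)

  colour-cong : ∀ v → colour π H v ≡ colour π′ H′ v
  colour-cong v = go (C.labelled v)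
    where
    go : ∀ {v} → C.Labelled v → colour π H v ≡ colour π′ H′ v
    go C.is-∞ = trans C.colour-∞ (sym C′.colour-∞)
    go (C.is-label i) = trans (C.colour-of (C.coloured i))
      (trans (sym (C′.colour-of (coloured-transfer (C.coloured i)))) (cong (λ u → colour π′ H′ (inject₁ u)) (sym (π≈ i))))

  class-transfer : ∀ {B} → ColourClass π H B → ColourClass π′ H′ B
  class-transfer (v , cl) = v , λ w → mk⇔
    (λ w∈ → trans (sym (colour-cong w)) (trans (to (cl w) w∈) (colour-cong v)))
    (λ e → from (cl w) (trans (colour-cong w) (trans e (sym (colour-cong v)))))

  min-transfer : ∀ {B i} → IsMin i (Hat π B) → IsMin i (Hat π′ B)
  min-transfer {B} (p , m) = subst (λ u → inject₁ u ∈ˢ B) (π≈ _) p ,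
    λ j j∈ → m j (subst (λ u → inject₁ u ∈ˢ B) (sym (π≈ j)) j∈)

  α-transfer : ∀ {B C} → C.α′ B C → C′.α′ B C
  α-transfer ((b , c , B≢C , x) , i , j , m , m′ , i<j) =
    (class-transfer b , class-transfer c , B≢C , x) , i , j , min-transfer m , min-transfer m′ , i<j

-- Equal configurations have permutations that agree only pointwise, so `colour` cannot be
-- rewritten. The relational description `Coloured` is carried over instead, and its uniqueness
-- identifies the colours.
Φ-cong : ∀ {M} {V W : VHC[S suc M ]} → Setoid._≈_ VHC[S suc M ]-setoid V W →
  Setoid._≈_ (OrientedPartition-setoid (suc (suc M))) (Φ V) (Φ W)
Φ-cong (π≈ , hooks≡) =
  (λ B → mk⇔ (class-transfer π≈ hooks≡) (class-transfer (λ i → sym (π≈ i)) (sym hooks≡))) ,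
  (λ B C → mk⇔ (α-transfer π≈ hooks≡) (α-transfer (λ i → sym (π≈ i)) (sym hooks≡)))

module _ {M : ℕ} (P : OrientedPartition (suc (suc M))) (isP : IsP̃ᶜ P) (matching : IsMatching (ρ P)) where

  private
    open FromHeap P isP matching
    open Planted heap
    realised : ∃ λ (V : VHC[S suc M ]) → Representation.Represents (proj₁ V) (proj₂ V) tree × (∀ {k} → suc M ≡ 1 + 2 * k → numHooks V ≡ k)
    realised = realise valid letters

  preimage : VHC[S suc M ]
  preimage = proj₁ realised

  numHooks-preimage : ∀ {k} → suc M ≡ 1 + 2 * k → numHooks preimage ≡ k
  numHooks-preimage = proj₂ (proj₂ realised)

  private
    π : Permutation′ (suc M)
    π = proj₁ preimage
    H : VHC π
    H = proj₂ preimage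
    module C = Configuration π H
    module T = Representation.Represented π H (proj₁ (proj₂ realised))
    open IsP̃ᶜ isP
    open IsOrientation isOrientation

  Φ-preimage : Setoid._≈_ (OrientedPartition-setoid (suc (suc M))) (Φ preimage) P
  Φ-preimage = (λ B → mk⇔ ρ⇒ ⇒ρ) , (λ B C → mk⇔ α⇒ ⇒α)
    where
    ρ⇒ : ∀ {B} → C.ρ′ B → ρ P B
    ρ⇒ b = found (T.class⇒arc b)
      where
      found : ∀ {B} → (∃ λ x → x ∈ arcs tree C.∞ × B ≡ pair x) → ρ P B
      found (x , x∈ , e) = subst (ρ P) (sym e) (proj₂ (arcs⁻ x∈))
    ⇒ρ : ∀ {B} → ρ P B → C.ρ′ B
    ⇒ρ b = found (block-arc b)
      where
      found : ∀ {B} → (∃ λ x → IsArc x × B ≡ pair x) → C.ρ′ B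
      found (x , ax , e) = subst C.ρ′ (sym e) (T.arc⇒class (arcs⁺ ax))
    min< : ∀ {x y} → IsArc x → IsArc y → R x y → MinHat< π (pair x) (pair y)
    min< ax ay r = T.before⇒min< (order ax ay r)
    ⇒α : ∀ {B C} → α P B C → C.α′ B C
    ⇒α {B} {C} a = (⇒ρ b , ⇒ρ c , B≢C , x) , found (block-arc b) (block-arc c) a
      where
      b = proj₁ (edge a)
      c = proj₁ (proj₂ (edge a))
      B≢C = proj₁ (proj₂ (proj₂ (edge a)))
      x = proj₂ (proj₂ (proj₂ (edge a)))
      found : ∀ {B C} → (∃ λ x → IsArc x × B ≡ pair x) → (∃ λ x → IsArc x × C ≡ pair x) → α P B C → MinHat< π B C
      found (x , ax , refl) (y , ay , refl) a = min< ax ay a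
    α⇒ : ∀ {B C} → C.α′ B C → α P B C
    α⇒ {B} {C} a′@((b , c , B≢C , x) , _) = choose (oriented (ρ⇒ b , ρ⇒ c , B≢C , x))
      where
      choose : α P B C ⊎ α P C B → α P B C
      choose (inj₁ a) = a
      -- If P oriented the edge the other way, the configuration would give edges in both
      -- directions, hence a first position smaller than itself.
      choose (inj₂ a) = contradiction (C.closure-< (a′ ∷ [ ⇒α a ])) C.irreflexive

module _ (k : ℕ) where

  private
    M N : ℕ
    M = 2 * k
    N = suc M

    V : Setoid _ _
    V = VHC^ k [S N ]-setoid

    Carrier : Set
    Carrier = Setoid.Carrier V

    treeOf : (v : Carrier) → ∃ (Representation.Represents (proj₁ (proj₁ v)) (proj₂ (proj₁ v)))
    treeOf ((π , H) , num) = Representation.represent π H num refl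

  Φ-matching : ∀ (v : Carrier) → IsMatching (ρ (Φ (proj₁ v)))
  Φ-matching v@((π , H) , _) b = found (T.class⇒arc b)
    where
    module T = Representation.Represented π H (proj₂ (treeOf v))
    found : ∀ {B} → (∃ λ x → x ∈ arcs (proj₁ (treeOf v)) (Configuration.∞ π H) × B ≡ pair x) → ∣ B ∣ ≡ 2
    found (x , x∈ , e) = trans (cong ∣_∣ e) (∣pair∣ (T.arc-< x∈))

  same-Φ⇒same-tree : ∀ (v w : Carrier) →
    Setoid._≈_ (OrientedPartition-setoid (suc N)) (Φ (proj₁ v)) (Φ (proj₁ w)) → proj₁ (treeOf v) ≡ proj₁ (treeOf w)
  same-Φ⇒same-tree v@((π , H) , _) w@((π′ , H′) , _) (hρ , hα) =
    represents-injective {π = π} {π′} {H} {H′} (proj₂ (treeOf v)) (proj₂ (treeOf w)) hρ hα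

  same-tree⇒≈ : ∀ (v w : Carrier) → proj₁ (treeOf v) ≡ proj₁ (treeOf w) → Setoid._≈_ V v w
  same-tree⇒≈ v@((π , H) , _) w@((π′ , H′) , _) e = same-tree {π = π} {π′} {H} {H′} (proj₂ (treeOf v))
    (subst (Representation.Represents π′ H′) (sym e) (proj₂ (treeOf w)))

  Φ′ : Bijection V (M̃ᶜ-setoid (suc N))
  Φ′ = record
    { to = λ v → Φ (proj₁ v) , Configuration.Φ-isP̃ᶜ (proj₁ (proj₁ v)) (proj₂ (proj₁ v)) , Φ-matching v
    ; cong = Φ-cong
    ; bijective = (λ {v} {w} e → same-tree⇒≈ v w (same-Φ⇒same-tree v w e)) ,
        λ (P , isP , matching) → (preimage P isP matching , numHooks-preimage P isP matching refl) ,
          λ e → Setoid.trans (OrientedPartition-setoid (suc N)) (Φ-cong e) (Φ-preimage P isP matching) }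

  private
    xs : List (Fin (suc N))
    xs = map inject₁ (allFin N)

    sorted : Sorted xs
    sorted = AllPairs.map⁺ (AllPairs.tabulate⁺-< λ {i} {j} i<j →
      subst₂ ℕ._<_ (sym (toℕ-inject₁ i)) (sym (toℕ-inject₁ j)) i<j)

    length-xs : length xs ≡ N
    length-xs = trans (length-map inject₁ (allFin N)) (length-tabulate {n = N} (λ i → i))

    E : List Tree
    E = allTrees xs

    ∈-xs : ∀ {z} → z ∈ xs ⇔ (∃ λ (y : Fin N) → z ≡ inject₁ y)
    ∈-xs = mk⇔ (λ z∈ → forget (∈-map⁻ inject₁ z∈)) λ { (y , refl) → ∈-map⁺ inject₁ (∈-allFin y) }
      where
      forget : ∀ {z} → (∃ λ y → y ∈ allFin N × z ≡ inject₁ y) → ∃ λ (y : Fin N) → z ≡ inject₁ y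
      forget (y , _ , e) = y , e

    treeOf∈ : ∀ v → proj₁ (treeOf v) ∈ E
    treeOf∈ v@((π , H) , _) = ∈-allTrees⁺ sorted T.valid (Symmetry.⇔-sym ∈-xs Compose.⇔-∘ letters)
      (ℕ.≤-reflexive (trans (Reading.length-word (proj₁ (treeOf v)) T.valid letters) (sym length-xs)))
      where
      module T = Representation.Represented π H (proj₂ (treeOf v))
      letters : ∀ {z} → z ∈ word (proj₁ (treeOf v)) ⇔ (∃ λ (y : Fin N) → z ≡ inject₁ y)
      letters = mk⇔ (λ z∈ → forget (T.∈-label z∈))
        λ { (y , refl) → subst (λ u → inject₁ u ∈ word (proj₁ (treeOf v))) (inverseʳ π) (T.label∈ (π Perm.⟨$⟩ˡ y)) }
        where
        forget : ∀ {z} → (∃ λ i → z ≡ inject₁ (π ⟨$⟩ʳ i)) → ∃ λ (y : Fin N) → z ≡ inject₁ y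
        forget (i , e) = π ⟨$⟩ʳ i , e

    number : Carrier → Fin (length E)
    number v = index (treeOf∈ v)

    lookup-number : ∀ v → proj₁ (treeOf v) ≡ lookup E (number v)
    lookup-number v = lookup-index (treeOf∈ v)

    number-unique : ∀ v i → proj₁ (treeOf v) ≡ lookup E i → number v ≡ i
    number-unique v i e = lookup-injective (allTrees-unique sorted) (trans (sym (lookup-number v)) e)

    -- The tree comes from the parser, which also consumes the proofs carried by a configuration.
    -- Its independence of them is obtained through `Φ`, whose value determines the tree.
    ≈⇒same-tree : ∀ v w → Setoid._≈_ V v w → proj₁ (treeOf v) ≡ proj₁ (treeOf w)
    ≈⇒same-tree v w e = same-Φ⇒same-tree v w (Φ-cong e)

    -- Realising a listed tree gives a configuration that this tree represents; parsing that
    -- configuration returns the same tree, since two trees representing one configuration agree by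
    -- `represents-injective`.
    numbered : ∀ i → ∃ λ v → proj₁ (treeOf v) ≡ lookup E i
    numbered i = choose (realise (proj₁ found) (∈-xs Compose.⇔-∘ proj₂ found))
      where
      found : Valid (lookup E i) × (∀ {z} → z ∈ word (lookup E i) ⇔ z ∈ xs)
      found = ∈-allTrees⁻ sorted (∈-lookup {xs = E} i)
      choose : (∃ λ (V : VHC[S N ]) → Representation.Represents (proj₁ V) (proj₂ V) (lookup E i) × (∀ {k} → N ≡ 1 + 2 * k → numHooks V ≡ k)) →
        ∃ λ v → proj₁ (treeOf v) ≡ lookup E i
      choose ((π , H) , T , num) = v , represents-injective {π = π} {π} {H} {H} (proj₂ (treeOf v)) T
          (λ B → mk⇔ (λ p → p) (λ p → p)) (λ B C → mk⇔ (λ p → p) (λ p → p))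
        where
        v : Carrier
        v = (π , H) , num refl

  enumeration : HasCardinality V (length E)
  enumeration = record
    { to = number
    ; cong = λ {v} {w} e → number-unique v (number w) (trans (≈⇒same-tree v w e) (lookup-number w))
    ; bijective = (λ {v} {w} e → same-tree⇒≈ v w (trans (lookup-number v) (trans (cong (lookup E) e) (sym (lookup-number w))))) ,
        λ i → proj₁ (numbered i) , λ {w} e → number-unique w i (trans (≈⇒same-tree w (proj₁ (numbered i)) e) (proj₂ (numbered i))) }

  length-E : + length E ≡ lassalle (suc k)
  length-E = trans (length-allTrees xs) (trans (cong (λ n → sumC n (g n)) length-xs)
    (trans (cong (λ n → sumC n (g N)) (cong suc (sym (dbl≡2* k))))
      (sym (lassalle≡total N (suc k) k ℕ.≤-refl (ℕ.≤-reflexive (cong suc (dbl≡2* k)))))))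

corollary5p5 : (k : ℕ) →
    (∀ (H : VHC[S 1 + 2 * k ]) → IsP̃ᶜ (Φ H)) ×
    (Σ[ Φ′ ∈ Bijection (VHC^ k [S 1 + 2 * k ]-setoid) (M̃ᶜ-setoid (2 + 2 * k)) ]
    (∀ (H : Setoid.Carrier (VHC^ k [S 1 + 2 * k ]-setoid)) →
    Setoid._≈_ (OrientedPartition-setoid (2 + 2 * k)) (proj₁ (Bijection.to Φ′ H)) (Φ (proj₁ H)))) ×
    (∃[ m ] (HasCardinality (VHC^ k [S 1 + 2 * k ]-setoid) m × + m ≡ lassalle (suc k)))
corollary5p5 k = (λ (π , H) → Configuration.Φ-isP̃ᶜ π H) ,
  (Φ′ k , λ H → Setoid.refl (OrientedPartition-setoid (2 + 2 * k))) ,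
  (_ , enumeration k , length-E k)
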